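{- Let $n>1$ and $d\geq 3$ be integers with $\gcd(n,d)=1$, and let $a,b$ be indeterminates. Then \[ \sum_{k=0}^{n-1}[2dk-1]\frac{(aq^{ -1},q^{ -1}/a,bq^{ -1},q^{ -1}/b;q^d)_k(q^{ -1};q^d)_k^2}{(aq^d,q^d/a,bq^d,q^d/b;q^d)_k(q^d;q^d)_k^2}q^{(2d+3)k} \equiv\begin{cases}0 \pmod{[n]\Phi_n(q)}, &\text{if }n\equiv 1\pmod{d},\\[5pt] 0 \pmod{[n]},&\text{otherwise}. \end{cases} \]
   Context: For an integer $m$, $[m]=[m]_q=(1-q^m)/(1-q)$ denotes the $q$-integer (so $[-1]=-q^{ -1}$). The $q$-shifted factorial is $(x;q)_0=1$ and $(x;q)_k=(1-x)(1-xq)\cdots(1-xq^{k-1})$ for $k\geq1$, with $(x_1,\dots,x_m;q)_k=(x_1;q)_k\cdots(x_m;q)_k$. $\Phi_n(q)$ is the $n$-th cyclotomic polynomial in $q$. For rational functions $A,B$ in $q$ (with coefficients involving the indeterminates $a,b$) and a polynomial $P(q)$, $A\equiv B\pmod{P(q)}$ means that the numerator of $A-B$ (in reduced form) is divisible by $P(q)$ and its denominator is coprime to $P(q)$. -}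

module Defs where

open import Data.Nat as ℕ using (ℕ; zero; suc)
open import Data.Nat.Divisibility using (_∣?_)
open import Data.Integer as ℤ using (ℤ; +_; -[1+_])
open import Data.List using (List; []; _∷_; map; length; foldr; filter; _++_)
open import Data.List.Relation.Unary.All using (All)
open import Data.Product using (_×_; _,_; Σ; proj₁; proj₂)
open import Relation.Binary.PropositionalEquality using (_≡_)
open import Relation.Nullary using (¬_; does)
open import Data.Bool using (if_then_else_)

-- Dense multivariate polynomials with integer coefficients.
-- Poly 0 = ℤ ; Poly (suc k) = coefficient lists (lowest degree first)
-- with coefficients in Poly k.  Poly 3 = ℤ[b][a][q]  (outer variable q).

Poly : ℕ → Set
Poly zero    = ℤ
Poly (suc k) = List (Poly k)

zeroP : ∀ k → Poly k
zeroP zero    = + 0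
zeroP (suc k) = []

constP : ∀ k → ℤ → Poly k
constP zero    c = c
constP (suc k) c = constP k c ∷ []

oneP : ∀ k → Poly k
oneP k = constP k (+ 1)

addP : ∀ k → Poly k → Poly k → Poly k
addP zero    x        y        = x ℤ.+ y
addP (suc k) []       ys       = ys
addP (suc k) (x ∷ xs) []       = x ∷ xs
addP (suc k) (x ∷ xs) (y ∷ ys) = addP k x y ∷ addP (suc k) xs ys

negP : ∀ k → Poly k → Poly k
negP zero    x        = ℤ.- x
negP (suc k) []       = []
negP (suc k) (x ∷ xs) = negP k x ∷ negP (suc k) xs

subP : ∀ k → Poly k → Poly k → Poly k
subP k x y = addP k x (negP k y)

scaleP : ∀ k → Poly k → Poly (suc k) → Poly (suc k)
mulP : ∀ k → Poly k → Poly k → Poly k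
scaleP k c []       = []
scaleP k c (y ∷ ys) = mulP k c y ∷ scaleP k c ys
mulP zero    x        y  = x ℤ.* y
mulP (suc k) []       ys = []
mulP (suc k) (x ∷ xs) ys = addP (suc k) (scaleP k x ys) (zeroP k ∷ mulP (suc k) xs ys)

powP : ∀ k → Poly k → ℕ → Poly k
powP k x zero    = oneP k
powP k x (suc n) = mulP k x (powP k x n)

-- Zero test / equality of polynomials (up to trailing zero coefficients).
IsZero : ∀ k → Poly k → Set
IsZero zero    x  = x ≡ + 0
IsZero (suc k) xs = All (IsZero k) xs

_≈P_ : ∀ {k} → Poly k → Poly k → Set
_≈P_ {k} x y = IsZero k (subP k x y)

P1 : Set
P1 = Poly 1

headZ : P1 → ℤ
headZ []      = + 0
headZ (x ∷ _) = x

tailZ : P1 → P1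
tailZ []       = []
tailZ (_ ∷ xs) = xs

trim : P1 → P1
trim []       = []
trim (x ∷ xs) with trim xs
... | []     = if does (x ℤ.≟ + 0) then [] else (x ∷ [])
... | y ∷ ys = x ∷ y ∷ ys

-- Exact division p / g of polynomials in ℤ[q], for g with constant term ±1,
-- computed by power-series division from the lowest coefficient upwards.
divLow : ℕ → P1 → P1 → P1
divLow zero    p g = []
divLow (suc f) p g =
  let c = headZ g ℤ.* headZ p in
  c ∷ divLow f (tailZ (subP 1 p (scaleP 0 c g))) g

exactDiv : P1 → P1 → P1
exactDiv p g = trim (divLow (suc (length p ℕ.∸ length g)) p g)

qvar1 : P1
qvar1 = + 0 ∷ + 1 ∷ []

-- product of the Φ_d (from the list of already computed pairs (d , Φ_d)) with d ∣ m
prodDivs : ℕ → List (ℕ × P1) → P1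
prodDivs m prev =
  foldr (λ dp acc → mulP 1 (proj₂ dp) acc) (oneP 1)
        (filter (λ dp → proj₁ dp ∣? m) prev)

cycloStep : ℕ → List (ℕ × P1) → P1
cycloStep m prev = exactDiv (subP 1 (powP 1 qvar1 m) (oneP 1)) (prodDivs m prev)

cyclos : ℕ → List (ℕ × P1)
cyclos zero    = []
cyclos (suc n) = cyclos n ++ ((suc n , cycloStep (suc n) (cyclos n)) ∷ [])

-- The n-th cyclotomic polynomial Φ_n(q)  (n ≥ 1; Φ_0 is set to 1, unused).
Φ : ℕ → P1
Φ zero    = oneP 1
Φ (suc n) = cycloStep (suc n) (cyclos n)

qintPoly : ℕ → P1
qintPoly zero    = []
qintPoly (suc n) = addP 1 (qintPoly n) (powP 1 qvar1 n)

P3 : Set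
P3 = Poly 3

embed1 : P1 → P3
embed1 p = map (constP 2) p

constQ : Poly 2 → P3
constQ c = c ∷ []

qP aP bP : P3
qP = zeroP 2 ∷ oneP 2 ∷ []
aP = (zeroP 1 ∷ oneP 1 ∷ []) ∷ []
bP = ((+ 0 ∷ + 1 ∷ []) ∷ []) ∷ []

-- formal fractions numerator / denominator (denominators nonzero in all uses)
Frac : Set
Frac = P3 × P3

fromP : P3 → Frac
fromP p = p , oneP 3

infixl 6 _+F_ _-F_
infixl 7 _*F_ _/F_

_+F_ : Frac → Frac → Frac
(a , b) +F (c , d) = addP 3 (mulP 3 a d) (mulP 3 c b) , mulP 3 b d

_-F_ : Frac → Frac → Frac
(a , b) -F (c , d) = subP 3 (mulP 3 a d) (mulP 3 c b) , mulP 3 b d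

_*F_ : Frac → Frac → Frac
(a , b) *F (c , d) = mulP 3 a c , mulP 3 b d

_/F_ : Frac → Frac → Frac
(a , b) /F (c , d) = mulP 3 a d , mulP 3 b c

invF : Frac → Frac
invF (a , b) = b , a

0F 1F qF aF bF : Frac
0F = fromP (zeroP 3)
1F = fromP (oneP 3)
qF = fromP qP
aF = fromP aP
bF = fromP bP

powF : Frac → ℕ → Frac
powF x zero    = 1F
powF x (suc n) = x *F powF x n

zpowF : Frac → ℤ → Frac
zpowF x (+ n)    = powF x n
zpowF x -[1+ n ] = powF (invF x) (suc n)

qint : ℤ → Frac
qint m = (1F -F zpowF qF m) /F (1F -F qF)

qpoch : Frac → Frac → ℕ → Frac
qpoch x p zero    = 1F
qpoch x p (suc k) = qpoch x p k *F (1F -F (x *F powF p k))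

sumF : ℕ → (ℕ → Frac) → Frac
sumF zero    f = 0F
sumF (suc n) f = sumF n f +F f n

summand : ℕ → ℕ → Frac
summand d k =
  let qd   = powF qF d
      qi   = invF qF
      num  = qpoch (aF *F qi) qd k *F qpoch (qi /F aF) qd k
             *F qpoch (bF *F qi) qd k *F qpoch (qi /F bF) qd k
             *F qpoch qi qd k *F qpoch qi qd k
      den  = qpoch (aF *F qd) qd k *F qpoch (qd /F aF) qd k
             *F qpoch (bF *F qd) qd k *F qpoch (qd /F bF) qd k
             *F qpoch qd qd k *F qpoch qd qd k
  in qint ((+ (2 ℕ.* d ℕ.* k)) ℤ.- + 1) *F (num /F den)
     *F powF qF ((2 ℕ.* d ℕ.+ 3) ℕ.* k)

lhs : ℕ → ℕ → Frac
lhs n d = sumF n (summand d)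

-- V and P are coprime in ℚ(a,b)[q]  (Bézout: X V + Y P is a nonzero element of ℤ[a,b])
CoprimeQ : P3 → P3 → Set
CoprimeQ V P = Σ P3 λ X → Σ P3 λ Y → Σ (Poly 2) λ c →
  (¬ (c ≈P zeroP 2)) × (addP 3 (mulP 3 X V) (mulP 3 Y P) ≈P constQ c)

-- A ≡ 0 (mod P):  A = P U / V with V coprime to P  (equivalently: the reduced
-- numerator of A is divisible by P and the reduced denominator is coprime to P)
≡0mod : Frac → P3 → Set
≡0mod (N , D) P = Σ P3 λ U → Σ P3 λ V →
  CoprimeQ V P × (mulP 3 N V ≈P mulP 3 (mulP 3 P U) D)

{-# OPTIONS --safe #-}

-- Put p = q^d and r = q⁻¹, and let f_j(k) be the product over l < j of (1 − p^(l−k))(1 − r p^(k+l)),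
-- a polynomial of degree j in p^(−k) + r p^k.  By the q-Saalschütz sum,
--   (br, r/b; p)_k (qp)^k / (pb, p/b; p)_k = Σ_j w_j(b) f_j(k),   w_j(b) = (qp; p)_j p^j / (p, pb, p/b; p)_j,
-- so the sum in question is a combination, with coefficients w_i(a) w_j(b), of the moments
-- Σ_k [2dk−1] q^k (r; p)_k² / (p; p)_k² f_i(k) f_j(k), in which a and b no longer occur.
-- Since f_i f_j is a combination of f_max(i,j), …, f_(i+j), only the moments of a single f_l matter.
-- These telescope: up to units and integral factors they are z² / (1 − q^(dl−1)), where
-- z = (r; p)_n / (p; p)_(n−1) is divisible by [n].  One of the two factors [n] pays for the denominator;
-- the factor Φ_n of the other one survives unless n ∣ dl − 1.  If n = dt + 1, then w_j is divisible by Φ_n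
-- for t ≤ j < n, while for i, j < t only l ≤ 2t − 2 occur, and for those n ∤ dl − 1.
-- All integrality statements amount to counting, for each m ∣ n, the factors 1 − q^j with m ∣ j,
-- because 1 − q^j is the product of the pairwise coprime Φ_m with m ∣ j.

module Submission where

open import Algebra.Bundles using (CommutativeRing; AbelianGroup)
import Algebra.Properties.AbelianGroup as AbelianGroupProperties
import Algebra.Properties.CommutativeSemigroup as CommutativeSemigroupProperties
import Algebra.Properties.Ring as RingProperties
open import Data.Empty using (⊥-elim)
import Data.Integer.Properties as ℤₚ
import Data.Integer.Tactic.RingSolver as ℤ-Solver
open import Data.List.Base using ([]; _∷_; length; _++_)
open import Data.List.Relation.Unary.All as All using ([]; _∷_; All)
open import Data.List.Relation.Unary.All.Properties using (++⁺)
open import Data.Maybe.Base using (Maybe; just; nothing)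
open import Data.Nat.Base as ℕ using (zero; suc; ℕ; _<_; s≤s; z≤n; pred; _≤_; _∸_)
import Data.Nat.Coprimality as ℕC
open import Data.Nat.Divisibility as ℕ∣ using (_∣_; ∣-refl; 1∣_; _∣?_; divides; ∣-trans)
open import Data.Nat.GCD using (gcd; gcd-GCD; gcd[m,n]∣m; gcd[m,n]∣n; module Bézout)
import Data.Nat.Properties as ℕₚ
open import Data.Nat.Tactic.RingSolver using (solve-∀)
open import Data.Product using (_,_; ∃; proj₂; _×_; ∃₂; proj₁)
open import Level using (0ℓ)
open import Relation.Binary.Definitions using (tri<; tri≈; tri>)
open import Relation.Binary.PropositionalEquality as ≡ using (_≡_)
import Relation.Binary.Reasoning.Setoid as SetoidReasoning
open import Relation.Binary.Structures using (IsEquivalence)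
open import Relation.Nullary using (yes; no; ¬_; contradiction; Dec)

-- The argument of the sum splits as q^((2d+3)k) = q^k (qp)^k (qp)^k. Each of the pairs a, 1/a and
-- b, 1/b takes one factor (qp)^k and so becomes the value of a balanced terminating sum; the
-- remaining q^k is the one for which the moments telescope.
--
-- Denominators are the main obstacle. All divisibility is stated in the ring O of fractions whose
-- denominator is coprime to [n] Φ_n over ℚ(a,b). There 1 - a q^j and a - q^j are units, because
-- modulo 1 - q^n they divide the nonzero constants 1 - a^n and a^n - 1; so is every Φ_m with m = 1
-- or m not dividing n. The condition d ≥ 3 is decisive where n ∣ dl - 1 with 0 < l ≤ 2t - 2 would
-- force dl - 1 = n = dt + 1, hence d ∣ 2.
--
-- The other obstacle is that Φ_n is the output of an algorithm, a power-series division by a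
-- product of its predecessors. Its exactness and the coprimality of the Φ_m go hand in hand in one
-- induction. Coprimality over ℚ gives divisibility only of an integer multiple, and the integer is
-- cancelled because the divisors have constant term 1 or -1.

-- A ring solver with integer coefficients for every commutative ring.

module Solver (R : CommutativeRing 0ℓ 0ℓ) where

  open import Data.Integer.Base as ℤ using (ℤ; +_; -[1+_]; +[1+_])
  open import Algebra.Solver.Ring.AlmostCommutativeRing
  open CommutativeRing R
  open import Algebra.Properties.Ring ring
  open import Algebra.Properties.AbelianGroup +-abelianGroup
  open import Algebra.Properties.Semiring.Mult.TCOptimised semiring renaming (_×_ to _·_)
  open import Relation.Binary.Reasoning.Setoid setoid

  -- The solver takes its coefficients from ℤ through this homomorphism, so that they can be
  -- compared although equality in the ring itself need not be decidable.
  fromℤ : ℤ → Carrier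
  fromℤ (+ n)    = n · 1#
  fromℤ -[1+ n ] = - (suc n · 1#)

  fromℤ-neg : ∀ i → fromℤ (ℤ.- i) ≈ - fromℤ i
  fromℤ-neg (+ zero)  = sym -0#≈0#
  fromℤ-neg +[1+ n ]  = refl
  fromℤ-neg -[1+ n ]  = sym (-‿involutive _)

  private
    cancelˡ : ∀ x y z → (x + y) - (x + z) ≈ y - z
    cancelˡ x y z = begin
      (x + y) + - (x + z)    ≈⟨ +-cong (+-comm x y) (sym (⁻¹-∙-comm x z)) ⟩
      (y + x) + (- x + - z)  ≈⟨ +-assoc y x _ ⟩
      y + (x + (- x + - z))  ≈⟨ +-congˡ (sym (+-assoc x (- x) (- z))) ⟩
      y + ((x + - x) + - z)  ≈⟨ +-congˡ (trans (+-congʳ (-‿inverseʳ x)) (+-identityˡ _)) ⟩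
      y - z ∎

  fromℤ-⊖ : ∀ m n → fromℤ (m ℤ.⊖ n) ≈ m · 1# - n · 1#
  fromℤ-⊖ m       zero    = sym (trans (+-congˡ -0#≈0#) (+-identityʳ _))
  fromℤ-⊖ zero    (suc n) = sym (+-identityˡ _)
  fromℤ-⊖ (suc m) (suc n) = begin
    fromℤ (suc m ℤ.⊖ suc n)  ≡⟨ ≡.cong fromℤ (ℤₚ.[1+m]⊖[1+n]≡m⊖n m n) ⟩
    fromℤ (m ℤ.⊖ n)          ≈⟨ fromℤ-⊖ m n ⟩
    m · 1# - n · 1#          ≈⟨ sym (cancelˡ 1# _ _) ⟩
    (1# + m · 1#) - (1# + n · 1#) ≈⟨ sym (+-cong (1+× m 1#) (-‿cong (1+× n 1#))) ⟩
    suc m · 1# - suc n · 1#  ∎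

  fromℤ-+ : ∀ i j → fromℤ (i ℤ.+ j) ≈ fromℤ i + fromℤ j
  fromℤ-+ (+ m)    (+ n)    = ×-homo-+ 1# m n
  fromℤ-+ (+ m)    -[1+ n ] = fromℤ-⊖ m (suc n)
  fromℤ-+ -[1+ m ] (+ n)    = trans (fromℤ-⊖ n (suc m)) (+-comm _ _)
  fromℤ-+ -[1+ m ] -[1+ n ] = begin
    - (suc (suc (m ℕ.+ n)) · 1#)  ≡⟨ ≡.cong (λ k → - (suc k · 1#)) (≡.sym (ℕₚ.+-suc m n)) ⟩
    - ((suc m ℕ.+ suc n) · 1#)    ≈⟨ -‿cong (×-homo-+ 1# (suc m) (suc n)) ⟩
    - (suc m · 1# + suc n · 1#)   ≈⟨ sym (⁻¹-∙-comm _ _) ⟩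
    - (suc m · 1#) - suc n · 1#   ∎

  private
    fromℤ-*-pos : ∀ m j → fromℤ (+ m ℤ.* j) ≈ m · 1# * fromℤ j
    fromℤ-*-pos m (+ n) = begin
      fromℤ (+ m ℤ.* + n)  ≡⟨ ≡.cong fromℤ (≡.sym (ℤₚ.pos-* m n)) ⟩
      (m ℕ.* n) · 1#       ≈⟨ ×1-homo-* m n ⟩
      m · 1# * n · 1#      ∎
    fromℤ-*-pos m -[1+ n ] = begin
      fromℤ (+ m ℤ.* ℤ.- (+ suc n))  ≡⟨ ≡.cong fromℤ (≡.sym (ℤₚ.neg-distribʳ-* (+ m) (+ suc n))) ⟩
      fromℤ (ℤ.- (+ m ℤ.* + suc n))  ≈⟨ fromℤ-neg (+ m ℤ.* + suc n) ⟩
      - fromℤ (+ m ℤ.* + suc n)      ≈⟨ -‿cong (fromℤ-*-pos m (+ suc n)) ⟩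
      - (m · 1# * suc n · 1#)        ≈⟨ -‿distribʳ-* _ _ ⟩
      m · 1# * - (suc n · 1#)        ∎

  fromℤ-* : ∀ i j → fromℤ (i ℤ.* j) ≈ fromℤ i * fromℤ j
  fromℤ-* (+ m)    j = fromℤ-*-pos m j
  fromℤ-* -[1+ m ] j = begin
    fromℤ (ℤ.- (+ suc m) ℤ.* j)  ≡⟨ ≡.cong fromℤ (≡.sym (ℤₚ.neg-distribˡ-* (+ suc m) j)) ⟩
    fromℤ (ℤ.- (+ suc m ℤ.* j))  ≈⟨ fromℤ-neg (+ suc m ℤ.* j) ⟩
    - fromℤ (+ suc m ℤ.* j)      ≈⟨ -‿cong (fromℤ-*-pos (suc m) j) ⟩
    - (suc m · 1# * fromℤ j)     ≈⟨ -‿distribˡ-* _ _ ⟩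
    fromℤ -[1+ m ] * fromℤ j     ∎

  private
    ℤ⟶R : ℤ.+-*-rawRing -Raw-AlmostCommutative⟶ fromCommutativeRing R
    ℤ⟶R = record
      { ⟦_⟧ = fromℤ ; +-homo = fromℤ-+ ; *-homo = fromℤ-* ; -‿homo = fromℤ-neg
      ; 0-homo = refl ; 1-homo = refl }

    _≟_ : ∀ i j → Maybe (fromℤ i ≈ fromℤ j)
    i ≟ j with i ℤₚ.≟ j
    ... | yes i≡j = just (reflexive (≡.cong fromℤ i≡j))
    ... | no  _   = nothing

  open import Algebra.Solver.Ring ℤ.+-*-rawRing (fromCommutativeRing R) ℤ⟶R _≟_ public
    using (Polynomial; solve; _:=_; _:+_; _:*_; _:-_; :-_; _:^_; con)

  :1 : ∀ {n} → Polynomial n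
  :1 = con (+ 1)

-- Finite sums, finite products and powers in a commutative ring.

module BigOp (R : CommutativeRing 0ℓ 0ℓ) where

  open import Data.Sum using (inj₁; inj₂)
  open CommutativeRing R
  open import Algebra.Properties.CommutativeSemigroup *-commutativeSemigroup using (interchange)
  import Algebra.Properties.CommutativeSemigroup +-commutativeSemigroup as +-CSG
  open import Algebra.Properties.Semiring.Exp semiring public
  open import Relation.Binary.Reasoning.Setoid setoid

  sum : ℕ → (ℕ → Carrier) → Carrier
  sum zero    f = 0#
  sum (suc n) f = sum n f + f n

  prod : ℕ → (ℕ → Carrier) → Carrier
  prod zero    f = 1#
  prod (suc n) f = prod n f * f n

  sum-cong< : ∀ n {f g} → (∀ i → i < n → f i ≈ g i) → sum n f ≈ sum n g
  sum-cong< zero    e = refl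
  sum-cong< (suc n) e = +-cong (sum-cong< n λ i i<n → e i (ℕₚ.m<n⇒m<1+n i<n)) (e n ℕₚ.≤-refl)

  sum-cong : ∀ n {f g} → (∀ i → f i ≈ g i) → sum n f ≈ sum n g
  sum-cong n e = sum-cong< n λ i _ → e i

  sum-zero : ∀ n → sum n (λ _ → 0#) ≈ 0#
  sum-zero zero    = refl
  sum-zero (suc n) = trans (+-identityʳ _) (sum-zero n)

  sum-+ : ∀ n f g → sum n (λ i → f i + g i) ≈ sum n f + sum n g
  sum-+ zero    f g = sym (+-identityʳ 0#)
  sum-+ (suc n) f g = trans (+-congʳ (sum-+ n f g)) (+-CSG.interchange _ _ _ _)

  *-sum : ∀ n c f → c * sum n f ≈ sum n (λ i → c * f i)
  *-sum zero    c f = zeroʳ c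
  *-sum (suc n) c f = trans (distribˡ c _ _) (+-congʳ (*-sum n c f))

  sum-* : ∀ n f c → sum n f * c ≈ sum n (λ i → f i * c)
  sum-* n f c = trans (*-comm _ c) (trans (*-sum n c f) (sum-cong n λ i → *-comm c (f i)))

  sum-swap : ∀ m n (f : ℕ → ℕ → Carrier) →
    sum m (λ i → sum n (f i)) ≈ sum n (λ j → sum m (λ i → f i j))
  sum-swap zero    n f = sym (sum-zero n)
  sum-swap (suc m) n f = trans (+-congʳ (sum-swap m n f)) (sym (sum-+ n _ (f m)))

  prod-cong< : ∀ n {f g} → (∀ i → i < n → f i ≈ g i) → prod n f ≈ prod n g
  prod-cong< zero    e = refl
  prod-cong< (suc n) e = *-cong (prod-cong< n λ i i<n → e i (ℕₚ.m<n⇒m<1+n i<n)) (e n ℕₚ.≤-refl)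

  prod-cong : ∀ n {f g} → (∀ i → f i ≈ g i) → prod n f ≈ prod n g
  prod-cong n e = prod-cong< n λ i _ → e i

  prod-* : ∀ n f g → prod n (λ i → f i * g i) ≈ prod n f * prod n g
  prod-* zero    f g = sym (*-identityʳ 1#)
  prod-* (suc n) f g = trans (*-congʳ (prod-* n f g)) (interchange _ _ _ _)

  prod-one : ∀ n {f} → (∀ i → i < n → f i ≈ 1#) → prod n f ≈ 1#
  prod-one zero    e = refl
  prod-one (suc n) e = trans (*-cong (prod-one n λ i i<n → e i (ℕₚ.m<n⇒m<1+n i<n)) (e n ℕₚ.≤-refl)) (*-identityʳ 1#)

  prod-zero : ∀ n {f} i → i < n → f i ≈ 0# → prod n f ≈ 0#
  prod-zero (suc n) i (s≤s i≤n) e with ℕₚ.m≤n⇒m<n∨m≡n i≤n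
  ... | inj₁ i<n    = trans (*-congʳ (prod-zero n i i<n e)) (zeroˡ _)
  ... | inj₂ ≡.refl = trans (*-congˡ e) (zeroʳ _)

  prod-single : ∀ n {f} i → i < n → (∀ j → ¬ j ≡ i → f j ≈ 1#) → prod n f ≈ f i
  prod-single (suc n) i (s≤s i≤n) e with ℕₚ.m≤n⇒m<n∨m≡n i≤n
  ... | inj₁ i<n    = trans (*-cong (prod-single n i i<n e) (e n λ n≡i → ℕₚ.<⇒≢ i<n (≡.sym n≡i))) (*-identityʳ _)
  ... | inj₂ ≡.refl = trans (*-congʳ (prod-one n λ j j<n → e j (ℕₚ.<⇒≢ j<n))) (*-identityˡ _)

  prod-sucˡ : ∀ n f → prod (suc n) f ≈ f 0 * prod n (λ i → f (suc i))
  prod-sucˡ zero    f = *-comm 1# (f 0)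
  prod-sucˡ (suc n) f = trans (*-congʳ (prod-sucˡ n f)) (*-assoc _ _ _)

  prod-^ : ∀ n x → prod n (λ _ → x) ≈ x ^ n
  prod-^ zero    x = refl
  prod-^ (suc n) x = trans (*-congʳ (prod-^ n x)) (*-comm _ x)

  1^ : ∀ n → 1# ^ n ≈ 1#
  1^ zero    = refl
  1^ (suc n) = trans (*-identityˡ _) (1^ n)

  ^-*-distrib : ∀ x y n → (x * y) ^ n ≈ x ^ n * y ^ n
  ^-*-distrib x y zero    = sym (*-identityʳ 1#)
  ^-*-distrib x y (suc n) = trans (*-congˡ (^-*-distrib x y n)) (interchange _ _ _ _)

  ^-inverse : ∀ {x y} → x * y ≈ 1# → ∀ n → x ^ n * y ^ n ≈ 1#
  ^-inverse {x} {y} e n = trans (sym (^-*-distrib x y n)) (trans (^-congˡ n e) (1^ n))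

-- Basic hypergeometric identities in the base p.

module QSeries (K : CommutativeRing 0ℓ 0ℓ) where

  open CommutativeRing K
  open import Algebra.Properties.Ring ring using (x∙y⁻¹≈ε⇒x≈y)
  open import Relation.Binary.Reasoning.Setoid setoid
  open Solver K
  open BigOp K

  -- The certificate of the telescoping in saalschütz, with J = p^(N+1), X = p^(k+1).
  certificate : ∀ J X Y r′ s u → X * Y ≈ 1# → s * r′ ≈ 1# →
    (1# - r′ * X * X) * ((1# - s * J) * (1# - J * Y) * (1# - r′ * X * J) - (1# - J) * (1# - u * J + J * J))
    ≈ J * ((1# - u * X + X * X) * (1# - Y) * (1# - r′ * X * J)
           - s * (1# - u * (r′ * X) + r′ * X * (r′ * X)) * (1# - J * Y) * (1# - r′ * X))
  certificate J X Y r′ s u XY≈1 sr′≈1 = begin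
    (1# - r′ * X * X) * ((1# - s * J) * (1# - J * Y) * (1# - r′ * X * J) - (1# - J) * (1# - u * J + J * J))
      -- The relations `X * Y ≈ 1#` and `s * r′ ≈ 1#` pull `s` out of `1# - s * J` and `Y` out of
      -- `1# - J * Y`, and give the other product the same weight. What remains is a polynomial
      -- identity in six free variables.
      ≈⟨ *-congˡ (+-cong (*-congʳ (*-cong 1-sJ (1-JY J))) (-‿cong (sym (scale _)))) ⟩
    (1# - r′ * X * X) * (s * (r′ - J) * ((X - J) * Y) * (1# - r′ * X * J) - s * r′ * (X * Y) * ((1# - J) * (1# - u * J + J * J)))
      ≈⟨ solve 6 (λ J X Y r′ s u →
           (:1 :- r′ :* X :* X) :* (s :* (r′ :- J) :* ((X :- J) :* Y) :* (:1 :- r′ :* X :* J)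
             :- s :* r′ :* (X :* Y) :* ((:1 :- J) :* (:1 :- u :* J :+ J :* J)))
           := J :* (s :* r′ :* ((:1 :- u :* X :+ X :* X) :* ((X :- :1) :* Y) :* (:1 :- r′ :* X :* J))
             :- s :* (:1 :- u :* (r′ :* X) :+ r′ :* X :* (r′ :* X)) :* ((X :- J) :* Y) :* (:1 :- r′ :* X)))
         refl J X Y r′ s u ⟩
    J * (s * r′ * ((1# - u * X + X * X) * ((X - 1#) * Y) * (1# - r′ * X * J))
         - s * (1# - u * (r′ * X) + r′ * X * (r′ * X)) * ((X - J) * Y) * (1# - r′ * X))
      ≈⟨ *-congˡ (+-cong (trans (*-congʳ sr′≈1) (trans (*-identityˡ _) (*-congʳ (*-congˡ (sym 1-Y)))))
           (-‿cong (*-congʳ (*-congˡ (sym (1-JY J)))))) ⟩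
    J * ((1# - u * X + X * X) * (1# - Y) * (1# - r′ * X * J)
           - s * (1# - u * (r′ * X) + r′ * X * (r′ * X)) * (1# - J * Y) * (1# - r′ * X)) ∎
    where
    1-JY : ∀ J → 1# - J * Y ≈ (X - J) * Y
    1-JY J = trans (+-congʳ (sym XY≈1)) (solve 3 (λ J X Y → X :* Y :- J :* Y := (X :- J) :* Y) refl J X Y)
    1-Y : 1# - Y ≈ (X - 1#) * Y
    1-Y = trans (+-congˡ (-‿cong (sym (*-identityˡ Y)))) (1-JY 1#)
    1-sJ : 1# - s * J ≈ s * (r′ - J)
    1-sJ = trans (+-congʳ (sym sr′≈1)) (solve 3 (λ J r′ s → s :* r′ :- s :* J := s :* (r′ :- J)) refl J r′ s)
    scale : ∀ x → s * r′ * (X * Y) * x ≈ x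
    scale x = trans (*-congʳ (trans (*-cong sr′≈1 XY≈1) (*-identityʳ 1#))) (*-identityˡ x)

  module Basis (p p⁻ r q : Carrier) (pp⁻≈1 : p * p⁻ ≈ 1#) (qr≈1 : q * r ≈ 1#) where

    -- φ m k = p^m (λ_m − λ_k) with λ_k = p^(−k) + r p^k, so basis i is a polynomial of degree i in λ_k.
    φ : ℕ → ℕ → Carrier
    φ m k = (1# - p ^ m * p⁻ ^ k) * (1# - r * p ^ m * p ^ k)

    basis : ℕ → ℕ → Carrier
    basis j k = prod j (λ l → φ l k)

    p^p⁻^ : ∀ n → p ^ n * p⁻ ^ n ≈ 1#
    p^p⁻^ = ^-inverse pp⁻≈1

    basis-vanishes : ∀ {j k} → k < j → basis j k ≈ 0#
    basis-vanishes {j} {k} k<j = prod-zero j k k<j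
      (trans (*-congʳ (trans (+-congˡ (-‿cong (p^p⁻^ k))) (-‿inverseʳ 1#))) (zeroˡ _))

    shift-p⁻ : ∀ m k → 1# - p ^ m * p⁻ ^ k ≈ 1# - p ^ suc m * p⁻ ^ suc k
    shift-p⁻ m k = +-congˡ (-‿cong (begin
      p ^ m * p⁻ ^ k             ≈⟨ *-identityˡ _ ⟨
      1# * (p ^ m * p⁻ ^ k)      ≈⟨ *-congʳ pp⁻≈1 ⟨
      p * p⁻ * (p ^ m * p⁻ ^ k)  ≈⟨ solve 4 (λ a b c d → a :* b :* (c :* d) := a :* c :* (b :* d)) refl _ _ _ _ ⟩
      p * p ^ m * (p⁻ * p⁻ ^ k)  ∎))

    -- Dividing `φ m k` by p^m and `φ i k` by p^i leaves λ_m - λ_k and λ_i - λ_k, whose difference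
    -- does not involve k. The constant is p^m (λ_m - λ_i).
    φ-exchange : ∀ m i k → φ m k ≈ p⁻ ^ i * p ^ m * φ i k
      + ((1# + r * (p ^ m * p ^ m)) - p⁻ ^ i * p ^ m * (1# + r * (p ^ i * p ^ i)))
    φ-exchange m i k = begin
      (1# - A * Z) * (1# - r * A * P)
        ≈⟨ solve 4 (λ A P Z r → (:1 :- A :* Z) :* (:1 :- r :* A :* P) := :1 :+ r :* (A :* A) :* (P :* Z) :- A :* (Z :+ r :* P)) refl A P Z r ⟩
      1# + r * (A * A) * (P * Z) - A * (Z + r * P)
        ≈⟨ +-cong (+-congˡ (trans (*-congˡ PZ) (*-identityʳ _))) (-‿cong (trans (sym (*-identityˡ _)) (*-congʳ (sym BB⁻)))) ⟩
      1# + r * (A * A) - B * B⁻ * (A * (Z + r * P))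
        ≈⟨ solve 6 (λ A B B⁻ P Z r → :1 :+ r :* (A :* A) :- B :* B⁻ :* (A :* (Z :+ r :* P)) :=
             B⁻ :* A :* (:1 :+ r :* (B :* B) :- B :* (Z :+ r :* P))
             :+ ((:1 :+ r :* (A :* A)) :- B⁻ :* A :* (:1 :+ r :* (B :* B)))) refl A B B⁻ P Z r ⟩
      B⁻ * A * (1# + r * (B * B) - B * (Z + r * P)) + ((1# + r * (A * A)) - B⁻ * A * (1# + r * (B * B)))
        ≈⟨ +-congʳ (*-congˡ (+-congʳ (+-congˡ (trans (sym (*-identityʳ _)) (*-congˡ (sym PZ)))))) ⟩
      B⁻ * A * (1# + r * (B * B) * (P * Z) - B * (Z + r * P)) + ((1# + r * (A * A)) - B⁻ * A * (1# + r * (B * B)))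
        ≈⟨ +-congʳ (*-congˡ (solve 4 (λ A P Z r → :1 :+ r :* (A :* A) :* (P :* Z) :- A :* (Z :+ r :* P) := (:1 :- A :* Z) :* (:1 :- r :* A :* P)) refl B P Z r)) ⟩
      B⁻ * A * ((1# - B * Z) * (1# - r * B * P)) + ((1# + r * (A * A)) - B⁻ * A * (1# + r * (B * B))) ∎
      where
      A = p ^ m
      B = p ^ i
      B⁻ = p⁻ ^ i
      P = p ^ k
      Z = p⁻ ^ k
      PZ : P * Z ≈ 1#
      PZ = p^p⁻^ k
      BB⁻ : B * B⁻ ≈ 1#
      BB⁻ = p^p⁻^ i

    moment : ℕ → (ℕ → Carrier) → ℕ → ℕ → Carrier
    moment n c i j = sum n (λ k → c k * (basis i k * basis j k))

    -- The last factor `φ i k` of `basis (suc i) k` is traded for `φ j k`, the factor that turns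
    -- `basis j k` into `basis (suc j) k`. Repeated use brings the first index down to 0 without
    -- ever raising the sum of the indices.
    moment-suc : ∀ n c i j → moment n c (suc i) j ≈
      p⁻ ^ j * p ^ i * moment n c i (suc j)
      + ((1# + r * (p ^ i * p ^ i)) - p⁻ ^ j * p ^ i * (1# + r * (p ^ j * p ^ j))) * moment n c i j
    moment-suc n c i j = begin
      sum n (λ k → c k * (basis i k * φ i k * basis j k))
        ≈⟨ sum-cong n (λ k → trans (*-congˡ (*-congʳ (*-congˡ (φ-exchange i j k))))
             (solve 6 (λ c x y f α β → c :* (x :* (α :* f :+ β) :* y) := α :* (c :* (x :* (y :* f))) :+ β :* (c :* (x :* y)))
                refl (c k) (basis i k) (basis j k) (φ j k) α β)) ⟩
      sum n (λ k → α * (c k * (basis i k * basis (suc j) k)) + β * (c k * (basis i k * basis j k)))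
        ≈⟨ sum-+ n _ _ ⟩
      sum n (λ k → α * (c k * (basis i k * basis (suc j) k))) + sum n (λ k → β * (c k * (basis i k * basis j k)))
        ≈⟨ +-cong (*-sum n α _) (*-sum n β _) ⟨
      α * moment n c i (suc j) + β * moment n c i j ∎
      where
      α = p⁻ ^ j * p ^ i
      β = (1# + r * (p ^ i * p ^ i)) - p⁻ ^ j * p ^ i * (1# + r * (p ^ j * p ^ j))

    double-expansion : ∀ n (c w w′ : ℕ → Carrier) →
      sum n (λ k → c k * (sum n (λ i → w i * basis i k) * sum n (λ j → w′ j * basis j k)))
      ≈ sum n (λ i → sum n (λ j → w i * w′ j * moment n c i j))
    double-expansion n c w w′ = begin
      sum n (λ k → c k * (sum n (λ i → w i * basis i k) * sum n (λ j → w′ j * basis j k)))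
        ≈⟨ sum-cong n (λ k → trans (*-congˡ (sum-* n _ _)) (trans (*-sum n (c k) _)
             (sum-cong n λ i → trans (*-congˡ (*-sum n (w i * basis i k) _)) (trans (*-sum n (c k) _)
               (sum-cong n λ j → solve 5 (λ c w f w′ g → c :* (w :* f :* (w′ :* g)) := w :* w′ :* (c :* (f :* g)))
                  refl (c k) (w i) (basis i k) (w′ j) (basis j k)))))) ⟩
      sum n (λ k → sum n (λ i → sum n (λ j → w i * w′ j * (c k * (basis i k * basis j k)))))
        ≈⟨ sum-swap n n _ ⟩
      sum n (λ i → sum n (λ k → sum n (λ j → w i * w′ j * (c k * (basis i k * basis j k)))))
        ≈⟨ sum-cong n (λ i → trans (sum-swap n n _) (sum-cong n λ j → sym (*-sum n (w i * w′ j) _))) ⟩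
      sum n (λ i → sum n (λ j → w i * w′ j * moment n c i j)) ∎

    -- Telescoping of the moments of a single basis polynomial.

    module Telescope (e : ℕ → Carrier) (e-inverse : ∀ x → (1# - p ^ suc x) * e x ≈ 1#) where

      weight : ℕ → Carrier
      weight k = q ^ k * (prod k (λ x → (1# - r * p ^ x) * e x) * prod k (λ x → (1# - r * p ^ x) * e x))

      -- The antidifference of the summand, up to the factor q p^(-l) - 1; it vanishes at k = 0.
      -- Passing from k to k + 1, `weight` acquires `e k` twice: the factor 1 - p^k absorbs one of
      -- them, and 1 - p^(k-l) together with the shifted `basis` absorbs the other.
      boundary : ℕ → ℕ → Carrier
      boundary l k = (1# - p ^ k * p⁻ ^ l) * (1# - p ^ k) * weight k * basis l k

      private
        first second : ℕ → ℕ → Carrier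
        first  l k = prod l (λ i → 1# - p ^ i * p⁻ ^ k)
        second l k = prod l (λ i → 1# - r * p ^ i * p ^ k)

        basis-split : ∀ l k → basis l k ≈ first l k * second l k
        basis-split l k = prod-* l _ _

        -- The step from k to k + 1 moves the product by one place, so all factors but the outermost
        -- agree. `first-shift` is the same in the opposite direction.
        second-shift : ∀ l k → second l (suc k) * (1# - r * p ^ k) ≈ second l k * (1# - r * p ^ l * p ^ k)
        second-shift l k = begin
          second l (suc k) * (1# - r * p ^ k)
            ≈⟨ *-comm _ _ ⟩
          (1# - r * p ^ k) * second l (suc k)
            ≈⟨ *-cong (+-congˡ (-‿cong (*-congʳ (sym (*-identityʳ r)))))
                 (prod-cong l λ i → +-congˡ (-‿cong (solve 4 (λ r p P I → r :* I :* (p :* P) := r :* (p :* I) :* P) refl r p (p ^ k) (p ^ i)))) ⟩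
          (1# - r * p ^ 0 * p ^ k) * prod l (λ i → 1# - r * p ^ suc i * p ^ k)
            ≈⟨ prod-sucˡ l (λ i → 1# - r * p ^ i * p ^ k) ⟨
          second l k * (1# - r * p ^ l * p ^ k) ∎

        first-shift : ∀ l k → first l (suc k) * (1# - p ^ l * p⁻ ^ suc k) ≈ (1# - p⁻ ^ suc k) * first l k
        first-shift l k = begin
          first (suc l) (suc k)
            ≈⟨ prod-sucˡ l (λ i → 1# - p ^ i * p⁻ ^ suc k) ⟩
          (1# - 1# * p⁻ ^ suc k) * prod l (λ i → 1# - p ^ suc i * p⁻ ^ suc k)
            ≈⟨ *-cong (+-congˡ (-‿cong (*-identityˡ _))) (prod-cong l λ i → sym (shift-p⁻ i k)) ⟩
          (1# - p⁻ ^ suc k) * first l k ∎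

        flip : ∀ m n → p ^ m * p⁻ ^ n * (1# - p ^ n * p⁻ ^ m) ≈ - (1# - p ^ m * p⁻ ^ n)
        flip m n = begin
          A * B⁻ * (1# - B * A⁻)
            ≈⟨ solve 4 (λ A A⁻ B B⁻ → A :* B⁻ :* (:1 :- B :* A⁻) := A :* B⁻ :- (A :* A⁻) :* (B :* B⁻)) refl A A⁻ B B⁻ ⟩
          A * B⁻ - (A * A⁻) * (B * B⁻)
            ≈⟨ +-congˡ (-‿cong (trans (*-cong (p^p⁻^ m) (p^p⁻^ n)) (*-identityʳ 1#))) ⟩
          A * B⁻ - 1#
            ≈⟨ solve 2 (λ A B⁻ → A :* B⁻ :- :1 := :- (:1 :- A :* B⁻)) refl A B⁻ ⟩
          - (1# - A * B⁻) ∎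
          where
          A = p ^ m
          A⁻ = p⁻ ^ m
          B = p ^ n
          B⁻ = p⁻ ^ n

        -- Up to -p^(k+1-l), the factor 1 - p^(k+1-l) of `boundary` is the one that `first-shift`
        -- drops; the factor 1 - p^(-k-1) that enters instead cancels against `e k`.
        first-step : ∀ l k → (1# - p ^ suc k * p⁻ ^ l) * e k * first l (suc k) ≈ p⁻ ^ l * first l k
        first-step l k = begin
          (1# - X * v) * e k * F′
            ≈⟨ solve 3 (λ a e F → a :* e :* F := :- ((:- a) :* e :* F)) refl (1# - X * v) (e k) F′ ⟩
          - (- (1# - X * v) * e k * F′)
            ≈⟨ -‿cong (*-congʳ (*-congʳ (flip (suc k) l))) ⟨
          - (X * v * (1# - p ^ l * Y) * e k * F′)
            ≈⟨ solve 5 (λ X v a e F → :- (X :* v :* a :* e :* F) := :- (X :* v :* e :* (F :* a))) refl X v (1# - p ^ l * Y) (e k) F′ ⟩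
          - (X * v * e k * (F′ * (1# - p ^ l * Y)))
            ≈⟨ -‿cong (*-congˡ (first-shift l k)) ⟩
          - (X * v * e k * ((1# - Y) * F))
            ≈⟨ solve 5 (λ X v e Y F → :- (X :* v :* e :* ((:1 :- Y) :* F)) := (X :* Y :- X) :* e :* (v :* F)) refl X v (e k) Y F ⟩
          (X * Y - X) * e k * (v * F)
            ≈⟨ *-congʳ (trans (*-congʳ (+-congʳ (p^p⁻^ (suc k)))) (e-inverse k)) ⟩
          1# * (v * F)
            ≈⟨ *-identityˡ _ ⟩
          v * F ∎
          where
          X = p ^ suc k
          Y = p⁻ ^ suc k
          v = p⁻ ^ l
          F = first l k
          F′ = first l (suc k)

        -- Both sides are quadratic in p^k with coefficients q p^(-l), -(1 + p^(-l)) and r. This is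
        -- what is left of the telescoping once the common products are divided out.
        polynomial-step : ∀ l k → q * p⁻ ^ l * (1# - r * p ^ k) * (1# - r * p ^ l * p ^ k)
          ≈ (1# - p ^ k * p⁻ ^ l) * (1# - p ^ k) + (q * p⁻ ^ l - 1#) * (1# - r * (p ^ k * p ^ k))
        polynomial-step l k = begin
          q * v * (1# - r * P) * (1# - r * t * P)
            ≈⟨ solve 5 (λ q v r t P → q :* v :* (:1 :- r :* P) :* (:1 :- r :* t :* P) :=
                 q :* v :- q :* r :* (v :* P) :- q :* r :* (t :* v) :* P :+ q :* r :* (t :* v) :* (r :* (P :* P))) refl q v r t P ⟩
          q * v - q * r * (v * P) - q * r * (t * v) * P + q * r * (t * v) * (r * (P * P))
            ≈⟨ +-cong (+-cong (+-congˡ (-‿cong (trans (*-congʳ qr≈1) (*-identityˡ _)))) (-‿cong (one P))) (one _) ⟩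
          q * v - v * P - P + r * (P * P)
            ≈⟨ solve 4 (λ q v r P → q :* v :- v :* P :- P :+ r :* (P :* P) :=
                 (:1 :- P :* v) :* (:1 :- P) :+ (q :* v :- :1 :+ r :* (P :* P)) :- :1 :* (P :* P :* v)) refl q v r P ⟩
          (1# - P * v) * (1# - P) + (q * v - 1# + r * (P * P)) - 1# * (P * P * v)
            ≈⟨ +-congˡ (-‿cong (*-congʳ qr≈1)) ⟨
          (1# - P * v) * (1# - P) + (q * v - 1# + r * (P * P)) - q * r * (P * P * v)
            ≈⟨ solve 4 (λ q v r P → (:1 :- P :* v) :* (:1 :- P) :+ (q :* v :- :1 :+ r :* (P :* P)) :- q :* r :* (P :* P :* v) :=
                 (:1 :- P :* v) :* (:1 :- P) :+ (q :* v :- :1) :* (:1 :- r :* (P :* P))) refl q v r P ⟩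
          (1# - P * v) * (1# - P) + (q * v - 1#) * (1# - r * (P * P)) ∎
          where
          P = p ^ k
          t = p ^ l
          v = p⁻ ^ l
          one : ∀ x → q * r * (t * v) * x ≈ x
          one x = trans (*-congʳ (trans (*-cong qr≈1 (p^p⁻^ l)) (*-identityʳ 1#))) (*-identityˡ x)

        boundary-step : ∀ l k → boundary l (suc k) ≈
          boundary l k + (q * p⁻ ^ l - 1#) * ((1# - r * (p ^ k * p ^ k)) * weight k * basis l k)
        boundary-step l k = begin
          (1# - X * v) * (1# - X) * (q * q ^ k * (ρ * (a * e k) * (ρ * (a * e k)))) * basis l (suc k)
            ≈⟨ *-congˡ (basis-split l (suc k)) ⟩
          (1# - X * v) * (1# - X) * (q * q ^ k * (ρ * (a * e k) * (ρ * (a * e k)))) * (first l (suc k) * second l (suc k))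
            ≈⟨ solve 9 (λ A E q Q ρ a e F S →
                 A :* E :* (q :* Q :* (ρ :* (a :* e) :* (ρ :* (a :* e)))) :* (F :* S) :=
                 q :* (Q :* (ρ :* ρ)) :* a :* (E :* e) :* (A :* e :* F) :* (S :* a))
                 refl (1# - X * v) (1# - X) q (q ^ k) ρ a (e k) (first l (suc k)) (second l (suc k)) ⟩
          q * weight k * a * ((1# - X) * e k) * ((1# - X * v) * e k * first l (suc k)) * (second l (suc k) * a)
            ≈⟨ *-cong (*-cong (trans (*-congˡ (e-inverse k)) (*-identityʳ _)) (first-step l k)) (second-shift l k) ⟩
          q * weight k * a * (v * first l k) * (second l k * (1# - r * p ^ l * p ^ k))
            ≈⟨ solve 7 (λ q W a v F S a′ → q :* W :* a :* (v :* F) :* (S :* a′) := q :* v :* a :* a′ :* (W :* (F :* S)))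
                 refl q (weight k) a v (first l k) (second l k) (1# - r * p ^ l * p ^ k) ⟩
          q * v * a * (1# - r * p ^ l * p ^ k) * (weight k * (first l k * second l k))
            ≈⟨ *-cong (polynomial-step l k) (*-congˡ (sym (basis-split l k))) ⟩
          ((1# - p ^ k * v) * (1# - p ^ k) + (q * v - 1#) * (1# - r * (p ^ k * p ^ k))) * (weight k * basis l k)
            ≈⟨ solve 5 (λ A B C W f → (A :+ B :* C) :* (W :* f) := A :* W :* f :+ B :* (C :* W :* f))
                 refl ((1# - p ^ k * v) * (1# - p ^ k)) (q * v - 1#) (1# - r * (p ^ k * p ^ k)) (weight k) (basis l k) ⟩
          boundary l k + (q * v - 1#) * ((1# - r * (p ^ k * p ^ k)) * weight k * basis l k) ∎
          where
          X = p ^ suc k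
          v = p⁻ ^ l
          a = 1# - r * p ^ k
          ρ = prod k (λ x → (1# - r * p ^ x) * e x)

      telescope : ∀ l n → (q * p⁻ ^ l - 1#) * sum n (λ k → (1# - r * (p ^ k * p ^ k)) * weight k * basis l k)
        ≈ boundary l n
      telescope l zero = begin
        (q * p⁻ ^ l - 1#) * 0#  ≈⟨ zeroʳ _ ⟩
        0#                      ≈⟨ solve 3 (λ a W f → con (ℤ.+ 0) := a :* (:1 :- :1) :* W :* f) refl (1# - 1# * p⁻ ^ l) (weight 0) (basis l 0) ⟩
        boundary l 0            ∎
        where import Data.Integer.Base as ℤ
      telescope l (suc n) = begin
        (q * p⁻ ^ l - 1#) * (sum n _ + _)
          ≈⟨ distribˡ _ _ _ ⟩
        (q * p⁻ ^ l - 1#) * sum n (λ k → (1# - r * (p ^ k * p ^ k)) * weight k * basis l k) + _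
          ≈⟨ +-congʳ (telescope l n) ⟩
        boundary l n + _
          ≈⟨ boundary-step l n ⟨
        boundary l (suc n) ∎

      -- The q-Saalschütz sum by creative telescoping.

      module Saalschütz (b b⁻ : Carrier) (bb⁻≈1 : b * b⁻ ≈ 1#) (β β⁻ : ℕ → Carrier)
        (β-inverse : ∀ x → (1# - p * b * p ^ x) * β x ≈ 1#)
        (β⁻-inverse : ∀ x → (1# - p * b⁻ * p ^ x) * β⁻ x ≈ 1#) where

        coefficient : ℕ → Carrier
        coefficient j = prod j (λ x → (1# - q * p * p ^ x) * p * (e x * β x * β⁻ x))

        term : ℕ → Carrier
        term k = prod k (λ x → (1# - b * r * p ^ x) * (1# - r * b⁻ * p ^ x) * (q * p) * (β x * β⁻ x))

        private
          expansion : ℕ → ℕ → Carrier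
          expansion n k = sum n (λ j → coefficient j * basis j k)

          r′ s u : Carrier
          r′ = r * p⁻
          s  = q * p
          u  = b + b⁻

          -- The coefficients of the recurrence `D k` F(k+1) = `C k` F(k), which `term` satisfies by
          -- its definition and `expansion` by telescoping in j. Both depend on b only through the
          -- symmetric u = b + 1/b.
          D C : ℕ → Carrier
          D k = let X = p ^ suc k in 1# - u * X + X * X
          C k = let X = p ^ suc k in s * (1# - u * (r′ * X) + r′ * X * (r′ * X))

          common : ℕ → ℕ → Carrier
          common N k = prod N (λ l → (1# - p ^ l * p⁻ ^ k) * (1# - r * p ^ suc l * p ^ k))

          -- The closed form of the partial sums over j ≤ N of `difference j k`. The product
          -- `common N k` is what `basis (suc N)` at k and at k + 1 have in common; it vanishes for
          -- k < N, and this is why the whole sum is zero.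
          Γ : ℕ → ℕ → Carrier
          Γ N k = coefficient N * (1# - q * p ^ suc N) * p⁻ ^ N * common N k * (1# - r′ * p ^ suc k * p ^ suc k)

          sr′≈1 : s * r′ ≈ 1#
          sr′≈1 = begin
            q * p * (r * p⁻)  ≈⟨ solve 4 (λ q p r p⁻ → q :* p :* (r :* p⁻) := q :* r :* (p :* p⁻)) refl q p r p⁻ ⟩
            q * r * (p * p⁻)  ≈⟨ *-cong qr≈1 pp⁻≈1 ⟩
            1# * 1#           ≈⟨ *-identityʳ 1# ⟩
            1#                ∎

          rP : ∀ k → r′ * p ^ suc k ≈ r * p ^ k
          rP k = begin
            r * p⁻ * (p * p ^ k)  ≈⟨ solve 4 (λ r p⁻ p P → r :* p⁻ :* (p :* P) := r :* P :* (p :* p⁻)) refl r p⁻ p (p ^ k) ⟩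
            r * p ^ k * (p * p⁻)  ≈⟨ trans (*-congˡ pp⁻≈1) (*-identityʳ _) ⟩
            r * p ^ k             ∎

          quadratic : ∀ x → (1# - b * x) * (1# - b⁻ * x) ≈ 1# - u * x + x * x
          quadratic x = begin
            (1# - b * x) * (1# - b⁻ * x)
              ≈⟨ solve 3 (λ b b⁻ x → (:1 :- b :* x) :* (:1 :- b⁻ :* x) := :1 :- (b :+ b⁻) :* x :+ b :* b⁻ :* (x :* x)) refl b b⁻ x ⟩
            1# - u * x + b * b⁻ * (x * x)
              ≈⟨ +-congˡ (trans (*-congʳ bb⁻≈1) (*-identityˡ _)) ⟩
            1# - u * x + x * x ∎

          D-inverse : ∀ k → D k * (β k * β⁻ k) ≈ 1#
          D-inverse k = begin
            D k * (β k * β⁻ k)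
              ≈⟨ *-congʳ (quadratic (p ^ suc k)) ⟨
            (1# - b * (p * p ^ k)) * (1# - b⁻ * (p * p ^ k)) * (β k * β⁻ k)
              ≈⟨ solve 6 (λ b b⁻ p P β β⁻ → (:1 :- b :* (p :* P)) :* (:1 :- b⁻ :* (p :* P)) :* (β :* β⁻) :=
                   ((:1 :- p :* b :* P) :* β) :* ((:1 :- p :* b⁻ :* P) :* β⁻)) refl b b⁻ p (p ^ k) (β k) (β⁻ k) ⟩
            ((1# - p * b * p ^ k) * β k) * ((1# - p * b⁻ * p ^ k) * β⁻ k)
              ≈⟨ *-cong (β-inverse k) (β⁻-inverse k) ⟩
            1# * 1#  ≈⟨ *-identityʳ 1# ⟩
            1#       ∎

          C≈ : ∀ k → C k ≈ (1# - b * r * p ^ k) * (1# - r * b⁻ * p ^ k) * (q * p)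
          C≈ k = begin
            s * (1# - u * (r′ * p ^ suc k) + r′ * p ^ suc k * (r′ * p ^ suc k))
              ≈⟨ *-congˡ (+-cong (+-congˡ (-‿cong (*-congˡ (rP k)))) (*-cong (rP k) (rP k))) ⟩
            s * (1# - u * (r * p ^ k) + r * p ^ k * (r * p ^ k))
              ≈⟨ *-congˡ (quadratic (r * p ^ k)) ⟨
            s * ((1# - b * (r * p ^ k)) * (1# - b⁻ * (r * p ^ k)))
              ≈⟨ solve 5 (λ s b b⁻ r P → s :* ((:1 :- b :* (r :* P)) :* (:1 :- b⁻ :* (r :* P))) :=
                   (:1 :- b :* r :* P) :* (:1 :- r :* b⁻ :* P) :* s) refl s b b⁻ r (p ^ k) ⟩
            (1# - b * r * p ^ k) * (1# - r * b⁻ * p ^ k) * s ∎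

          coefficient-suc : ∀ N → let J = p ^ suc N in
            coefficient N * (1# - q * J) ≈ coefficient (suc N) * p⁻ * ((1# - J) * (1# - u * J + J * J))
          coefficient-suc N = sym (begin
            w * ((1# - q * p * p ^ N) * p * (e N * β N * β⁻ N)) * p⁻ * ((1# - J) * D N)
              ≈⟨ solve 9 (λ w a p e β β⁻ p⁻ E D → w :* (a :* p :* (e :* β :* β⁻)) :* p⁻ :* (E :* D) :=
                   w :* a :* ((p :* p⁻) :* (E :* e) :* (D :* (β :* β⁻)))) refl
                   w (1# - q * p * p ^ N) p (e N) (β N) (β⁻ N) p⁻ (1# - J) (D N) ⟩
            w * (1# - q * p * p ^ N) * ((p * p⁻) * ((1# - J) * e N) * (D N * (β N * β⁻ N)))
              ≈⟨ *-cong (*-congˡ (+-congˡ (-‿cong (*-assoc q p _)))) (*-cong (*-cong pp⁻≈1 (e-inverse N)) (D-inverse N)) ⟩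
            w * (1# - q * J) * (1# * 1# * 1#)
              ≈⟨ trans (*-congˡ (trans (*-identityʳ _) (*-identityʳ _))) (*-identityʳ _) ⟩
            w * (1# - q * J) ∎)
            where
            w = coefficient N
            J = p ^ suc N

          basis-suc : ∀ N k → let J = p ^ suc N ; X = p ^ suc k ; Y = p⁻ ^ suc k in
            basis (suc N) k ≈ common N k * ((1# - J * Y) * (1# - r′ * X))
          basis-suc N k = begin
            prod (suc N) (λ l → φ l k)
              ≈⟨ prod-* (suc N) _ _ ⟩
            prod (suc N) (λ l → 1# - p ^ l * p⁻ ^ k) * prod (suc N) (λ l → 1# - r * p ^ l * p ^ k)
              ≈⟨ *-congˡ (prod-sucˡ N (λ l → 1# - r * p ^ l * p ^ k)) ⟩
            F * (1# - p ^ N * p⁻ ^ k) * ((1# - r * 1# * p ^ k) * S)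
              ≈⟨ *-cong (*-congˡ (shift-p⁻ N k)) (*-congʳ (+-congˡ (-‿cong (trans (*-congʳ (*-identityʳ r)) (sym (rP k)))))) ⟩
            F * (1# - J * Y) * ((1# - r′ * X) * S)
              ≈⟨ solve 4 (λ F A B S → F :* A :* (B :* S) := F :* S :* (A :* B)) refl F (1# - J * Y) (1# - r′ * X) S ⟩
            F * S * ((1# - J * Y) * (1# - r′ * X))
              ≈⟨ *-congʳ (prod-* N _ _) ⟨
            common N k * ((1# - J * Y) * (1# - r′ * X)) ∎
            where
            J = p ^ suc N
            X = p ^ suc k
            Y = p⁻ ^ suc k
            F = prod N (λ l → 1# - p ^ l * p⁻ ^ k)
            S = prod N (λ l → 1# - r * p ^ suc l * p ^ k)

          r′XJ : ∀ N k → r * p ^ N * p ^ suc k ≈ r′ * p ^ suc k * p ^ suc N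
          r′XJ N k = begin
            r * p ^ N * (p * p ^ k)     ≈⟨ solve 4 (λ r p A B → r :* A :* (p :* B) := r :* B :* (p :* A)) refl r p (p ^ N) (p ^ k) ⟩
            r * p ^ k * (p * p ^ N)     ≈⟨ *-congʳ (rP k) ⟨
            r′ * p ^ suc k * p ^ suc N  ∎

          common-suc : ∀ N k → let J = p ^ suc N ; X = p ^ suc k ; Y = p⁻ ^ suc k in
            common (suc N) k ≈ common N k * ((1# - J * Y) * (1# - r′ * X * J))
          common-suc N k = *-congˡ (*-cong (shift-p⁻ N k) (+-congˡ (-‿cong shifted)))
            where
            shifted : r * p ^ suc N * p ^ k ≈ r′ * p ^ suc k * p ^ suc N
            shifted = trans (solve 3 (λ r A B → r :* A :* B := r :* B :* A) refl r (p ^ suc N) (p ^ k)) (*-congʳ (sym (rP k)))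

          basis-suc-suc : ∀ N k → let J = p ^ suc N ; X = p ^ suc k ; Y = p⁻ ^ suc k in
            basis (suc N) (suc k) ≈ common N k * ((1# - Y) * (1# - r′ * X * J))
          basis-suc-suc N k = begin
            prod (suc N) (λ l → φ l (suc k))
              ≈⟨ prod-* (suc N) _ _ ⟩
            prod (suc N) (λ l → 1# - p ^ l * Y) * (prod N (λ l → 1# - r * p ^ l * X) * (1# - r * p ^ N * X))
              ≈⟨ *-cong (prod-sucˡ N (λ l → 1# - p ^ l * Y)) (*-cong
                   (prod-cong N λ l → +-congˡ (-‿cong (trans (r′XJ l k) (trans (*-congʳ (rP k))
                      (solve 3 (λ r A B → r :* B :* A := r :* A :* B) refl r (p ^ suc l) (p ^ k))))))
                   (+-congˡ (-‿cong (r′XJ N k)))) ⟩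
            (1# - 1# * Y) * prod N (λ l → 1# - p ^ suc l * Y) * (S * (1# - r′ * X * J))
              ≈⟨ *-congʳ (*-cong (+-congˡ (-‿cong (*-identityˡ Y))) (prod-cong N λ l → sym (shift-p⁻ l k))) ⟩
            (1# - Y) * F * (S * (1# - r′ * X * J))
              ≈⟨ solve 4 (λ F A B S → A :* F :* (S :* B) := F :* S :* (A :* B)) refl F (1# - Y) (1# - r′ * X * J) S ⟩
            F * S * ((1# - Y) * (1# - r′ * X * J))
              ≈⟨ *-congʳ (prod-* N _ _) ⟨
            common N k * ((1# - Y) * (1# - r′ * X * J)) ∎
            where
            J = p ^ suc N
            X = p ^ suc k
            Y = p⁻ ^ suc k
            F = prod N (λ l → 1# - p ^ l * p⁻ ^ k)
            S = prod N (λ l → 1# - r * p ^ suc l * p ^ k)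

          difference : ℕ → ℕ → Carrier
          difference j k = coefficient j * (D k * basis j (suc k) - C k * basis j k)

          -- By `coefficient-suc` and the two factorisations of `basis`, everything is a multiple of
          -- `coefficient (suc N)` times `common N k`; the remaining cofactors agree by
          -- `certificate`.
          Γ-suc : ∀ N k → Γ (suc N) k ≈ Γ N k + difference (suc N) k
          Γ-suc N k = begin
            W * (1# - q * (p * J)) * I * common (suc N) k * (1# - r′ * X * X)
              ≈⟨ *-congʳ (*-cong (*-congʳ (*-congˡ (+-congˡ (-‿cong (sym (*-assoc q p J)))))) (common-suc N k)) ⟩
            W * (1# - s * J) * I * (G * ((1# - J * Y) * Z)) * V
              ≈⟨ solve 8 (λ W A I G B Z V E → W :* A :* I :* (G :* (B :* Z)) :* V :=
                   W :* I :* G :* (V :* E) :+ W :* I :* G :* (V :* (A :* B :* Z :- E)))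
                   refl W (1# - s * J) I G (1# - J * Y) Z V E ⟩
            W * I * G * (V * E) + W * I * G * (V * ((1# - s * J) * (1# - J * Y) * Z - E))
              ≈⟨ +-congˡ (*-congˡ (certificate J X Y r′ s u (p^p⁻^ (suc k)) sr′≈1)) ⟩
            W * I * G * (V * E) + W * I * G * (J * (D k * (1# - Y) * Z - C k * (1# - J * Y) * (1# - r′ * X)))
              ≈⟨ +-cong
                   (solve 6 (λ W p⁻ I G V E → W :* (p⁻ :* I) :* G :* (V :* E) := W :* p⁻ :* E :* I :* G :* V) refl W p⁻ (p⁻ ^ N) G V E)
                   (solve 10 (λ W I G J D y Z C B A → W :* I :* G :* (J :* (D :* y :* Z :- C :* B :* A)) :=
                     J :* I :* (W :* (D :* (G :* (y :* Z)) :- C :* (G :* (B :* A)))))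
                     refl W I G J (D k) (1# - Y) Z (C k) (1# - J * Y) (1# - r′ * X)) ⟩
            W * p⁻ * E * p⁻ ^ N * G * V + J * I * (W * (D k * (G * ((1# - Y) * Z)) - C k * (G * ((1# - J * Y) * (1# - r′ * X)))))
              ≈⟨ +-cong (*-congʳ (*-congʳ (*-congʳ (sym (coefficient-suc N)))))
                   (trans (*-congʳ (p^p⁻^ (suc N))) (trans (*-identityˡ _)
                     (*-congˡ (+-cong (*-congˡ (sym (basis-suc-suc N k))) (-‿cong (*-congˡ (sym (basis-suc N k)))))))) ⟩
            Γ N k + difference (suc N) k ∎
            where
            J = p ^ suc N
            I = p⁻ ^ suc N
            X = p ^ suc k
            Y = p⁻ ^ suc k
            W = coefficient (suc N)
            G = common N k
            E = (1# - J) * (1# - u * J + J * J)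
            V = 1# - r′ * X * X
            Z = 1# - r′ * X * J

          Γ-sum : ∀ N k → sum (suc N) (λ j → difference j k) ≈ Γ N k
          Γ-sum zero k = begin
            0# + 1# * (D k * 1# - C k * 1#)
              ≈⟨ solve 5 (λ u X r′ s o → con (ℤ.+ 0) :+ :1 :* ((:1 :- u :* X :+ X :* X) :* :1 :- s :* (:1 :- u :* (r′ :* X) :+ r′ :* X :* (r′ :* X)) :* :1) :=
                   :1 :- u :* X :+ X :* X :- s :+ s :* r′ :* (u :* X) :- s :* r′ :* (r′ :* X :* X)) refl u X r′ s 1# ⟩
            1# - u * X + X * X - s + s * r′ * (u * X) - s * r′ * (r′ * X * X)
              ≈⟨ +-cong (+-congˡ (one _)) (-‿cong (one _)) ⟩
            1# - u * X + X * X - s + u * X - r′ * X * X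
              ≈⟨ solve 4 (λ u X r′ s → :1 :- u :* X :+ X :* X :- s :+ u :* X :- r′ :* X :* X :=
                   :1 :* (X :* X) :+ (:1 :- s :- r′ :* X :* X)) refl u X r′ s ⟩
            1# * (X * X) + (1# - s - r′ * X * X)
              ≈⟨ +-congʳ (*-congʳ (sym sr′≈1)) ⟩
            s * r′ * (X * X) + (1# - s - r′ * X * X)
              ≈⟨ solve 4 (λ q p X r′ → q :* p :* r′ :* (X :* X) :+ (:1 :- q :* p :- r′ :* X :* X) :=
                   :1 :* (:1 :- q :* (p :* :1)) :* :1 :* :1 :* (:1 :- r′ :* X :* X)) refl q p X r′ ⟩
            Γ 0 k ∎
            where
            import Data.Integer.Base as ℤ
            X = p ^ suc k
            one : ∀ x → s * r′ * x ≈ x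
            one x = trans (*-congʳ sr′≈1) (*-identityˡ x)
          Γ-sum (suc N) k = trans (+-congʳ (Γ-sum N k)) (sym (Γ-suc N k))

          Γ-vanishes : ∀ N k → k < N → Γ N k ≈ 0#
          Γ-vanishes N k k<N = trans (*-congʳ (trans (*-congˡ (prod-zero N k k<N
            (trans (*-congʳ (trans (+-congˡ (-‿cong (p^p⁻^ k))) (-‿inverseʳ 1#))) (zeroˡ _)))) (zeroʳ _))) (zeroˡ _)

          expansion-suc : ∀ n k → suc k < n → D k * expansion n (suc k) ≈ C k * expansion n k
          expansion-suc (suc n) k (s≤s k<n) = x∙y⁻¹≈ε⇒x≈y _ _ (begin
            D k * expansion (suc n) (suc k) - C k * expansion (suc n) k
              ≈⟨ +-cong (*-sum (suc n) (D k) _) (trans (solve 2 (λ C x → :- (C :* x) := (:- C) :* x) refl (C k) _) (*-sum (suc n) (- C k) _)) ⟩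
            sum (suc n) (λ j → D k * (coefficient j * basis j (suc k))) + sum (suc n) (λ j → - C k * (coefficient j * basis j k))
              ≈⟨ sum-+ (suc n) _ _ ⟨
            sum (suc n) (λ j → D k * (coefficient j * basis j (suc k)) + - C k * (coefficient j * basis j k))
              ≈⟨ sum-cong (suc n) (λ j → solve 5 (λ D C w f g → D :* (w :* f) :+ :- C :* (w :* g) := w :* (D :* f :- C :* g))
                   refl (D k) (C k) (coefficient j) (basis j (suc k)) (basis j k)) ⟩
            sum (suc n) (λ j → difference j k)
              ≈⟨ Γ-sum n k ⟩
            Γ n k
              ≈⟨ Γ-vanishes n k k<n ⟩
            0# ∎)

          expansion-zero : ∀ n → expansion (suc n) 0 ≈ 1#
          expansion-zero zero    = trans (+-identityˡ _) (*-identityʳ 1#)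
          expansion-zero (suc n) = trans (+-cong (expansion-zero n)
            (trans (*-congˡ (basis-vanishes {suc n} (s≤s z≤n))) (zeroʳ _))) (+-identityʳ 1#)

        -- Both sides satisfy the same first-order recurrence in k and equal 1 at k = 0. Truncating
        -- the sum at n loses nothing, because `basis j k` vanishes for j > k.
        saalschütz : ∀ n k → k < n → sum n (λ j → coefficient j * basis j k) ≈ term k
        saalschütz (suc n) zero    _     = expansion-zero n
        saalschütz n       (suc k) 1+k<n = begin
          expansion n (suc k)
            ≈⟨ trans (*-congʳ (D-inverse k)) (*-identityˡ _) ⟨
          D k * (β k * β⁻ k) * expansion n (suc k)
            ≈⟨ solve 3 (λ D B x → D :* B :* x := D :* x :* B) refl (D k) (β k * β⁻ k) (expansion n (suc k)) ⟩
          D k * expansion n (suc k) * (β k * β⁻ k)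
            ≈⟨ *-congʳ (expansion-suc n k 1+k<n) ⟩
          C k * expansion n k * (β k * β⁻ k)
            ≈⟨ *-congʳ (*-cong (C≈ k) (saalschütz n k (ℕₚ.<-trans (ℕₚ.n<1+n k) 1+k<n))) ⟩
          (1# - b * r * p ^ k) * (1# - r * b⁻ * p ^ k) * (q * p) * term k * (β k * β⁻ k)
            ≈⟨ solve 3 (λ A t B → A :* t :* B := t :* (A :* B)) refl _ (term k) (β k * β⁻ k) ⟩
          term (suc k) ∎

-- Const plays the part of the nonzero elements of ℤ[a,b] in ℤ[a,b][q].
record ConstDomain : Set₁ where
  field
    ring : CommutativeRing 0ℓ 0ℓ
  open CommutativeRing ring
  field
    noZeroDivisors : ∀ x y → x * y ≈ 0# → ¬ x ≈ 0# → y ≈ 0#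
    1≉0            : ¬ 1# ≈ 0#
    Const          : Carrier → Set
    const-1        : Const 1#
    const-*        : ∀ {c d} → Const c → Const d → Const (c * d)

-- The fractions of an integral domain.

module FractionRing
  (R : CommutativeRing 0ℓ 0ℓ)
  (noZeroDivisors : ∀ x y → CommutativeRing._≈_ R (CommutativeRing._*_ R x y) (CommutativeRing.0# R) →
    ¬ CommutativeRing._≈_ R x (CommutativeRing.0# R) → CommutativeRing._≈_ R y (CommutativeRing.0# R))
  (1≉0 : ¬ CommutativeRing._≈_ R (CommutativeRing.1# R) (CommutativeRing.0# R))
  where

  open CommutativeRing R
  open import Algebra.Properties.Ring ring
  open import Relation.Binary.Reasoning.Setoid setoid
  open Solver R

  *-cancelʳ : ∀ {x y} z → ¬ z ≈ 0# → x * z ≈ y * z → x ≈ y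
  *-cancelʳ {x} {y} z z≉0 e = x∙y⁻¹≈ε⇒x≈y x y (noZeroDivisors z (x - y) (begin
    z * (x - y)    ≈⟨ solve 3 (λ x y z → z :* (x :- y) := x :* z :- y :* z) refl x y z ⟩
    x * z - y * z  ≈⟨ x≈y⇒x∙y⁻¹≈ε e ⟩
    0#             ∎) z≉0)

  *-nonzero : ∀ {x y} → ¬ x ≈ 0# → ¬ y ≈ 0# → ¬ x * y ≈ 0#
  *-nonzero x≉0 y≉0 e = y≉0 (noZeroDivisors _ _ e x≉0)

  private
    record Fraction : Set where
      constructor fraction
      field
        num         : Carrier
        den         : Carrier
        den-nonzero : ¬ den ≈ 0#

    open Fraction

    infix 4 _≈F_
    record _≈F_ (x y : Fraction) : Set where
      constructor cross
      field uncross : num x * den y ≈ num y * den x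

    _+F_ _*F_ : Fraction → Fraction → Fraction
    fraction a b b≉0 +F fraction c d d≉0 = fraction (a * d + c * b) (b * d) (*-nonzero b≉0 d≉0)
    fraction a b b≉0 *F fraction c d d≉0 = fraction (a * c) (b * d) (*-nonzero b≉0 d≉0)

    -F_ : Fraction → Fraction
    -F fraction a b b≉0 = fraction (- a) b b≉0

    ≈F-trans : ∀ {x y z} → x ≈F y → y ≈F z → x ≈F z
    ≈F-trans {fraction a b _} {fraction c d d≉0} {fraction e f _} (cross p) (cross q) =
      cross (*-cancelʳ d d≉0 (begin
        a * f * d  ≈⟨ solve 3 (λ a f d → a :* f :* d := a :* d :* f) refl a f d ⟩
        a * d * f  ≈⟨ *-congʳ p ⟩
        c * b * f  ≈⟨ solve 3 (λ c b f → c :* b :* f := c :* f :* b) refl c b f ⟩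
        c * f * b  ≈⟨ *-congʳ q ⟩
        e * d * b  ≈⟨ solve 3 (λ e d b → e :* d :* b := e :* b :* d) refl e d b ⟩
        e * b * d  ∎))

    +F-cong : ∀ {x x′ y y′} → x ≈F x′ → y ≈F y′ → (x +F y) ≈F (x′ +F y′)
    +F-cong {fraction a b _} {fraction a′ b′ _} {fraction c d _} {fraction c′ d′ _} (cross p) (cross q) =
      cross (begin
        (a * d + c * b) * (b′ * d′)
          ≈⟨ solve 6 (λ a b c d b′ d′ → (a :* d :+ c :* b) :* (b′ :* d′) :=
               a :* b′ :* (d :* d′) :+ c :* d′ :* (b :* b′)) refl a b c d b′ d′ ⟩
        a * b′ * (d * d′) + c * d′ * (b * b′)
          ≈⟨ +-cong (*-congʳ p) (*-congʳ q) ⟩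
        a′ * b * (d * d′) + c′ * d * (b * b′)
          ≈⟨ solve 6 (λ a′ b c′ d b′ d′ → a′ :* b :* (d :* d′) :+ c′ :* d :* (b :* b′) :=
               (a′ :* d′ :+ c′ :* b′) :* (b :* d)) refl a′ b c′ d b′ d′ ⟩
        (a′ * d′ + c′ * b′) * (b * d) ∎)

    *F-cong : ∀ {x x′ y y′} → x ≈F x′ → y ≈F y′ → (x *F y) ≈F (x′ *F y′)
    *F-cong {fraction a b _} {fraction a′ b′ _} {fraction c d _} {fraction c′ d′ _} (cross p) (cross q) =
      cross (begin
        a * c * (b′ * d′)  ≈⟨ solve 4 (λ a c b′ d′ → a :* c :* (b′ :* d′) := a :* b′ :* (c :* d′)) refl a c b′ d′ ⟩
        a * b′ * (c * d′)  ≈⟨ *-cong p q ⟩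
        a′ * b * (c′ * d)  ≈⟨ solve 4 (λ a′ b c′ d → a′ :* b :* (c′ :* d) := a′ :* c′ :* (b :* d)) refl a′ b c′ d ⟩
        a′ * c′ * (b * d)  ∎)

  private
    concreteRing : CommutativeRing 0ℓ 0ℓ
    concreteRing = record
      { Carrier = Fraction ; _≈_ = _≈F_ ; _+_ = _+F_ ; _*_ = _*F_ ; -_ = -F_
      ; 0# = fraction 0# 1# 1≉0 ; 1# = fraction 1# 1# 1≉0
      ; isCommutativeRing = record
        { isRing = record
          { +-isAbelianGroup = record
            { isGroup = record
              { isMonoid = record
                { isSemigroup = record
                  { isMagma = record
                    { isEquivalence = record
                      { refl = cross refl ; sym = λ { (cross p) → cross (sym p) } ; trans = ≈F-trans }
                    ; ∙-cong = +F-cong }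
                  ; assoc = λ x y z → cross (solve 6 (λ a b c d e f →
                      ((a :* d :+ c :* b) :* f :+ e :* (b :* d)) :* (b :* (d :* f)) :=
                      (a :* (d :* f) :+ (c :* f :+ e :* d) :* b) :* (b :* d :* f))
                      refl (num x) (den x) (num y) (den y) (num z) (den z)) }
                ; identity = (λ x → cross (solve 2 (λ a b → (con (ℤ.+ 0) :* b :+ a :* :1) :* b := a :* (:1 :* b)) refl (num x) (den x)))
                           , (λ x → cross (solve 2 (λ a b → (a :* :1 :+ con (ℤ.+ 0) :* b) :* b := a :* (b :* :1)) refl (num x) (den x))) }
              ; inverse = (λ x → cross (solve 2 (λ a b → (:- a :* b :+ a :* b) :* :1 := con (ℤ.+ 0) :* (b :* b)) refl (num x) (den x)))
                        , (λ x → cross (solve 2 (λ a b → (a :* b :+ :- a :* b) :* :1 := con (ℤ.+ 0) :* (b :* b)) refl (num x) (den x)))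
              ; ⁻¹-cong = λ { {x} {y} (cross p) → cross (trans (sym (-‿distribˡ-* _ _)) (trans (-‿cong p) (-‿distribˡ-* _ _))) } }
            ; comm = λ x y → cross (solve 4 (λ a b c d → (a :* d :+ c :* b) :* (d :* b) := (c :* b :+ a :* d) :* (b :* d))
                refl (num x) (den x) (num y) (den y)) }
          ; *-cong = *F-cong
          ; *-assoc = λ x y z → cross (solve 6 (λ a b c d e f → a :* c :* e :* (b :* (d :* f)) := a :* (c :* e) :* (b :* d :* f))
                      refl (num x) (den x) (num y) (den y) (num z) (den z))
          ; *-identity = (λ x → cross (solve 2 (λ a b → :1 :* a :* b := a :* (:1 :* b)) refl (num x) (den x)))
                       , (λ x → cross (solve 2 (λ a b → a :* :1 :* b := a :* (b :* :1)) refl (num x) (den x)))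
          ; distrib = (λ x y z → cross (solve 6 (λ a b c d e f →
                        a :* (c :* f :+ e :* d) :* (b :* d :* (b :* f)) :=
                        (a :* c :* (b :* f) :+ a :* e :* (b :* d)) :* (b :* (d :* f)))
                      refl (num x) (den x) (num y) (den y) (num z) (den z)))
                    , (λ x y z → cross (solve 6 (λ a b c d e f →
                        (c :* f :+ e :* d) :* a :* (d :* b :* (f :* b)) :=
                        (c :* a :* (f :* b) :+ e :* a :* (d :* b)) :* ((d :* f) :* b))
                      refl (num x) (den x) (num y) (den y) (num z) (den z))) }
        ; *-comm = λ x y → cross (solve 4 (λ a b c d → a :* c :* (d :* b) := c :* a :* (b :* d))
                refl (num x) (den x) (num y) (den y)) } }
      where import Data.Integer.Base as ℤ

  abstract
    fractionRing : CommutativeRing 0ℓ 0ℓ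
    fractionRing = concreteRing

  module K = CommutativeRing fractionRing

  abstract
    ι : Carrier → K.Carrier
    ι x = fraction x 1# 1≉0

    ι-cong : ∀ {x y} → x ≈ y → ι x K.≈ ι y
    ι-cong e = cross (*-congʳ e)

    ι-injective : ∀ {x y} → ι x K.≈ ι y → x ≈ y
    ι-injective (cross e) = trans (sym (*-identityʳ _)) (trans e (*-identityʳ _))

    ι-0 : ι 0# K.≈ K.0#
    ι-0 = K.refl

    ι-1 : ι 1# K.≈ K.1#
    ι-1 = K.refl

    ι-+ : ∀ x y → ι (x + y) K.≈ ι x K.+ ι y
    ι-+ x y = cross (solve 2 (λ x y → (x :+ y) :* (:1 :* :1) := (x :* :1 :+ y :* :1) :* :1) refl x y)

    ι-* : ∀ x y → ι (x * y) K.≈ ι x K.* ι y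
    ι-* x y = cross (solve 2 (λ x y → x :* y :* (:1 :* :1) := x :* y :* :1) refl x y)

    ι-neg : ∀ x → ι (- x) K.≈ K.- ι x
    ι-neg x = cross refl

    recip : ∀ {x} → ¬ x ≈ 0# → K.Carrier
    recip {x} x≉0 = fraction 1# x x≉0

    recip-inverse : ∀ {x} (x≉0 : ¬ x ≈ 0#) → ι x K.* recip x≉0 K.≈ K.1#
    recip-inverse {x} x≉0 = cross (solve 1 (λ x → x :* :1 :* :1 := :1 :* (:1 :* x)) refl x)

-- Coprimality, and divisibility in a localisation.

module Localisation (𝓓 : ConstDomain) where

  open ConstDomain 𝓓 renaming (ring to R)
  open CommutativeRing R
  open import Relation.Binary.Reasoning.Setoid setoid
  open Solver R
  open BigOp R
  open FractionRing R noZeroDivisors 1≉0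
  private module BK = BigOp fractionRing
  open import Data.Integer.Base using (+_)

  -- Coprimality over the fraction field of the constants. The combination is only asked to be a
  -- constant, not 1, because constants such as 1 - a^n are not units of the polynomial ring.
  record Coprime (V P : Carrier) : Set where
    constructor bézout
    field
      X Y c : Carrier
      const : Const c
      equation : X * V + Y * P ≈ c

  coprime-sym : ∀ {V P} → Coprime V P → Coprime P V
  coprime-sym (bézout X Y c k e) = bézout Y X c k (trans (+-comm _ _) e)

  coprime-one : ∀ {P} → Coprime 1# P
  coprime-one {P} = bézout 1# 0# 1# const-1 (solve 1 (λ P → :1 :* :1 :+ con (+ 0) :* P := :1) refl P)

  coprime-* : ∀ {V W P} → Coprime V P → Coprime W P → Coprime (V * W) P
  coprime-* {V} {W} {P} (bézout X Y c k e) (bézout X′ Y′ c′ k′ e′) =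
    bézout (X * X′) (X * V * Y′ + Y * X′ * W + Y * Y′ * P) (c * c′) (const-* k k′) (begin
      X * X′ * (V * W) + (X * V * Y′ + Y * X′ * W + Y * Y′ * P) * P
        ≈⟨ solve 7 (λ V W P X Y X′ Y′ → X :* X′ :* (V :* W) :+ (X :* V :* Y′ :+ Y :* X′ :* W :+ Y :* Y′ :* P) :* P
             := (X :* V :+ Y :* P) :* (X′ :* W :+ Y′ :* P)) refl V W P X Y X′ Y′ ⟩
      (X * V + Y * P) * (X′ * W + Y′ * P)
        ≈⟨ *-cong e e′ ⟩
      c * c′ ∎)

  coprime-*ʳ : ∀ {V P P′} → Coprime V P → Coprime V P′ → Coprime V (P * P′)
  coprime-*ʳ h h′ = coprime-sym (coprime-* (coprime-sym h) (coprime-sym h′))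

  coprime-cong : ∀ {V W P P′} → V ≈ W → P ≈ P′ → Coprime V P → Coprime W P′
  coprime-cong e f (bézout X Y c k h) = bézout X Y c k (trans (+-cong (*-congˡ (sym e)) (*-congˡ (sym f))) h)

  coprime-factorʳ : ∀ {V P P′} → Coprime V (P * P′) → Coprime V P
  coprime-factorʳ {V} {P} {P′} (bézout X Y c k h) = bézout X (Y * P′) c k
    (trans (+-congˡ (solve 3 (λ Y P P′ → Y :* P′ :* P := Y :* (P :* P′)) refl Y P P′)) h)

  coprime-factorˡ : ∀ {V W P} → Coprime (V * W) P → Coprime V P
  coprime-factorˡ h = coprime-sym (coprime-factorʳ (coprime-sym h))

  coprime-prod : ∀ n {f P} → (∀ i → i < n → Coprime (f i) P) → Coprime (prod n f) P
  coprime-prod zero    h = coprime-one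
  coprime-prod (suc n) h = coprime-* (coprime-prod n λ i i<n → h i (ℕₚ.m<n⇒m<1+n i<n)) (h n ℕₚ.≤-refl)

  coprime-^ : ∀ {V P} n → Coprime V P → Coprime (V ^ n) P
  coprime-^ zero    h = coprime-one
  coprime-^ (suc n) h = coprime-* h (coprime-^ n h)

  module Modulo (Q : Carrier) where

    -- Multiple P x: x lies in P·O, where O is the ring of fractions with denominator coprime to Q.
    record Multiple (P : Carrier) (x : K.Carrier) : Set where
      constructor multiple-of
      field
        U V : Carrier
        coprime : Coprime V Q
        equation : x K.* ι V K.≈ ι (P * U)

    Integral : K.Carrier → Set
    Integral = Multiple 1#

    multiple-cong : ∀ {P P′ x y} → P ≈ P′ → x K.≈ y → Multiple P x → Multiple P′ y
    multiple-cong e f (multiple-of U V h g) = multiple-of U V h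
      (K.trans (K.*-congʳ (K.sym f)) (K.trans g (ι-cong (*-congʳ e))))

    resp : ∀ {P x y} → x K.≈ y → Multiple P x → Multiple P y
    resp = multiple-cong refl

    integral-ι : ∀ u → Integral (ι u)
    integral-ι u = multiple-of u 1# coprime-one
      (K.trans (K.sym (ι-* u 1#)) (ι-cong (*-comm u 1#)))

    integral-1 : Integral K.1#
    integral-1 = resp ι-1 (integral-ι 1#)

    private
      module S where
        open Solver fractionRing public
        open import Relation.Binary.Reasoning.Setoid K.setoid public

    multiple-+ : ∀ {P x y} → Multiple P x → Multiple P y → Multiple P (x K.+ y)
    multiple-+ {P} {x} {y} (multiple-of U V h e) (multiple-of U′ V′ h′ e′) =
      multiple-of (U * V′ + U′ * V) (V * V′) (coprime-* h h′) (S.begin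
        (x K.+ y) K.* ι (V * V′)
          S.≈⟨ K.*-congˡ (ι-* V V′) ⟩
        (x K.+ y) K.* (ι V K.* ι V′)
          S.≈⟨ S.solve 4 (λ x y V V′ → (x S.:+ y) S.:* (V S.:* V′) S.:= (x S.:* V) S.:* V′ S.:+ (y S.:* V′) S.:* V) K.refl x y (ι V) (ι V′) ⟩
        (x K.* ι V) K.* ι V′ K.+ (y K.* ι V′) K.* ι V
          S.≈⟨ K.+-cong (K.*-congʳ e) (K.*-congʳ e′) ⟩
        ι (P * U) K.* ι V′ K.+ ι (P * U′) K.* ι V
          S.≈⟨ K.sym (K.trans (ι-+ _ _) (K.+-cong (ι-* _ _) (ι-* _ _))) ⟩
        ι (P * U * V′ + P * U′ * V)
          S.≈⟨ ι-cong (solve 5 (λ P U U′ V V′ → P :* U :* V′ :+ P :* U′ :* V := P :* (U :* V′ :+ U′ :* V)) refl P U U′ V V′) ⟩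
        ι (P * (U * V′ + U′ * V)) S.∎)

    multiple-* : ∀ {P P′ x y} → Multiple P x → Multiple P′ y → Multiple (P * P′) (x K.* y)
    multiple-* {P} {P′} {x} {y} (multiple-of U V h e) (multiple-of U′ V′ h′ e′) =
      multiple-of (U * U′) (V * V′) (coprime-* h h′) (S.begin
        (x K.* y) K.* ι (V * V′)
          S.≈⟨ K.*-congˡ (ι-* V V′) ⟩
        (x K.* y) K.* (ι V K.* ι V′)
          S.≈⟨ S.solve 4 (λ x y V V′ → (x S.:* y) S.:* (V S.:* V′) S.:= (x S.:* V) S.:* (y S.:* V′)) K.refl x y (ι V) (ι V′) ⟩
        (x K.* ι V) K.* (y K.* ι V′)
          S.≈⟨ K.*-cong e e′ ⟩
        ι (P * U) K.* ι (P′ * U′)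
          S.≈⟨ K.sym (ι-* _ _) ⟩
        ι (P * U * (P′ * U′))
          S.≈⟨ ι-cong (solve 4 (λ P P′ U U′ → P :* U :* (P′ :* U′) := P :* P′ :* (U :* U′)) refl P P′ U U′) ⟩
        ι (P * P′ * (U * U′)) S.∎)

    multiple-*ʳ : ∀ {P x y} → Multiple P x → Integral y → Multiple P (x K.* y)
    multiple-*ʳ h k = multiple-cong (*-identityʳ _) K.refl (multiple-* h k)

    multiple-*ˡ : ∀ {P x y} → Integral x → Multiple P y → Multiple P (x K.* y)
    multiple-*ˡ h k = multiple-cong (*-identityˡ _) K.refl (multiple-* h k)

    multiple-factor : ∀ {P P′ x} → Multiple (P * P′) x → Multiple P x
    multiple-factor {P} {P′} (multiple-of U V h e) = multiple-of (P′ * U) V h (K.trans e (ι-cong (*-assoc P P′ U)))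

    multiple-cancel : ∀ {P V x} → Coprime V Q → Multiple P (x K.* ι V) → Multiple P x
    multiple-cancel {P} {V} {x} h (multiple-of U W h′ e) = multiple-of U (V * W) (coprime-* h h′)
      (K.trans (K.*-congˡ (ι-* V W)) (K.trans (K.sym (K.*-assoc x (ι V) (ι W))) e))

    multiple-0 : ∀ {P} → Multiple P K.0#
    multiple-0 {P} = multiple-of 0# 1# coprime-one (K.trans (K.zeroˡ (ι 1#)) (K.trans (K.sym ι-0) (ι-cong (sym (zeroʳ P)))))

    integral-neg : ∀ {x} → Integral x → Integral (K.- x)
    integral-neg {x} h = resp
      (K.trans (K.*-congʳ (K.trans (ι-neg 1#) (K.-‿cong ι-1))) (S.solve 1 (λ x → (S.:- S.:1) S.:* x S.:= S.:- x) K.refl x))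
      (multiple-*ˡ (integral-ι (- 1#)) h)

    integral-- : ∀ {x y} → Integral x → Integral y → Integral (x K.- y)
    integral-- h k = multiple-+ h (integral-neg k)

    integral-inverse : ∀ {v x} → Coprime v Q → ι v K.* x K.≈ K.1# → Integral x
    integral-inverse {v} h e = multiple-cancel h (resp (K.sym (K.trans (K.*-comm _ _) e)) integral-1)

    integral-^ : ∀ {x} n → Integral x → Integral (x BK.^ n)
    integral-^ zero    h = integral-1
    integral-^ (suc n) h = multiple-*ʳ h (integral-^ n h)

    integral-prod : ∀ n {f} → (∀ i → i < n → Integral (f i)) → Integral (BK.prod n f)
    integral-prod zero    h = integral-1
    integral-prod (suc n) h = multiple-*ʳ (integral-prod n λ i i<n → h i (ℕₚ.m<n⇒m<1+n i<n)) (h n ℕₚ.≤-refl)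

    multiple-sum : ∀ n {P f} → (∀ i → i < n → Multiple P (f i)) → Multiple P (BK.sum n f)
    multiple-sum zero    h = multiple-0
    multiple-sum (suc n) h = multiple-+ (multiple-sum n λ i i<n → h i (ℕₚ.m<n⇒m<1+n i<n)) (h n ℕₚ.≤-refl)

-- Counting the exponents divisible by m.

module Counting where

  open import Data.Nat.Base
  open import Data.Nat.Properties
  open import Data.Nat.DivMod using (m≡m%n+[m/n]*n; m%n<n)
  open import Data.Nat.Divisibility
  open import Data.Nat.Coprimality using (Coprime; coprime-divisor; coprime-Bézout)
  open import Data.Nat.GCD using (module Bézout)
  open import Data.Nat.Tactic.RingSolver using (solve-∀)
  open import Data.Bool.Base using (if_then_else_)
  open import Data.Empty using (⊥-elim)
  open import Data.Product using (∃; _×_; _,_)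
  open import Data.Sum using (inj₁; inj₂)
  open import Relation.Nullary using (¬_; does; yes; no; contradiction)
  open import Relation.Binary.PropositionalEquality

  -- For j > 0 this is the exponent of Φ_m in 1 - q^j.
  divides? : ℕ → ℕ → ℕ
  divides? m j = if does (m ∣? j) then 1 else 0

  divides?-yes : ∀ {m j} → m ∣ j → divides? m j ≡ 1
  divides?-yes {m} {j} m∣j with m ∣? j
  ... | yes _   = refl
  ... | no  m∤j = contradiction m∣j m∤j

  divides?-no : ∀ {m j} → m ∤ j → divides? m j ≡ 0
  divides?-no {m} {j} m∤j with m ∣? j
  ... | yes m∣j = contradiction m∣j m∤j
  ... | no  _   = refl

  divides?⇒∣ : ∀ {m j} → divides? m j ≡ 1 → m ∣ j
  divides?⇒∣ {m} {j} e with m ∣? j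
  ... | yes m∣j = m∣j

  divides?≤1 : ∀ m j → divides? m j ≤ 1
  divides?≤1 m j with m ∣? j
  ... | yes _ = ≤-refl
  ... | no  _ = z≤n

  divides?-cong : ∀ {m i j} → (m ∣ i → m ∣ j) → (m ∣ j → m ∣ i) → divides? m i ≡ divides? m j
  divides?-cong {m} {i} {j} f g with m ∣? j
  ... | yes m∣j = divides?-yes (g m∣j)
  ... | no  m∤j = divides?-no λ m∣i → m∤j (f m∣i)

  -- For positive values of g this is the exponent of Φ_m in the product of the 1 - q^(g x) over x <
  -- N.
  count : ℕ → (ℕ → ℕ) → ℕ → ℕ
  count m g zero    = 0
  count m g (suc N) = count m g N + divides? m (g N)

  count-+ : ∀ m g N M → count m g (N + M) ≡ count m g N + count m (λ x → g (N + x)) M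
  count-+ m g N zero    = trans (cong (count m g) (+-identityʳ N)) (sym (+-identityʳ _))
  count-+ m g N (suc M) = trans (cong (count m g) (+-suc N M))
    (trans (cong (_+ divides? m (g (N + M))) (count-+ m g N M)) (+-assoc (count m g N) _ _))

  count-cong : ∀ {m g h} → (∀ x → divides? m (g x) ≡ divides? m (h x)) → ∀ N → count m g N ≡ count m h N
  count-cong e zero    = refl
  count-cong e (suc N) = cong₂ _+_ (count-cong e N) (e N)

  count-zero : ∀ {m g} N → (∀ x → x < N → m ∤ g x) → count m g N ≡ 0
  count-zero zero    e = refl
  count-zero (suc N) e = cong₂ _+_ (count-zero N λ x x<N → e x (m<n⇒m<1+n x<N)) (divides?-no (e N ≤-refl))

  count-positive : ∀ {m g} N x → x < N → m ∣ g x → 1 ≤ count m g N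
  count-positive {m} {g} (suc N) x (s≤s x≤N) m∣gx with m≤n⇒m<n∨m≡n x≤N
  ... | inj₁ x<N  = ≤-trans (count-positive N x x<N m∣gx) (m≤m+n _ _)
  ... | inj₂ refl = ≤-trans (≤-reflexive (sym (divides?-yes m∣gx))) (m≤n+m _ (count m g N))

  Periodic : ℕ → (ℕ → ℕ) → Set
  Periodic m g = ∀ x → divides? m (g (m + x)) ≡ divides? m (g x)

  count-* : ∀ {m g} → Periodic m g → ∀ c → count m g (c * m) ≡ c * count m g m
  count-* periodic zero = refl
  count-* {m} {g} periodic (suc c) = trans (count-+ m g m (c * m))
    (cong (count m g m +_) (trans (count-cong periodic (c * m)) (count-* periodic c)))

  count-shift : ∀ {m g} → Periodic m g → ∀ c N → count m (λ x → g (c * m + x)) N ≡ count m g N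
  count-shift periodic zero N = refl
  count-shift {m} {g} periodic (suc c) N = trans
    (count-cong (λ x → trans (cong (λ y → divides? m (g y)) (+-assoc m (c * m) x)) (periodic (c * m + x))) N)
    (count-shift periodic c N)

  -- The exponents j of the factors 1 − q^j of (q⁻¹;q^d), (q^d;q^d) and (q^(d+1);q^d);
  -- 1 − q⁻¹ is a unit times 1 − q, whence the value at 0.
  below multiple above : ℕ → ℕ → ℕ
  below d zero    = 1
  below d (suc x) = d * suc x ∸ 1
  multiple d x = d * suc x
  above d x = suc (d * suc x)

  module _ (d m : ℕ) (1<m : 1 < m) (0<d : 0 < d) (coprime : Coprime m d) where

    private
      instance
        m-nonZero : NonZero m
        m-nonZero = >-nonZero (<-trans z<s 1<m)

      m∤1 : m ∤ 1
      m∤1 m∣1 = <⇒≢ 1<m (sym (∣1⇒≡1 m∣1))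

      m∣suc⇒ : ∀ {j} → m ∣ j → m ∤ suc j
      m∣suc⇒ {j} m∣j m∣1+j = m∤1 (∣m+n∣m⇒∣n (subst (m ∣_) (+-comm 1 j) m∣1+j) m∣j)

      inverse : ∃ λ x → m ∣ suc (d * x)
      inverse with coprime-Bézout coprime
      ... | Bézout.+- x y eq = y , subst (m ∣_) (trans (sym eq) (cong suc (*-comm y d))) (n∣m*n x)
      -- Here d y is 1 modulo m, while -1 is wanted; so y is multiplied by m - 1.
      ... | Bézout.-+ x y eq = (pred m * y) , subst (m ∣_) (sym eq′) (m∣m*n (1 + pred m * x))
        where
        open ≡-Reasoning
        eq′ : suc (d * (pred m * y)) ≡ m * (1 + pred m * x)
        eq′ = begin
          suc (d * (pred m * y))           ≡⟨ cong suc (rearrange d (pred m) y) ⟩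
          suc (pred m * (y * d))           ≡⟨ cong (λ z → suc (pred m * z)) (sym eq) ⟩
          suc (pred m * suc (x * m))       ≡⟨ expand (pred m) x m ⟩
          suc (pred m) + m * (pred m * x)  ≡⟨ cong (_+ m * (pred m * x)) (suc-pred m) ⟩
          m + m * (pred m * x)             ≡⟨ sym (*-suc m (pred m * x)) ⟩
          m * (1 + pred m * x)             ∎
          where
          rearrange : ∀ d a y → d * (a * y) ≡ a * (y * d)
          rearrange = solve-∀
          expand : ∀ a x m → suc (a * suc (x * m)) ≡ suc a + m * (a * x)
          expand = solve-∀

      m∣suc-d*[y%m] : ∀ y → m ∣ suc (d * y) → m ∣ suc (d * (y % m))
      m∣suc-d*[y%m] y m∣ = ∣m+n∣m⇒∣n (subst (m ∣_) (begin
        suc (d * y)                          ≡⟨ cong (λ z → suc (d * z)) (m≡m%n+[m/n]*n y m) ⟩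
        suc (d * (y % m + y / m * m))        ≡⟨ expand d (y % m) (y / m) m ⟩
        d * (y / m) * m + suc (d * (y % m))  ∎) m∣) (n∣m*n (d * (y / m)))
        where
        open ≡-Reasoning
        expand : ∀ d a b m → suc (d * (a + b * m)) ≡ d * b * m + suc (d * a)
        expand = solve-∀

      positiveInverse : ∀ z → z < m → m ∣ suc (d * z) → ∃ λ x → suc x < m × m ∣ above d x
      positiveInverse zero    _   m∣ = ⊥-elim (m∤1 (subst (λ z → m ∣ suc z) (*-zeroʳ d) m∣))
      positiveInverse (suc x) x<m m∣ = x , x<m , m∣

      reducedInverse : ∃ λ x → suc x < m × m ∣ above d x
      reducedInverse = let (y , m∣) = inverse in
        positiveInverse (y % m) (m%n<n y m) (m∣suc-d*[y%m] y m∣)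

      -- The exponents d (x + 1) + 1 and d (m - x - 1) - 1 add up to d m.
      below-complement : ∀ x → suc x < m → m ∣ above d x → m ∣ below d (m ∸ suc x)
      below-complement x x<m m∣ with m ∸ suc x in eq
      ... | zero  = contradiction (m∸n≡0⇒m≤n eq) (<⇒≱ x<m)
      ... | suc y = ∣m+n∣m⇒∣n (subst (m ∣_) (sym eq′) (n∣m*n d)) m∣
        where
        open ≡-Reasoning
        eq′ : above d x + below d (suc y) ≡ d * m
        eq′ = begin
          suc (d * suc x) + (d * suc y ∸ 1)  ≡⟨ sym (+-suc (d * suc x) (d * suc y ∸ 1)) ⟩
          d * suc x + suc (d * suc y ∸ 1)    ≡⟨ cong (d * suc x +_) (suc-pred (d * suc y) {{>-nonZero (*-mono-< 0<d (z<s {y}))}}) ⟩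
          d * suc x + d * suc y              ≡⟨ sym (*-distribˡ-+ d (suc x) (suc y)) ⟩
          d * (suc x + suc y)                ≡⟨ cong (λ z → d * (suc x + z)) (sym eq) ⟩
          d * (suc x + (m ∸ suc x))          ≡⟨ cong (d *_) (m+[n∸m]≡n (<⇒≤ x<m)) ⟩
          d * m                              ∎

      periodic : ∀ {g} → (∀ x → g (m + x) ≡ m * d + g x) → Periodic m g
      periodic {g} e x = divides?-cong
        (λ m∣ → ∣m+n∣m⇒∣n (subst (m ∣_) (e x) m∣) (m∣m*n d))
        (λ m∣ → subst (m ∣_) (sym (e x)) (∣m∣n⇒∣m+n (m∣m*n d) m∣))

    multiple-periodic : Periodic m (multiple d)
    multiple-periodic = periodic (eq d m)
      where
      eq : ∀ d m x → d * suc (m + x) ≡ m * d + d * suc x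
      eq = solve-∀

    above-periodic : Periodic m (above d)
    above-periodic = periodic (eq d m)
      where
      eq : ∀ d m x → suc (d * suc (m + x)) ≡ m * d + suc (d * suc x)
      eq = solve-∀

    suc-below′ : ∀ x → suc (below d (suc x)) ≡ d * suc x
    suc-below′ x = suc-pred (d * suc x) {{>-nonZero (*-mono-< 0<d (z<s {x}))}}

    -- Only the exceptional value `below d 0` needs care: the term one period later is d m - 1, and
    -- neither it nor 1 is a multiple of m.
    below-periodic : Periodic m (below d)
    below-periodic zero = trans (divides?-no not) (sym (divides?-no m∤1))
      where
      not : m ∤ below d (m + 0)
      not m∣ rewrite +-identityʳ m = m∣suc⇒ m∣ (subst (m ∣_) (eq m) (n∣m*n d))
        where
        eq : ∀ k .{{_ : NonZero k}} → d * k ≡ suc (below d k)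
        eq (suc k) = sym (suc-below′ k)
    below-periodic (suc x) = divides?-cong
      (λ m∣ → ∣m+n∣m⇒∣n (subst (m ∣_) eq m∣) (n∣m*n d))
      (λ m∣ → subst (m ∣_) (sym eq) (∣m∣n⇒∣m+n (n∣m*n d) m∣))
      where
      open ≡-Reasoning
      eq : below d (m + suc x) ≡ d * m + below d (suc x)
      eq = suc-injective (begin
        suc (below d (m + suc x))      ≡⟨ cong (λ z → suc (below d z)) (+-suc m x) ⟩
        suc (below d (suc (m + x)))    ≡⟨ suc-below′ (m + x) ⟩
        d * suc (m + x)                ≡⟨ cong (d *_) (sym (+-suc m x)) ⟩
        d * (m + suc x)                ≡⟨ *-distribˡ-+ d m (suc x) ⟩
        d * m + d * suc x              ≡⟨ cong (d * m +_) (sym (suc-below′ x)) ⟩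
        d * m + suc (below d (suc x))  ≡⟨ +-suc (d * m) _ ⟩
        suc (d * m + below d (suc x))  ∎)

    count-multiple-small : ∀ N → N < m → count m (multiple d) N ≡ 0
    count-multiple-small N N<m = count-zero N λ x x<N m∣ →
      >⇒∤ (≤-<-trans x<N N<m) (coprime-divisor coprime m∣)

    private
      count-multiple≤1 : count m (multiple d) m ≤ 1
      count-multiple≤1 = subst (λ k → count m (multiple d) k ≤ 1) (suc-pred m)
        (subst (λ c → c + divides? m (multiple d (pred m)) ≤ 1)
          (sym (count-multiple-small (pred m) (subst (pred m <_) (suc-pred m) ≤-refl)))
          (divides?≤1 m _))

      1≤count-above : 1 ≤ count m (above d) m
      1≤count-above = let (x , x<m , m∣) = reducedInverse in
        count-positive m x (<-trans ≤-refl x<m) m∣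

      1≤count-below : 1 ≤ count m (below d) m
      1≤count-below = let (x , x<m , m∣) = reducedInverse in
        count-positive m (m ∸ suc x) (∸-monoʳ-< z<s (<⇒≤ x<m)) (below-complement x x<m m∣)

    -- In a full period of length m there is at most one multiple of m among the d (x + 1), namely
    -- the last, and at least one among the d (x + 1) + 1. The incomplete period at the end
    -- therefore contributes nothing to the left side.
    count-multiple≤count-above : ∀ N → count m (multiple d) N ≤ count m (above d) N
    count-multiple≤count-above N = begin
      count m (multiple d) N
        ≡⟨ cong (count m (multiple d)) N≡ ⟩
      count m (multiple d) (c * m + s)
        ≡⟨ count-+ m (multiple d) (c * m) s ⟩
      count m (multiple d) (c * m) + count m (λ x → multiple d (c * m + x)) s
        ≡⟨ cong₂ _+_ (count-* multiple-periodic c) (trans (count-shift multiple-periodic c s) (count-multiple-small s (m%n<n N m))) ⟩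
      c * count m (multiple d) m + 0
        ≤⟨ +-mono-≤ (*-monoʳ-≤ c (≤-trans count-multiple≤1 1≤count-above)) z≤n ⟩
      c * count m (above d) m + count m (λ x → above d (c * m + x)) s
        ≡⟨ cong (_+ count m (λ x → above d (c * m + x)) s) (count-* above-periodic c) ⟨
      count m (above d) (c * m) + count m (λ x → above d (c * m + x)) s
        ≡⟨ count-+ m (above d) (c * m) s ⟨
      count m (above d) (c * m + s)
        ≡⟨ cong (count m (above d)) N≡ ⟨
      count m (above d) N ∎
      where
      open ≤-Reasoning
      c = N / m
      s = N % m
      N≡ : N ≡ c * m + s
      N≡ = trans (m≡m%n+[m/n]*n N m) (+-comm s (c * m))

    -- Over n + 1 terms, a whole number of periods, `below` is hit at least as often as `multiple`.
    -- The strict inequality comes from the term d (n + 1) of `multiple`, which is a hit but lies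
    -- outside the first n terms.
    count-multiple<count-below : ∀ n → m ∣ suc n → suc (count m (multiple d) n) ≤ count m (below d) (suc n)
    count-multiple<count-below n (divides c 1+n≡c*m) = begin
      suc (count m (multiple d) n)
        ≡⟨ +-comm 1 _ ⟩
      count m (multiple d) n + 1
        ≡⟨ cong (count m (multiple d) n +_) (divides?-yes (∣n⇒∣m*n d (divides c 1+n≡c*m))) ⟨
      count m (multiple d) (suc n)
        ≡⟨ cong (count m (multiple d)) 1+n≡c*m ⟩
      count m (multiple d) (c * m)
        ≡⟨ count-* multiple-periodic c ⟩
      c * count m (multiple d) m
        ≤⟨ *-monoʳ-≤ c (≤-trans count-multiple≤1 1≤count-below) ⟩
      c * count m (below d) m
        ≡⟨ count-* below-periodic c ⟨
      count m (below d) (c * m)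
        ≡⟨ cong (count m (below d)) 1+n≡c*m ⟨
      count m (below d) (suc n) ∎
      where open ≤-Reasoning

-- Products of cyclotomic factors and their exponents.

module Valuation (𝓓 : ConstDomain) where

  open ConstDomain 𝓓 using (noZeroDivisors; 1≉0; Const; const-1) renaming (ring to R)
  open Counting
  open CommutativeRing R
  open Solver R
  open BigOp R
  open Localisation 𝓓
  open FractionRing R noZeroDivisors 1≉0
  open import Relation.Binary.Reasoning.Setoid setoid

  geometric : ∀ x y n → ∃ λ z → x ^ n - y ^ n ≈ (x - y) * z
  geometric x y zero    = 0# , trans (-‿inverseʳ 1#) (sym (zeroʳ _))
  geometric x y (suc n) with geometric x y n
  ... | z , e = y ^ n + x * z , (begin
    x * x ^ n - y * y ^ n
      ≈⟨ solve 4 (λ x y X Y → x :* X :- y :* Y := (x :- y) :* Y :+ x :* (X :- Y)) refl x y (x ^ n) (y ^ n) ⟩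
    (x - y) * y ^ n + x * (x ^ n - y ^ n)
      ≈⟨ +-congˡ (*-congˡ e) ⟩
    (x - y) * y ^ n + x * ((x - y) * z)
      ≈⟨ solve 4 (λ x y Y z → (x :- y) :* Y :+ x :* ((x :- y) :* z) := (x :- y) :* (Y :+ x :* z)) refl x y (y ^ n) z ⟩
    (x - y) * (y ^ n + x * z) ∎)

  module Cyclotomic
    (q : Carrier) (φ : ℕ → Carrier) (n B : ℕ) (1<n : 1 < n) (n≤B : n ≤ B)
    (φ-one : φ 1 ≈ 1# - q)
    (φ-coprime : ∀ {i j} → ¬ i ≡ j → Coprime (φ (suc i)) (φ (suc j)))
    (1-q^ : ∀ j → 0 < j → j ≤ B → 1# - q ^ j ≈ prod B (λ i → φ (suc i) ^ divides? (suc i) j))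
    where

    private
      0<n : 0 < n
      0<n = ℕₚ.<-trans ℕ.z<s 1<n

    -- Products of cyclotomic factors are handled through their exponent vectors, indexed by 1 ≤ m ≤
    -- B.
    Π : (ℕ → ℕ) → Carrier
    Π e = prod B (λ i → φ (suc i) ^ e (suc i))

    Π-cong : ∀ {e f} → (∀ m → e m ≡ f m) → Π e ≈ Π f
    Π-cong e≡f = prod-cong B λ i → reflexive (≡.cong (φ (suc i) ^_) (e≡f (suc i)))

    Π-+ : ∀ e f → Π (λ m → e m ℕ.+ f m) ≈ Π e * Π f
    Π-+ e f = trans (prod-cong B λ i → ^-homo-* (φ (suc i)) (e (suc i)) (f (suc i))) (prod-* B _ _)

    Π-zero : Π (λ _ → 0) ≈ 1#
    Π-zero = prod-one B λ _ _ → refl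

    single : ℕ → ℕ → ℕ
    single m k with k ℕₚ.≟ m
    ... | yes _ = 1
    ... | no  _ = 0

    Π-single : ∀ {m} → m < B → Π (single (suc m)) ≈ φ (suc m)
    Π-single {m} m<B = trans (prod-single B m m<B others) (trans (reflexive (≡.cong (φ (suc m) ^_) self)) (*-identityʳ _))
      where
      self : single (suc m) (suc m) ≡ 1
      self with suc m ℕₚ.≟ suc m
      ... | yes _ = ≡.refl
      ... | no ¬e = contradiction ≡.refl ¬e
      others : ∀ j → ¬ j ≡ m → φ (suc j) ^ single (suc m) (suc j) ≈ 1#
      others j j≢m with suc j ℕₚ.≟ suc m
      ... | yes e = contradiction (ℕₚ.suc-injective e) j≢m
      ... | no _  = refl

    -- The q-integer [n] is the product of the φ m over the divisors m > 1 of n.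
    support : ℕ → ℕ
    support zero          = 0
    support (suc zero)    = 0
    support (suc (suc m)) = divides? (suc (suc m)) n

    support-one : ∀ m → 1 < m → m ∣ n → support m ≡ 1
    support-one (suc (suc m)) _ m∣n = divides?-yes m∣n
    support-one (suc zero) (s≤s ()) _

    support⇒1<m : ∀ m → support m ≡ 1 → 1 < m
    support⇒1<m (suc (suc m)) _ = s≤s (s≤s z≤n)

    support⇒∣ : ∀ m → support m ≡ 1 → m ∣ n
    support⇒∣ (suc (suc m)) e = divides?⇒∣ e

    [n] : Carrier
    [n] = Π support

    1-q^n : (1# - q) * [n] ≈ 1# - q ^ n
    1-q^n = sym (trans (1-q^ n (ℕₚ.<-trans ℕ.z<s 1<n) n≤B) (split B (ℕₚ.<-≤-trans (ℕₚ.<-trans ℕ.z<s 1<n) n≤B)))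
      where
      split : ∀ B → 0 < B → prod B (λ i → φ (suc i) ^ divides? (suc i) n) ≈ (1# - q) * prod B (λ i → φ (suc i) ^ support (suc i))
      split (suc B) _ = begin
        prod (suc B) (λ i → φ (suc i) ^ divides? (suc i) n)
          ≈⟨ prod-sucˡ B _ ⟩
        φ 1 ^ divides? 1 n * prod B (λ i → φ (suc (suc i)) ^ divides? (suc (suc i)) n)
          ≈⟨ *-cong (trans (reflexive (≡.cong (φ 1 ^_) (divides?-yes (1∣ n)))) (trans (*-identityʳ _) φ-one))
               (sym (*-identityˡ _)) ⟩
        (1# - q) * (1# * prod B (λ i → φ (suc (suc i)) ^ divides? (suc (suc i)) n))
          ≈⟨ *-congˡ (prod-sucˡ B (λ i → φ (suc i) ^ support (suc i))) ⟨
        (1# - q) * prod (suc B) (λ i → φ (suc i) ^ support (suc i)) ∎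

    -- The modulus of the stronger congruence also fixes the ring O for the weaker one, so that both
    -- are proved in the same ring.
    Q : Carrier
    Q = [n] * φ n

    private
      coprime-[n] : ∀ m → support (suc m) ≡ 0 → Coprime (φ (suc m)) [n]
      coprime-[n] m s≡0 = coprime-sym (coprime-prod B λ i _ → factor i)
        where
        factor : ∀ i → Coprime (φ (suc i) ^ support (suc i)) (φ (suc m))
        factor i with i ℕₚ.≟ m
        ... | yes ≡.refl = coprime-cong (reflexive (≡.cong (φ (suc i) ^_) (≡.sym s≡0))) refl coprime-one
        ... | no  i≢m    = coprime-^ (support (suc i)) (φ-coprime i≢m)

      support-n : support n ≡ 1
      support-n = support-one n 1<n ∣-refl

    -- Outside `support` the index is 1 or does not divide n, hence differs from the index of every
    -- factor of Q. These cyclotomic factors are units of O, and only the divisors m > 1 of n have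
    -- to be counted.
    coprime-φ : ∀ m → support (suc m) ≡ 0 → Coprime (φ (suc m)) Q
    coprime-φ m s≡0 = coprime-*ʳ (coprime-[n] m s≡0) (coprime-φₙ n ≡.refl)
      where
      coprime-φₙ : ∀ k → k ≡ n → Coprime (φ (suc m)) (φ k)
      coprime-φₙ zero    ≡.refl = contradiction 1<n λ ()
      coprime-φₙ (suc k) ≡.refl = φ-coprime λ { ≡.refl → contradiction (≡.trans (≡.sym s≡0) support-n) λ () }

    open Modulo Q

    coprime-1-q : Coprime (1# - q) Q
    coprime-1-q = coprime-cong φ-one refl (coprime-φ 0 ≡.refl)

    prod-1-q^ : ∀ N g → (∀ x → x < N → 0 < g x) → (∀ x → x < N → g x ≤ B) →
      prod N (λ x → 1# - q ^ g x) ≈ Π (λ m → count m g N)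
    prod-1-q^ zero    g pos bound = sym Π-zero
    prod-1-q^ (suc N) g pos bound = trans
      (*-cong (prod-1-q^ N g (λ x x<N → pos x (ℕₚ.m<n⇒m<1+n x<N)) (λ x x<N → bound x (ℕₚ.m<n⇒m<1+n x<N)))
              (1-q^ (g N) (pos N ℕₚ.≤-refl) (bound N ℕₚ.≤-refl)))
      (sym (Π-+ (λ m → count m g N) (λ m → divides? m (g N))))

    -- Here counting turns into divisibility: `y` is the inverse of the denominator, and δ bounds
    -- from below the surplus of the numerator. On `support` the denominator is cancelled
    -- completely; off `support` its factors are units of O and are kept as the denominator V.
    multiple-ratio : ∀ δ {N M g h y} →
      (∀ x → x < N → 0 < g x) → (∀ x → x < N → g x ≤ B) →
      (∀ x → x < M → 0 < h x) → (∀ x → x < M → h x ≤ B) →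
      (∀ m → support m ≡ 0 → δ m ≡ 0) →
      (∀ m → support m ≡ 1 → count m h M ℕ.+ δ m ≤ count m g N) →
      ι (prod M (λ x → 1# - q ^ h x)) K.* y K.≈ K.1# →
      Multiple (Π δ) (ι (prod N (λ x → 1# - q ^ g x)) K.* y)
    multiple-ratio δ {N} {M} {g} {h} {y} g-pos g-bound h-pos h-bound δ-support counts inverse =
      multiple-of (Π u) (Π v) (coprime-prod B λ i _ → v-coprime i) (SK.begin
        (ι Ng K.* y) K.* ι (Π v)
          SK.≈⟨ SK.solve 3 (λ a y v → (a SK.:* y) SK.:* v SK.:= y SK.:* (a SK.:* v)) K.refl (ι Ng) y (ι (Π v)) ⟩
        y K.* (ι Ng K.* ι (Π v))
          SK.≈⟨ K.*-congˡ (K.trans (K.sym (ι-* Ng (Π v))) (ι-cong balance)) ⟩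
        y K.* ι (Nh * (Π δ * Π u))
          SK.≈⟨ K.*-congˡ (ι-* Nh (Π δ * Π u)) ⟩
        y K.* (ι Nh K.* ι (Π δ * Π u))
          SK.≈⟨ SK.solve 3 (λ a y v → y SK.:* (a SK.:* v) SK.:= (a SK.:* y) SK.:* v) K.refl (ι Nh) y (ι (Π δ * Π u)) ⟩
        (ι Nh K.* y) K.* ι (Π δ * Π u)
          SK.≈⟨ K.trans (K.*-congʳ inverse) (K.*-identityˡ _) ⟩
        ι (Π δ * Π u) SK.∎)
      where
      module SK where
        open Solver fractionRing public
        open import Relation.Binary.Reasoning.Setoid K.setoid public
      Ng = prod N (λ x → 1# - q ^ g x)
      Nh = prod M (λ x → 1# - q ^ h x)
      α β u v : ℕ → ℕ
      α m = count m g N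
      β m = count m h M
      u m with support m
      ... | zero  = α m
      ... | suc _ = α m ℕ.∸ (β m ℕ.+ δ m)
      v m with support m
      ... | zero  = β m
      ... | suc _ = 0
      support≤1 : ∀ m → support m ≤ 1
      support≤1 zero          = z≤n
      support≤1 (suc zero)    = z≤n
      support≤1 (suc (suc m)) = divides?≤1 (suc (suc m)) n
      exponents : ∀ m → α m ℕ.+ v m ≡ β m ℕ.+ (δ m ℕ.+ u m)
      exponents m with support m | δ-support m | counts m | support≤1 m
      ... | zero | δ≡0 | _ | _ = ≡.trans (ℕₚ.+-comm (α m) (β m)) (≡.cong (λ z → β m ℕ.+ (z ℕ.+ α m)) (≡.sym (δ≡0 ≡.refl)))
      ... | suc zero | _ | c | _ = ≡.trans (ℕₚ.+-identityʳ (α m)) (≡.trans (≡.sym (ℕₚ.m+[n∸m]≡n (c ≡.refl))) (ℕₚ.+-assoc (β m) (δ m) _))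
      ... | suc (suc _) | _ | _ | s≤s ()
      balance : Ng * Π v ≈ Nh * (Π δ * Π u)
      balance = begin
        Ng * Π v                         ≈⟨ *-congʳ (prod-1-q^ N g g-pos g-bound) ⟩
        Π α * Π v                        ≈⟨ Π-+ α v ⟨
        Π (λ m → α m ℕ.+ v m)            ≈⟨ Π-cong exponents ⟩
        Π (λ m → β m ℕ.+ (δ m ℕ.+ u m))  ≈⟨ Π-+ β (λ m → δ m ℕ.+ u m) ⟩
        Π β * Π (λ m → δ m ℕ.+ u m)      ≈⟨ *-cong (sym (prod-1-q^ M h h-pos h-bound)) (Π-+ δ u) ⟩
        Nh * (Π δ * Π u)                 ∎
      v-coprime : ∀ i → Coprime (φ (suc i) ^ v (suc i)) Q
      v-coprime i with support (suc i) in eq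
      ... | zero  = coprime-^ (β (suc i)) (coprime-φ i eq)
      ... | suc _ = coprime-one

    [n]≈φ* : ∃ λ E → [n] ≈ φ n * E
    [n]≈φ* = split n ≡.refl
      where
      split : ∀ k → k ≡ n → ∃ λ E → [n] ≈ φ k * E
      split zero    0≡n    = contradiction 0≡n (ℕₚ.<⇒≢ 0<n)
      split (suc k) ≡.refl = Π (λ m → support m ℕ.∸ single n m) , (begin
        Π support
          ≈⟨ Π-cong (λ m → ≡.sym (ℕₚ.m+[n∸m]≡n (single≤support m))) ⟩
        Π (λ m → single n m ℕ.+ (support m ℕ.∸ single n m))
          ≈⟨ Π-+ (single n) (λ m → support m ℕ.∸ single n m) ⟩
        Π (single n) * Π (λ m → support m ℕ.∸ single n m)
          ≈⟨ *-congʳ (Π-single n≤B) ⟩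
        φ n * Π (λ m → support m ℕ.∸ single n m) ∎)
        where
        single≤support : ∀ m → single n m ≤ support m
        single≤support m with m ℕₚ.≟ n
        ... | yes ≡.refl = ℕₚ.≤-reflexive (≡.sym (support-one n 1<n ∣-refl))
        ... | no  _      = z≤n

    -- Both factors [n] and φ n of Q divide 1 - q^n.
    coprime-Q : ∀ {V} → Coprime V (1# - q ^ n) → Coprime V Q
    coprime-Q {V} h = coprime-*ʳ V⊥[n] (coprime-factorʳ (coprime-cong refl (proj₂ [n]≈φ*) V⊥[n]))
      where
      V⊥[n] : Coprime V [n]
      V⊥[n] = coprime-factorʳ (coprime-cong refl (trans (sym 1-q^n) (*-comm _ _)) h)

    coprime-q : Coprime q Q
    coprime-q = coprime-Q (bézout (q ^ pred n) 1# 1# const-1 (begin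
      q ^ pred n * q + 1# * (1# - q ^ n)
        ≈⟨ +-cong (*-comm _ q) (*-identityˡ _) ⟩
      q ^ suc (pred n) + (1# - q ^ n)
        ≈⟨ +-congʳ (reflexive (≡.cong (q ^_) (ℕₚ.suc-pred n {{ℕ.>-nonZero 0<n}}))) ⟩
      q ^ n + (1# - q ^ n)
        ≈⟨ solve 1 (λ x → x :+ (:1 :- x) := :1) refl (q ^ n) ⟩
      1# ∎))

    private
      q^-^ : ∀ j → ∃ λ w → 1# - (q ^ j) ^ n ≈ (1# - q ^ n) * w
      q^-^ j with geometric 1# (q ^ n) j
      ... | w , eq = w , trans (+-cong (sym (1^ j)) (-‿cong (begin
        (q ^ j) ^ n    ≈⟨ ^-assocʳ q j n ⟩
        q ^ (j ℕ.* n)  ≡⟨ ≡.cong (q ^_) (ℕₚ.*-comm j n) ⟩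
        q ^ (n ℕ.* j)  ≈⟨ ^-assocʳ q n j ⟨
        (q ^ n) ^ j    ∎))) eq

    -- Modulo 1 - q^n the n-th power of y q^j is y^n, so a multiple of 1 - y q^j is congruent to the
    -- constant 1 - y^n. This is how the factors containing a or b become units of O.
    coprime-1-yq^ : ∀ y j → Const (1# - y ^ n) → Coprime (1# - y * q ^ j) Q
    coprime-1-yq^ y j k with geometric 1# (y * q ^ j) n | q^-^ j
    ... | z , ez | w , ew = coprime-Q (bézout z (- (y ^ n * w)) (1# - y ^ n) k (begin
      z * (1# - y * q ^ j) + - (y ^ n * w) * (1# - q ^ n)
        ≈⟨ solve 5 (λ z A Y w B → z :* A :+ :- (Y :* w) :* B := A :* z :- Y :* (B :* w)) refl z _ (y ^ n) w _ ⟩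
      (1# - y * q ^ j) * z - y ^ n * ((1# - q ^ n) * w)
        ≈⟨ +-cong (sym ez) (-‿cong (*-congˡ (sym ew))) ⟩
      1# ^ n - (y * q ^ j) ^ n - y ^ n * (1# - (q ^ j) ^ n)
        ≈⟨ +-congʳ (+-cong (1^ n) (-‿cong (^-*-distrib y (q ^ j) n))) ⟩
      1# - y ^ n * (q ^ j) ^ n - y ^ n * (1# - (q ^ j) ^ n)
        ≈⟨ solve 2 (λ Y Z → :1 :- Y :* Z :- Y :* (:1 :- Z) := :1 :- Y) refl (y ^ n) ((q ^ j) ^ n) ⟩
      1# - y ^ n ∎))

    coprime-y-q^ : ∀ y j → Const (y ^ n - 1#) → Coprime (y - q ^ j) Q
    coprime-y-q^ y j k with geometric y (q ^ j) n | q^-^ j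
    ... | z , ez | w , ew = coprime-Q (bézout z (- w) (y ^ n - 1#) k (begin
      z * (y - q ^ j) + - w * (1# - q ^ n)
        ≈⟨ solve 4 (λ z A w B → z :* A :+ :- w :* B := A :* z :- B :* w) refl z _ w _ ⟩
      (y - q ^ j) * z - (1# - q ^ n) * w
        ≈⟨ +-cong (sym ez) (-‿cong (sym ew)) ⟩
      y ^ n - (q ^ j) ^ n - (1# - (q ^ j) ^ n)
        ≈⟨ solve 2 (λ Y Z → Y :- Z :- (:1 :- Z) := Y :- :1) refl (y ^ n) ((q ^ j) ^ n) ⟩
      y ^ n - 1# ∎))

-- Divisibility of the moments and of the expansion coefficients.

module Congruence (𝓓 : ConstDomain) where

  open ConstDomain 𝓓 using (noZeroDivisors; 1≉0; Const; const-1) renaming (ring to R)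
  open Counting
  open CommutativeRing R
  open BigOp R
  open Localisation 𝓓
  open FractionRing R noZeroDivisors 1≉0
  open Valuation 𝓓

  module KB = BigOp fractionRing
  open Solver fractionRing
  open import Relation.Binary.Reasoning.Setoid K.setoid

  ι-^ : ∀ x n → ι (x ^ n) K.≈ ι x KB.^ n
  ι-^ x zero    = ι-1
  ι-^ x (suc n) = K.trans (ι-* x (x ^ n)) (K.*-congˡ (ι-^ x n))

  ι-1- : ∀ x → ι (1# - x) K.≈ K.1# K.- ι x
  ι-1- x = K.trans (ι-+ 1# (- x)) (K.+-cong ι-1 (ι-neg x))

  ι-prod : ∀ n f → ι (prod n f) K.≈ KB.prod n (λ i → ι (f i))
  ι-prod zero    f = ι-1
  ι-prod (suc n) f = K.trans (ι-* _ _) (K.*-congʳ (ι-prod n f))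

  module Setup
    (n d : ℕ) (1<n : 1 < n) (3≤d : 3 ≤ d) (n⊥d : ℕC.Coprime n d)
    (q : Carrier) (φ : ℕ → Carrier)
    (φ-one : φ 1 ≈ 1# - q)
    (φ-coprime : ∀ {i j} → ¬ i ≡ j → Coprime (φ (suc i)) (φ (suc j)))
    (1-q^ : ∀ B j → 0 < j → j ≤ B → 1# - q ^ j ≈ prod B (λ i → φ (suc i) ^ divides? (suc i) j))
    (q≉0 : ¬ q ≈ 0#)
    (1-q^≉0 : ∀ j → ¬ 1# - q ^ suc j ≈ 0#)
    where

    -- A common bound for n and for all exponents j of the factors 1 - q^j that occur; the moments
    -- have indices l up to 2n.
    B : ℕ
    B = suc (d ℕ.* (n ℕ.+ n))

    private
      0<d : 0 < d
      0<d = ℕₚ.<-≤-trans ℕ.z<s 3≤d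

      0<n : 0 < n
      0<n = ℕₚ.<-trans ℕ.z<s 1<n

      n≤B : n ≤ B
      n≤B = ℕₚ.m≤n⇒m≤1+n (ℕₚ.≤-trans (ℕₚ.m≤m+n n n) (ℕₚ.m≤n*m (n ℕ.+ n) d {{ℕ.>-nonZero 0<d}}))

    open Cyclotomic q φ n B 1<n n≤B φ-one φ-coprime (1-q^ B) public
    open Modulo Q public

    qK r p p⁻ : K.Carrier
    qK = ι q
    r  = recip q≉0
    p  = qK KB.^ d
    p⁻ = r KB.^ d

    qr≈1 : qK K.* r K.≈ K.1#
    qr≈1 = recip-inverse q≉0

    κ : ℕ → K.Carrier
    κ zero    = K.1#
    κ (suc j) = recip (1-q^≉0 j)

    κ-inverse : ∀ j → 0 < j → ι (1# - q ^ j) K.* κ j K.≈ K.1#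
    κ-inverse (suc j) _ = recip-inverse (1-q^≉0 j)

    p^ : ∀ x → p KB.^ x K.≈ ι (q ^ (d ℕ.* x))
    p^ x = K.trans (KB.^-assocʳ qK d x) (K.sym (ι-^ q (d ℕ.* x)))

    open QSeries fractionRing
    module QB = Basis p p⁻ r qK (KB.^-inverse qr≈1 d) qr≈1

    e : ℕ → K.Carrier
    e x = κ (multiple d x)

    private
      0<multiple : ∀ x → 0 < multiple d x
      0<multiple x = ℕₚ.*-mono-< 0<d (ℕ.z<s {x})

      0<below : ∀ x → 0 < below d x
      0<below zero    = ℕ.z<s
      0<below (suc x) = ℕₚ.≤-trans (ℕₚ.≤-trans (ℕ.s≤s ℕ.z≤n) (ℕₚ.∸-monoˡ-≤ 1 3≤d))
        (ℕₚ.∸-monoˡ-≤ 1 (ℕₚ.m≤m*n d (suc x)))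

      suc-below : ∀ x → suc (below d (suc x)) ≡ d ℕ.* suc x
      suc-below x = ℕₚ.suc-pred (d ℕ.* suc x) {{ℕ.>-nonZero (0<multiple x)}}

    e-inverse : ∀ x → (K.1# K.- p KB.^ suc x) K.* e x K.≈ K.1#
    e-inverse x = K.trans (K.*-congʳ (K.trans (K.+-congˡ (K.-‿cong (p^ (suc x)))) (K.sym (ι-1- _))))
      (κ-inverse (multiple d x) (0<multiple x))

    module QT = QB.Telescope e e-inverse

    below-factor : ∀ x → K.1# K.- r K.* p KB.^ suc x K.≈ ι (1# - q ^ below d (suc x))
    below-factor x = K.trans (K.+-congˡ (K.-‿cong (begin
      r K.* p KB.^ suc x                      ≈⟨ K.*-congˡ (p^ (suc x)) ⟩
      r K.* ι (q ^ (d ℕ.* suc x))             ≡⟨ ≡.cong (λ j → r K.* ι (q ^ j)) (≡.sym (suc-below x)) ⟩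
      r K.* ι (q * q ^ below d (suc x))       ≈⟨ K.*-congˡ (ι-* q _) ⟩
      r K.* (qK K.* ι (q ^ below d (suc x)))  ≈⟨ solve 3 (λ r q x → r :* (q :* x) := q :* r :* x) K.refl r qK _ ⟩
      qK K.* r K.* ι (q ^ below d (suc x))    ≈⟨ K.trans (K.*-congʳ qr≈1) (K.*-identityˡ _) ⟩
      ι (q ^ below d (suc x))                 ∎))) (K.sym (ι-1- _))

    above-factor : ∀ x → K.1# K.- qK K.* p K.* p KB.^ x K.≈ ι (1# - q ^ above d x)
    above-factor x = K.trans (K.+-congˡ (K.-‿cong (begin
      qK K.* p K.* p KB.^ x         ≈⟨ K.*-assoc qK p _ ⟩
      qK K.* p KB.^ suc x           ≈⟨ K.*-congˡ (p^ (suc x)) ⟩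
      qK K.* ι (q ^ (d ℕ.* suc x))  ≈⟨ ι-* q _ ⟨
      ι (q ^ above d x)             ∎))) (K.sym (ι-1- _))

    integral-q : Integral qK
    integral-q = integral-ι q

    integral-r : Integral r
    integral-r = integral-inverse coprime-q qr≈1

    integral-p : Integral p
    integral-p = integral-^ d integral-q

    integral-p⁻ : Integral p⁻
    integral-p⁻ = integral-^ d integral-r

    integral-basis : ∀ m k → Integral (QB.φ m k)
    integral-basis m k = multiple-*ʳ
      (integral-- integral-1 (multiple-*ʳ (integral-^ m integral-p) (integral-^ k integral-p⁻)))
      (integral-- integral-1 (multiple-*ʳ (multiple-*ʳ integral-r (integral-^ m integral-p)) (integral-^ k integral-p)))

    private
      0<support⇒ : ∀ {m} → support m ≡ 1 → ℕC.Coprime m d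
      0<support⇒ {m} s≡1 (k∣m , k∣d) = n⊥d (∣-trans k∣m (support⇒∣ m s≡1) , k∣d)

      d*-≤ : ∀ {x} → x ≤ n ℕ.+ n → d ℕ.* x ≤ B
      d*-≤ x≤ = ℕₚ.m≤n⇒m≤1+n (ℕₚ.*-monoʳ-≤ d x≤)

      suc-d*-≤ : ∀ {x} → x ≤ n ℕ.+ n → suc (d ℕ.* x) ≤ B
      suc-d*-≤ x≤ = s≤s (ℕₚ.*-monoʳ-≤ d x≤)

      below≤B : ∀ x → x ≤ n ℕ.+ n → below d x ≤ B
      below≤B zero    _  = s≤s z≤n
      below≤B (suc x) x≤ = ℕₚ.≤-trans (ℕₚ.m∸n≤m _ 1) (d*-≤ x≤)

      n≤n+n : n ≤ n ℕ.+ n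
      n≤n+n = ℕₚ.m≤m+n n n

    -- Written in the shape that `boundary` produces at k = n; the factor 1 - p^n cancels the last
    -- `e`.
    z : K.Carrier
    z = (K.1# K.- p KB.^ n) K.* KB.prod n (λ x → (K.1# K.- r K.* p KB.^ x) K.* e x)

    private
      e-prod-inverse : ∀ M → ι (prod M (λ x → 1# - q ^ multiple d x)) K.* KB.prod M e K.≈ K.1#
      e-prod-inverse M = K.trans (K.*-congʳ (ι-prod M _)) (K.trans (K.sym (KB.prod-* M _ _))
        (KB.prod-one M λ x _ → κ-inverse (multiple d x) (0<multiple x)))

      z≈ : ∀ n₀ → suc n₀ ≡ n → z K.≈ K.- r K.* (ι (prod n (λ x → 1# - q ^ below d x)) K.* KB.prod n₀ e)
      z≈ n₀ ≡.refl = begin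
        (K.1# K.- p KB.^ n) K.* KB.prod n (λ x → (K.1# K.- r K.* p KB.^ x) K.* e x)
          ≈⟨ K.*-congˡ (KB.prod-* n _ _) ⟩
        (K.1# K.- p KB.^ n) K.* (KB.prod n (λ x → K.1# K.- r K.* p KB.^ x) K.* (KB.prod n₀ e K.* e n₀))
          ≈⟨ solve 4 (λ a P E e → a :* (P :* (E :* e)) := a :* e :* (P :* E)) K.refl _ _ (KB.prod n₀ e) (e n₀) ⟩
        (K.1# K.- p KB.^ n) K.* e n₀ K.* (KB.prod n (λ x → K.1# K.- r K.* p KB.^ x) K.* KB.prod n₀ e)
          ≈⟨ K.*-cong (e-inverse n₀) (K.*-congʳ (KB.prod-sucˡ n₀ _)) ⟩
        K.1# K.* ((K.1# K.- r K.* K.1#) K.* KB.prod n₀ (λ x → K.1# K.- r K.* p KB.^ suc x) K.* KB.prod n₀ e)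
          ≈⟨ K.*-congˡ (K.*-congʳ (K.*-cong 1-r (KB.prod-cong n₀ below-factor))) ⟩
        K.1# K.* (K.- r K.* ι (1# - q ^ 1) K.* KB.prod n₀ (λ x → ι (1# - q ^ below d (suc x))) K.* KB.prod n₀ e)
          ≈⟨ solve 4 (λ r a P E → :1 :* (:- r :* a :* P :* E) := :- r :* (a :* P :* E)) K.refl r _ _ (KB.prod n₀ e) ⟩
        K.- r K.* (ι (1# - q ^ 1) K.* KB.prod n₀ (λ x → ι (1# - q ^ below d (suc x))) K.* KB.prod n₀ e)
          ≈⟨ K.*-congˡ (K.*-congʳ (K.trans (ι-prod n _) (KB.prod-sucˡ n₀ _))) ⟨
        K.- r K.* (ι (prod n (λ x → 1# - q ^ below d x)) K.* KB.prod n₀ e) ∎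
        where
        1-r : K.1# K.- r K.* K.1# K.≈ K.- r K.* ι (1# - q ^ 1)
        1-r = begin
          K.1# K.- r K.* K.1#       ≈⟨ K.+-congʳ (K.sym qr≈1) ⟩
          qK K.* r K.- r K.* K.1#   ≈⟨ solve 2 (λ q r → q :* r :- r :* :1 := :- r :* (:1 :- q)) K.refl qK r ⟩
          K.- r K.* (K.1# K.- qK)   ≈⟨ K.*-congˡ (K.trans (ι-1- _) (K.+-congˡ (K.-‿cong (ι-cong (*-identityʳ q))))) ⟨
          K.- r K.* ι (1# - q ^ 1)  ∎

    multiple-z : Multiple [n] z
    multiple-z = go n ≡.refl
      where
      go : ∀ k → k ≡ n → Multiple [n] z
      go zero     0≡n    = contradiction 0≡n (ℕₚ.<⇒≢ 0<n)
      go (suc n₀) 1+n₀≡n = resp (K.sym (z≈ n₀ 1+n₀≡n)) (multiple-*ˡ (integral-neg integral-r)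
        (multiple-ratio support
          (λ x _ → 0<below x)
          (λ x x<n → below≤B x (ℕₚ.≤-trans (ℕₚ.<⇒≤ x<n) n≤n+n))
          (λ x _ → 0<multiple x)
          (λ x x<n₀ → d*-≤ (ℕₚ.≤-trans (ℕₚ.≤-trans x<n₀ (ℕₚ.n≤1+n n₀)) (ℕₚ.≤-trans (ℕₚ.≤-reflexive 1+n₀≡n) n≤n+n)))
          (λ m s≡0 → s≡0)
          (λ m s≡1 → counts m s≡1)
          (e-prod-inverse n₀)))
        where
        counts : ∀ m → support m ≡ 1 → count m (multiple d) n₀ ℕ.+ support m ≤ count m (below d) n
        counts m s≡1 = ≡.subst (_≤ count m (below d) n)
          (≡.trans (ℕₚ.+-comm 1 _) (≡.cong (count m (multiple d) n₀ ℕ.+_) (≡.sym s≡1)))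
          (≡.subst (λ k → suc (count m (multiple d) n₀) ≤ count m (below d) k) 1+n₀≡n
            (count-multiple<count-below d m (support⇒1<m m s≡1) 0<d (0<support⇒ s≡1) n₀
              (≡.subst (m ∣_) (≡.sym 1+n₀≡n) (support⇒∣ m s≡1))))

    -- Since (1 - q) [n] = 1 - q^n and 1 - q is a unit of O, the multiple z of [n] may be treated as
    -- a multiple of 1 - q^n. The latter contains every φ m with m ∣ n exactly once, and 1 - q^j
    -- contains it at most once.
    multiple-zκ : ∀ δ j → 0 < j → j ≤ B → (∀ m → support m ≡ 0 → δ m ≡ 0) →
      (∀ m → support m ≡ 1 → divides? m j ℕ.+ δ m ≤ 1) → Multiple (Π δ) (z K.* κ j)
    multiple-zκ δ j 0<j j≤B δ-support counts with multiple-z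
    ... | multiple-of U V V⊥Q zV≈ = multiple-cancel (coprime-* V⊥Q coprime-1-q) (resp (K.sym (begin
        z K.* κ j K.* ι (V * (1# - q))
          ≈⟨ K.*-congˡ (ι-* V _) ⟩
        z K.* κ j K.* (ι V K.* ι (1# - q))
          ≈⟨ solve 4 (λ z k V c → z :* k :* (V :* c) := z :* V :* c :* k) K.refl z (κ j) (ι V) (ι (1# - q)) ⟩
        z K.* ι V K.* ι (1# - q) K.* κ j
          ≈⟨ K.*-congʳ (K.trans (K.*-congʳ zV≈) (K.sym (ι-* _ _))) ⟩
        ι ([n] * U * (1# - q)) K.* κ j
          ≈⟨ K.*-congʳ (K.trans (ι-cong (trans (trans (*-comm _ _) (sym (*-assoc _ _ _))) (*-congʳ (trans 1-q^n (sym (*-identityˡ _)))))) (ι-* _ U)) ⟩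
        ι (1# * (1# - q ^ n)) K.* ι U K.* κ j
          ≈⟨ solve 3 (λ a b c → a :* b :* c := a :* c :* b) K.refl _ (ι U) (κ j) ⟩
        ι (1# * (1# - q ^ n)) K.* κ j K.* ι U ∎))
        (multiple-*ʳ (multiple-ratio δ {1} {1} {λ _ → n} {λ _ → j}
          (λ _ _ → 0<n) (λ _ _ → n≤B) (λ _ _ → 0<j) (λ _ _ → j≤B) δ-support
          (λ m s≡1 → ℕₚ.≤-trans (counts m s≡1) (ℕₚ.≤-reflexive (≡.sym (divides?-yes (support⇒∣ m s≡1)))))
          (K.trans (K.*-congʳ (ι-cong (*-identityˡ _))) (κ-inverse j 0<j)))
          (integral-ι U)))

    c : ℕ → K.Carrier
    c k = (K.1# K.- r K.* (p KB.^ k K.* p KB.^ k)) K.* QT.weight k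

    private
      L : ℕ → K.Carrier
      L l = QB.moment n c 0 l

      L≈ : ∀ l → (qK K.* p⁻ KB.^ l K.- K.1#) K.* L l K.≈ QT.boundary l n
      L≈ l = K.trans (K.*-congˡ (KB.sum-cong n λ k → K.*-congˡ (K.*-identityˡ _))) (QT.telescope l n)

      ρ : K.Carrier
      ρ = KB.prod n (λ x → (K.1# K.- r K.* p KB.^ x) K.* e x)

      -- The cofactor of z² in the boundary term at k = n, multiplied by the unit that turns q
      -- p^(-l) - 1 into 1 - q^(`below d l`): this unit is r p^l for l > 0 and -1 for l = 0.
      rest : ℕ → K.Carrier
      rest zero    = K.- (qK KB.^ n)
      rest (suc l) = r K.* p KB.^ suc l K.* (qK KB.^ n K.* (K.1# K.- p KB.^ n K.* p⁻ KB.^ suc l)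
        K.* (K.- (p⁻ KB.^ n)) K.* (K.1# K.- r K.* K.1# K.* p KB.^ n) K.* KB.prod l (λ i → QB.φ (suc i) n))

      integral-rest : ∀ l → Integral (rest l)
      integral-rest zero    = integral-neg (integral-^ n integral-q)
      integral-rest (suc l) = multiple-*ʳ (multiple-*ʳ integral-r (integral-^ (suc l) integral-p))
        (multiple-*ʳ (multiple-*ʳ (multiple-*ʳ (multiple-*ʳ (integral-^ n integral-q)
          (integral-- integral-1 (multiple-*ʳ (integral-^ n integral-p) (integral-^ (suc l) integral-p⁻))))
          (integral-neg (integral-^ n integral-p⁻)))
          (integral-- integral-1 (multiple-*ʳ (multiple-*ʳ integral-r integral-1) (integral-^ n integral-p))))
          (integral-prod l λ i _ → integral-basis (suc i) n))

      -- By telescoping, only the boundary term at k = n is left. One of the two factors 1 - p^n in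
      -- z² is explicit in `boundary`. The other is its factor 1 - p^(n-l) if l = 0, and otherwise
      -- comes from the factor `φ 0 n` of `basis l n`.
      L-closed : ∀ l → ι (1# - q ^ below d l) K.* L l K.≈ z K.* z K.* rest l
      L-closed zero = begin
        ι (1# - q * 1#) K.* L 0
          ≈⟨ K.*-congʳ (K.trans (ι-1- _) (K.+-congˡ (K.-‿cong (ι-cong (*-identityʳ q))))) ⟩
        (K.1# K.- qK) K.* L 0
          ≈⟨ solve 2 (λ q x → (:1 :- q) :* x := :- ((q :* :1 :- :1) :* x)) K.refl qK (L 0) ⟩
        K.- ((qK K.* K.1# K.- K.1#) K.* L 0)
          ≈⟨ K.-‿cong (L≈ 0) ⟩
        K.- ((K.1# K.- p KB.^ n K.* K.1#) K.* (K.1# K.- p KB.^ n) K.* (qK KB.^ n K.* (ρ K.* ρ)) K.* K.1#)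
          ≈⟨ solve 3 (λ P Q ρ → :- ((:1 :- P :* :1) :* (:1 :- P) :* (Q :* (ρ :* ρ)) :* :1)
               := (:1 :- P) :* ρ :* ((:1 :- P) :* ρ) :* :- Q) K.refl (p KB.^ n) (qK KB.^ n) ρ ⟩
        z K.* z K.* rest 0 ∎
      L-closed (suc l) = begin
        ι (1# - q ^ below d (suc l)) K.* L (suc l)
          ≈⟨ K.*-congʳ (below-factor l) ⟨
        (K.1# K.- r K.* P′) K.* L (suc l)
          ≈⟨ K.*-congʳ (K.trans (K.+-congʳ (K.sym one)) (solve 4 (λ q r P Z → q :* r :* (P :* Z) :- r :* P := r :* P :* (q :* Z :- :1)) K.refl qK r P′ Z′)) ⟩
        r K.* P′ K.* (qK K.* Z′ K.- K.1#) K.* L (suc l)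
          ≈⟨ K.trans (K.*-assoc _ _ _) (K.*-congˡ (L≈ (suc l))) ⟩
        r K.* P′ K.* ((K.1# K.- P K.* Z′) K.* (K.1# K.- P) K.* (qK KB.^ n K.* (ρ K.* ρ)) K.* QB.basis (suc l) n)
          ≈⟨ K.*-congˡ (K.*-congˡ (K.trans (KB.prod-sucˡ l _) (K.*-congʳ (K.*-congʳ first)))) ⟩
        r K.* P′ K.* ((K.1# K.- P K.* Z′) K.* (K.1# K.- P) K.* (qK KB.^ n K.* (ρ K.* ρ))
          K.* (K.- Z K.* (K.1# K.- P) K.* (K.1# K.- r K.* K.1# K.* P) K.* T))
          ≈⟨ solve 8 (λ A P Y Q ρ Z W T → A :* (Y :* (:1 :- P) :* (Q :* (ρ :* ρ)) :* (:- Z :* (:1 :- P) :* W :* T))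
               := (:1 :- P) :* ρ :* ((:1 :- P) :* ρ) :* (A :* (Q :* Y :* :- Z :* W :* T)))
               K.refl (r K.* P′) P (K.1# K.- P K.* Z′) (qK KB.^ n) ρ Z (K.1# K.- r K.* K.1# K.* P) T ⟩
        z K.* z K.* rest (suc l) ∎
        where
        P = p KB.^ n
        Z = p⁻ KB.^ n
        P′ = p KB.^ suc l
        Z′ = p⁻ KB.^ suc l
        T = KB.prod l (λ i → QB.φ (suc i) n)
        one : qK K.* r K.* (P′ K.* Z′) K.≈ K.1#
        one = K.trans (K.*-cong qr≈1 (QB.p^p⁻^ (suc l))) (K.*-identityʳ K.1#)
        first : K.1# K.- K.1# K.* Z K.≈ K.- Z K.* (K.1# K.- P)
        first = begin
          K.1# K.- K.1# K.* Z     ≈⟨ K.+-congʳ (QB.p^p⁻^ n) ⟨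
          P K.* Z K.- K.1# K.* Z  ≈⟨ solve 2 (λ P Z → P :* Z :- :1 :* Z := :- Z :* (:1 :- P)) K.refl P Z ⟩
          K.- Z K.* (K.1# K.- P)  ∎

    multiple-moment₀ : ∀ δ l → l ≤ n ℕ.+ n → (∀ m → support m ≡ 0 → δ m ≡ 0) →
      (∀ m → support m ≡ 1 → divides? m (below d l) ℕ.+ δ m ≤ 1) → Multiple ([n] * Π δ) (QB.moment n c 0 l)
    multiple-moment₀ δ l l≤ δ-support counts = multiple-cong (*-comm (Π δ) [n]) (begin
        z K.* κ j K.* (z K.* rest l)
          ≈⟨ solve 3 (λ z k s → z :* k :* (z :* s) := k :* (z :* z :* s)) K.refl z (κ j) (rest l) ⟩
        κ j K.* (z K.* z K.* rest l)
          ≈⟨ K.*-congˡ (L-closed l) ⟨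
        κ j K.* (ι (1# - q ^ j) K.* L l)
          ≈⟨ solve 3 (λ k a x → k :* (a :* x) := a :* k :* x) K.refl (κ j) _ (L l) ⟩
        ι (1# - q ^ j) K.* κ j K.* L l
          ≈⟨ K.trans (K.*-congʳ (κ-inverse j (0<below l))) (K.*-identityˡ _) ⟩
        L l ∎)
      (multiple-* (multiple-zκ δ j (0<below l) (below≤B l l≤) δ-support counts)
        (multiple-*ʳ multiple-z (integral-rest l)))
      where
      j = below d l

    -- The bound N is a parameter because divisibility by [n] is available for all l up to 2n, the
    -- extra factor Φ_n only for small l.
    multiple-moment : ∀ P N → (∀ l → l ≤ N → Multiple P (QB.moment n c 0 l)) →
      ∀ i j → i ℕ.+ j ≤ N → Multiple P (QB.moment n c i j)
    multiple-moment P N h zero    j i+j≤ = h j i+j≤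
    multiple-moment P N h (suc i) j i+j≤ = resp (K.sym (QB.moment-suc n c i j)) (multiple-+
      (multiple-*ˡ (integral-α) (multiple-moment P N h i (suc j) (ℕₚ.≤-trans (ℕₚ.≤-reflexive (ℕₚ.+-suc i j)) i+j≤)))
      (multiple-*ˡ (integral-- (integral-1+ i) (multiple-*ʳ integral-α (integral-1+ j)))
        (multiple-moment P N h i j (ℕₚ.≤-trans (ℕₚ.n≤1+n _) i+j≤))))
      where
      integral-α : Integral (p⁻ KB.^ j K.* p KB.^ i)
      integral-α = multiple-*ʳ (integral-^ j integral-p⁻) (integral-^ i integral-p)
      integral-1+ : ∀ i → Integral (K.1# K.+ r K.* (p KB.^ i K.* p KB.^ i))
      integral-1+ i = multiple-+ integral-1 (multiple-*ʳ integral-r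
        (multiple-*ʳ (integral-^ i integral-p) (integral-^ i integral-p)))

    multiple-above/multiple : ∀ δ j → j ≤ n → (∀ m → support m ≡ 0 → δ m ≡ 0) →
      (∀ m → support m ≡ 1 → count m (multiple d) j ℕ.+ δ m ≤ count m (above d) j) →
      Multiple (Π δ) (KB.prod j (λ x → (K.1# K.- qK K.* p K.* p KB.^ x) K.* e x))
    multiple-above/multiple δ j j≤n δ-support counts = resp
      (K.sym (K.trans (KB.prod-* j _ _) (K.*-congʳ (K.trans (KB.prod-cong j above-factor) (K.sym (ι-prod j _))))))
      (multiple-ratio δ (λ _ _ → ℕ.z<s)
        (λ x x<j → suc-d*-≤ (ℕₚ.≤-trans (ℕₚ.≤-trans x<j j≤n) n≤n+n))
        (λ x _ → 0<multiple x)
        (λ x x<j → d*-≤ (ℕₚ.≤-trans (ℕₚ.≤-trans x<j j≤n) n≤n+n))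
        δ-support counts (e-prod-inverse j))

    -- The properties of a and b on which the proof rests: no positive power of y is 1, so that 1 -
    -- y^n is a nonzero constant, and none of the denominators in y vanishes.
    record Indeterminate (y : Carrier) : Set where
      field
        const-y   : Const y
        const-1-y : ∀ k → 0 < k → Const (1# - y ^ k)
        const-y-1 : ∀ k → 0 < k → Const (y ^ k - 1#)
        y≉0       : ¬ y ≈ 0#
        1-yq^≉0   : ∀ j → 0 < j → ¬ 1# - y * q ^ j ≈ 0#
        y-q^≉0    : ∀ j → 0 < j → ¬ y - q ^ j ≈ 0#

    module Parameter (y : Carrier) (indeterminate : Indeterminate y) where
      open Indeterminate indeterminate

      y⁻ : K.Carrier
      y⁻ = recip y≉0

      yy⁻≈1 : ι y K.* y⁻ K.≈ K.1#
      yy⁻≈1 = recip-inverse y≉0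

      β β⁻ : ℕ → K.Carrier
      β x  = recip (1-yq^≉0 (multiple d x) (0<multiple x))
      -- The inverse of 1 - q^j / y is written as y / (y - q^j), whose denominator is a polynomial.
      β⁻ x = ι y K.* recip (y-q^≉0 (multiple d x) (0<multiple x))

      β-inverse : ∀ x → (K.1# K.- p K.* ι y K.* p KB.^ x) K.* β x K.≈ K.1#
      β-inverse x = K.trans (K.*-congʳ (K.trans (K.+-congˡ (K.-‿cong (begin
        p K.* ι y K.* p KB.^ x        ≈⟨ solve 3 (λ p y x → p :* y :* x := y :* (p :* x)) K.refl p (ι y) _ ⟩
        ι y K.* p KB.^ suc x          ≈⟨ K.*-congˡ (p^ (suc x)) ⟩
        ι y K.* ι (q ^ multiple d x)  ≈⟨ ι-* y _ ⟨
        ι (y * q ^ multiple d x)      ∎))) (K.sym (ι-1- _)))) (recip-inverse _)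

      β⁻-inverse : ∀ x → (K.1# K.- p K.* y⁻ K.* p KB.^ x) K.* β⁻ x K.≈ K.1#
      β⁻-inverse x = begin
        (K.1# K.- p K.* y⁻ K.* p KB.^ x) K.* (ι y K.* s)
          ≈⟨ solve 5 (λ p y⁻ P y s → (:1 :- p :* y⁻ :* P) :* (y :* s) := (y :- y :* y⁻ :* (p :* P)) :* s) K.refl p y⁻ (p KB.^ x) (ι y) s ⟩
        (ι y K.- ι y K.* y⁻ K.* p KB.^ suc x) K.* s
          ≈⟨ K.*-congʳ (K.+-congˡ (K.-‿cong (K.trans (K.*-cong yy⁻≈1 (p^ (suc x))) (K.*-identityˡ _)))) ⟩
        (ι y K.- ι (q ^ multiple d x)) K.* s
          ≈⟨ K.*-congʳ (K.trans (ι-+ y _) (K.+-congˡ (ι-neg _))) ⟨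
        ι (y - q ^ multiple d x) K.* s
          ≈⟨ recip-inverse _ ⟩
        K.1# ∎
        where
        s = recip (y-q^≉0 (multiple d x) (0<multiple x))

      module QA = QT.Saalschütz (ι y) y⁻ yy⁻≈1 β β⁻ β-inverse β⁻-inverse

      integral-β : ∀ x → Integral (β x)
      integral-β x = integral-inverse (coprime-1-yq^ y (multiple d x) (const-1-y n 0<n)) (recip-inverse _)

      integral-β⁻ : ∀ x → Integral (β⁻ x)
      integral-β⁻ x = multiple-*ʳ (integral-ι y) (integral-inverse (coprime-y-q^ y (multiple d x) (const-y-1 n 0<n)) (recip-inverse _))

      -- The factors of w_j that depend on y lie in O, so w_j inherits the divisibility of (qp; p)_j
      -- / (p; p)_j.
      multiple-coefficient : ∀ δ j → j ≤ n → (∀ m → support m ≡ 0 → δ m ≡ 0) →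
        (∀ m → support m ≡ 1 → count m (multiple d) j ℕ.+ δ m ≤ count m (above d) j) →
        Multiple (Π δ) (QA.coefficient j)
      multiple-coefficient δ j j≤n δ-support counts = resp
        (K.trans (K.sym (KB.prod-* j _ _)) (KB.prod-cong j λ x →
          solve 5 (λ a e p b b⁻ → (a :* e) :* (p :* (b :* b⁻)) := a :* p :* (e :* b :* b⁻)) K.refl _ (e x) p (β x) (β⁻ x)))
        (multiple-*ʳ (multiple-above/multiple δ j j≤n δ-support counts)
          (integral-prod j λ x _ → multiple-*ʳ integral-p (multiple-*ʳ (integral-β x) (integral-β⁻ x))))

      coefficient-integral : ∀ j → j ≤ n → Integral (QA.coefficient j)
      coefficient-integral j j≤n = multiple-cong Π-zero K.refl (multiple-coefficient (λ _ → 0) j j≤n (λ _ _ → ≡.refl)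
        λ m s≡1 → ≡.subst (_≤ count m (above d) j) (≡.sym (ℕₚ.+-identityʳ _))
          (count-multiple≤count-above d m (support⇒1<m m s≡1) 0<d (0<support⇒ s≡1) j))

    -- Assembly of the sum and its divisibility by [n] and by [n] Φ_n.

    module Sum (a b : Carrier) (indeterminate-a : Indeterminate a) (indeterminate-b : Indeterminate b) where

      module PA = Parameter a indeterminate-a
      module PB = Parameter b indeterminate-b

      -- The factor `κ 1` is 1 / (1 - q); it turns 1 - q^(2dk-1) into [2dk-1].
      total : K.Carrier
      total = KB.sum n (λ k → κ 1 K.* (c k K.* (PA.QA.term k K.* PB.QA.term k)))

      private
        total≈ : total K.≈ κ 1 K.* KB.sum n (λ i → KB.sum n (λ j →
          PA.QA.coefficient i K.* PB.QA.coefficient j K.* QB.moment n c i j))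
        total≈ = K.trans (K.sym (KB.*-sum n (κ 1) _)) (K.*-congˡ (K.trans
          (KB.sum-cong< n λ k k<n → K.*-congˡ (K.*-cong (K.sym (PA.QA.saalschütz n k k<n)) (K.sym (PB.QA.saalschütz n k k<n))))
          (QB.double-expansion n c PA.QA.coefficient PB.QA.coefficient)))

        integral-κ1 : Integral (κ 1)
        integral-κ1 = integral-inverse (coprime-cong (+-congˡ (-‿cong (sym (*-identityʳ q)))) refl coprime-1-q) (κ-inverse 1 ℕ.z<s)

        by-terms : ∀ {P} → (∀ i j → i < n → j < n →
          Multiple P (PA.QA.coefficient i K.* PB.QA.coefficient j K.* QB.moment n c i j)) → Multiple P total
        by-terms h = resp (K.sym total≈) (multiple-*ˡ integral-κ1
          (multiple-sum n λ i i<n → multiple-sum n λ j j<n → h i j i<n j<n))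

        moment-[n] : ∀ i j → i < n → j < n → Multiple [n] (QB.moment n c i j)
        moment-[n] i j i<n j<n = multiple-moment [n] (n ℕ.+ n)
          (λ l l≤ → multiple-factor (multiple-moment₀ (λ _ → 0) l l≤ (λ _ _ → ≡.refl)
            λ m _ → ≡.subst (_≤ 1) (≡.sym (ℕₚ.+-identityʳ _)) (divides?≤1 m _)))
          i j (ℕₚ.+-mono-≤ (ℕₚ.<⇒≤ i<n) (ℕₚ.<⇒≤ j<n))

      total-[n] : Multiple [n] total
      total-[n] = by-terms λ i j i<n j<n → multiple-*ˡ
        (multiple-*ʳ (PA.coefficient-integral i (ℕₚ.<⇒≤ i<n)) (PB.coefficient-integral j (ℕₚ.<⇒≤ j<n)))
        (moment-[n] i j i<n j<n)

      module _ (t : ℕ) (n≡ : n ≡ suc (d ℕ.* t)) where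

        private
          0<t : 0 < t
          0<t = ℕₚ.n≢0⇒n>0 λ t≡0 → ℕₚ.<⇒≢ 1<n (≡.sym (≡.trans n≡
            (≡.cong suc (≡.trans (≡.cong (d ℕ.*_) t≡0) (ℕₚ.*-zeroʳ d)))))

          δ : ℕ → ℕ
          δ = single n

          Πδ≈φ : Π δ ≈ φ n
          Πδ≈φ = go n ≡.refl
            where
            go : ∀ k → k ≡ n → Π (single k) ≈ φ k
            go zero    0≡n    = contradiction 0≡n (ℕₚ.<⇒≢ 0<n)
            go (suc k) ≡.refl = Π-single n≤B

          δ-support : ∀ m → support m ≡ 0 → δ m ≡ 0
          δ-support m s≡0 with m ℕₚ.≟ n
          ... | yes ≡.refl = contradiction (≡.trans (≡.sym s≡0) (support-one n 1<n ∣-refl)) λ ()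
          ... | no  _      = ≡.refl

          at-n : ∀ {x : ℕ → ℕ} {y : ℕ → ℕ} → x n ℕ.+ 1 ≤ y n → (∀ m → support m ≡ 1 → x m ≤ y m) →
            ∀ m → support m ≡ 1 → x m ℕ.+ δ m ≤ y m
          at-n {x} {y} x+1≤y x≤y m s≡1 with m ℕₚ.≟ n
          ... | yes ≡.refl = x+1≤y
          ... | no  _      = ≡.subst (_≤ y m) (≡.sym (ℕₚ.+-identityʳ (x m))) (x≤y m s≡1)

          -- The factor of (qp; p)_j with x = t - 1 is 1 - q^(dt+1) = 1 - q^n, whereas (p; p)_j
          -- contains no φ n, because j < n and n is prime to d.
          coefficient-counts : ∀ j → t ≤ j → j < n → ∀ m → support m ≡ 1 →
            count m (multiple d) j ℕ.+ δ m ≤ count m (above d) j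
          coefficient-counts j t≤j j<n = at-n {λ m → count m (multiple d) j} {λ m → count m (above d) j}
            (≡.subst (λ k → k ℕ.+ 1 ≤ count n (above d) j) (≡.sym (count-multiple-small d n 1<n 0<d n⊥d j j<n))
              (count-positive j (pred t) (ℕₚ.≤-trans (ℕₚ.≤-reflexive (ℕₚ.suc-pred t {{ℕ.>-nonZero 0<t}})) t≤j)
                (≡.subst (n ∣_) (≡.trans n≡ (≡.cong (λ k → suc (d ℕ.* k)) (≡.sym (ℕₚ.suc-pred t {{ℕ.>-nonZero 0<t}})))) ∣-refl)))
            (λ m s≡1 → count-multiple≤count-above d m (support⇒1<m m s≡1) 0<d (0<support⇒ s≡1) j)

          -- For l > 0 one has 0 < dl - 1 < 2n, so the quotient could only be 1. But dl - 1 = n = dt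
          -- + 1 would make d a divisor of 2.
          n∤below : ∀ l → suc (suc l) ≤ t ℕ.+ t → ¬ n ∣ below d l
          n∤below zero    _   n∣1 = ℕₚ.<⇒≢ 1<n (≡.sym (ℕ∣.∣1⇒≡1 n∣1))
          n∤below (suc l) l≤ (divides zero          eq) = ℕₚ.<⇒≢ (0<below (suc l)) (≡.sym eq)
          n∤below (suc l) l≤ (divides (suc zero)    eq) = ℕₚ.<⇒≱ 3≤d (ℕ∣.∣⇒≤ d∣2)
            where
            d∣2 : d ∣ 2
            d∣2 = ℕ∣.∣m+n∣m⇒∣n (≡.subst (d ∣_) (≡.trans (≡.sym (suc-below l)) (≡.trans (≡.cong suc (≡.trans eq (≡.trans (ℕₚ.+-identityʳ n) n≡)))
              (≡.trans (≡.cong suc (ℕₚ.+-comm 1 _)) (≡.sym (ℕₚ.+-suc (d ℕ.* t) 1))))) (ℕ∣.m∣m*n (suc l))) (ℕ∣.m∣m*n t)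
          n∤below (suc l) l≤ (divides (suc (suc k)) eq) = ℕₚ.<⇒≱ below< 
              (ℕₚ.≤-trans (ℕₚ.+-monoʳ-≤ n (ℕₚ.m≤m+n n (k ℕ.* n))) (ℕₚ.≤-reflexive (≡.sym eq)))
            where
            below< : below d (suc l) < n ℕ.+ n
            below< = ℕₚ.≤-trans (ℕₚ.≤-reflexive (suc-below l)) (ℕₚ.≤-trans
              (ℕₚ.*-monoʳ-≤ d (ℕₚ.≤-trans (ℕₚ.≤-trans (ℕₚ.n≤1+n _) (ℕₚ.n≤1+n _)) l≤))
              (ℕₚ.≤-trans (ℕₚ.≤-reflexive (ℕₚ.*-distribˡ-+ d t t)) (ℕₚ.+-mono-≤ dt≤n dt≤n)))
              where
              dt≤n : d ℕ.* t ≤ n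
              dt≤n = ℕₚ.≤-trans (ℕₚ.n≤1+n _) (ℕₚ.≤-reflexive (≡.sym n≡))

          moment-Q : ∀ i j → i < t → j < t → Multiple ([n] * Π δ) (QB.moment n c i j)
          moment-Q i j i<t j<t = multiple-moment ([n] * Π δ) (i ℕ.+ j)
            (λ l l≤ → multiple-moment₀ δ l (ℕₚ.≤-trans (ℕₚ.≤-trans (ℕₚ.≤-trans (ℕₚ.n≤1+n l) (ℕₚ.n≤1+n _)) (bound l l≤)) (ℕₚ.+-mono-≤ t≤n t≤n)) δ-support
              (at-n {λ m → divides? m (below d l)} {λ _ → 1}
                (ℕₚ.≤-reflexive (≡.cong (ℕ._+ 1) (divides?-no (n∤below l (bound l l≤)))))
                λ m _ → divides?≤1 m _))
            i j ℕₚ.≤-refl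
            where
            bound : ∀ l → l ≤ i ℕ.+ j → suc (suc l) ≤ t ℕ.+ t
            bound l l≤ = ℕₚ.≤-trans (s≤s (s≤s l≤)) (ℕₚ.≤-trans (ℕₚ.≤-reflexive (≡.cong suc (≡.sym (ℕₚ.+-suc i j)))) (ℕₚ.+-mono-≤ i<t j<t))
            t≤n : t ≤ n
            t≤n = ℕₚ.≤-trans (ℕₚ.m≤n*m t d {{ℕ.>-nonZero 0<d}}) (ℕₚ.≤-trans (ℕₚ.n≤1+n _) (ℕₚ.≤-reflexive (≡.sym n≡)))

          term-Q : ∀ i j → i < n → j < n →
            Multiple Q (PA.QA.coefficient i K.* PB.QA.coefficient j K.* QB.moment n c i j)
          term-Q i j i<n j<n with i ℕₚ.<? t | j ℕₚ.<? t
          ... | yes i<t | yes j<t = multiple-cong (*-congˡ Πδ≈φ) K.refl (multiple-*ˡ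
            (multiple-*ʳ (PA.coefficient-integral i (ℕₚ.<⇒≤ i<n)) (PB.coefficient-integral j (ℕₚ.<⇒≤ j<n)))
            (moment-Q i j i<t j<t))
          ... | no i≮t | _ = multiple-cong (trans (*-comm _ _) (*-congˡ Πδ≈φ)) K.refl (multiple-*
            (multiple-*ʳ (PA.multiple-coefficient δ i (ℕₚ.<⇒≤ i<n) δ-support (coefficient-counts i (ℕₚ.≮⇒≥ i≮t) i<n))
              (PB.coefficient-integral j (ℕₚ.<⇒≤ j<n)))
            (moment-[n] i j i<n j<n))
          ... | yes _ | no j≮t = multiple-cong (trans (*-comm _ _) (*-congˡ Πδ≈φ)) K.refl (multiple-*
            (multiple-*ˡ (PA.coefficient-integral i (ℕₚ.<⇒≤ i<n))
              (PB.multiple-coefficient δ j (ℕₚ.<⇒≤ j<n) δ-support (coefficient-counts j (ℕₚ.≮⇒≥ j≮t) j<n)))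
            (moment-[n] i j i<n j<n))

        total-Q : Multiple Q total
        total-Q = by-terms term-Q

-- Coprimality of the cyclotomic factors from the factorisation of q^j - 1.

module CyclotomicFactors (𝓓 : ConstDomain) where

  open ConstDomain 𝓓 using (noZeroDivisors; 1≉0; Const; const-1; const-*) renaming (ring to R)
  open import Data.Integer.Base using (+_)
  open import Data.Sum using (inj₁; inj₂)
  open Counting
  open CommutativeRing R
  open import Algebra.Properties.Semiring.Mult semiring using () renaming (_×_ to _·_)
  open Solver R
  open BigOp R
  open Localisation 𝓓
  open FractionRing R noZeroDivisors 1≉0 using (*-cancelʳ)
  open import Relation.Binary.Reasoning.Setoid setoid

  module _
    (const-ℕ : ∀ k → 0 < k → Const (k · 1#))
    (q : Carrier) (q^-1≉0 : ∀ k → 0 < k → ¬ q ^ k - 1# ≈ 0#)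
    (Φ : ℕ → Carrier) where

    factor : ℕ → ℕ → Carrier
    factor j i = Φ (suc i) ^ divides? (suc i) j

    -- The sequence Φ is arbitrary here. For the computed Φ this is the induction hypothesis: from
    -- its validity for all j ≤ N the following lemmas derive what the division defining Φ at N + 1
    -- needs.
    Factorises : ℕ → Set
    Factorises j = q ^ j - 1# ≈ prod j (factor j)

    private
      factor-yes : ∀ {j i} → suc i ∣ j → factor j i ≈ Φ (suc i)
      factor-yes {j} {i} d = trans (reflexive (≡.cong (Φ (suc i) ^_) (divides?-yes d))) (*-identityʳ _)

      factor-no : ∀ {j i} → ¬ suc i ∣ j → factor j i ≈ 1#
      factor-no {j} {i} d = reflexive (≡.cong (Φ (suc i) ^_) (divides?-no d))

    prod-factor : ∀ j B → 0 < j → j ≤ B → prod B (factor j) ≈ prod j (factor j)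
    prod-factor j zero    0<j j≤B = contradiction j≤B (ℕₚ.<⇒≱ 0<j)
    prod-factor j (suc B) 0<j j≤B with ℕₚ.m≤n⇒m<n∨m≡n j≤B
    ... | inj₂ ≡.refl    = refl
    ... | inj₁ (s≤s j≤B) = trans (*-cong (prod-factor j B 0<j j≤B)
            (factor-no (ℕ∣.>⇒∤ {{ℕ.>-nonZero 0<j}} (s≤s j≤B)))) (*-identityʳ _)

    -- Modulo q^m − 1 the quotient (q^(km) − 1)/(q^m − 1) is the integer k, so Φ i and Φ j are coprime over ℚ.
    quotient : ∀ m k → ∃₂ λ A W → (q ^ (k ℕ.* m) - 1# ≈ (q ^ m - 1#) * A) × (A ≈ k · 1# + W * (q ^ m - 1#))
    quotient m zero = 0# , 0# , trans (-‿inverseʳ 1#) (sym (zeroʳ _)) , sym (trans (+-identityˡ _) (zeroˡ _))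
    quotient m (suc k) with quotient m k
    ... | A , W , e , f = 1# + q ^ m * A , A + W , (begin
      q ^ (m ℕ.+ k ℕ.* m) - 1#
        ≈⟨ +-congʳ (^-homo-* q m (k ℕ.* m)) ⟩
      q ^ m * q ^ (k ℕ.* m) - 1#
        ≈⟨ solve 2 (λ x y → x :* y :- :1 := (x :- :1) :+ x :* (y :- :1)) refl (q ^ m) (q ^ (k ℕ.* m)) ⟩
      (q ^ m - 1#) + q ^ m * (q ^ (k ℕ.* m) - 1#)
        ≈⟨ +-congˡ (*-congˡ e) ⟩
      (q ^ m - 1#) + q ^ m * ((q ^ m - 1#) * A)
        ≈⟨ solve 2 (λ x A → (x :- :1) :+ x :* ((x :- :1) :* A) := (x :- :1) :* (:1 :+ x :* A)) refl (q ^ m) A ⟩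
      (q ^ m - 1#) * (1# + q ^ m * A) ∎) , (begin
      1# + q ^ m * A
        ≈⟨ solve 2 (λ x A → :1 :+ x :* A := :1 :+ (A :+ A :* (x :- :1))) refl (q ^ m) A ⟩
      1# + (A + A * (q ^ m - 1#))
        ≈⟨ +-congˡ (+-congʳ f) ⟩
      1# + (k · 1# + W * (q ^ m - 1#) + A * (q ^ m - 1#))
        ≈⟨ solve 4 (λ x A W k → :1 :+ (k :+ W :* x :+ A :* x) := :1 :+ k :+ (A :+ W) :* x) refl (q ^ m - 1#) A W (k · 1#) ⟩
      1# + k · 1# + (A + W) * (q ^ m - 1#) ∎)

    quotient-∣ : ∀ {m j} → m ∣ j → ∃ λ A → q ^ j - 1# ≈ (q ^ m - 1#) * A
    quotient-∣ {m} (divides k ≡.refl) with quotient m k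
    ... | A , _ , e , _ = A , e

    private
      -- As g + yj = xi, one has q^g - 1 = (q^(xi) - 1) - q^g (q^(yj) - 1), and the two differences
      -- are multiples of q^i - 1 and q^j - 1 respectively.
      euclid : ∀ g x y i j → g ℕ.+ y ℕ.* j ≡ x ℕ.* i →
        ∃₂ λ X Y → q ^ g - 1# ≈ X * (q ^ i - 1#) + Y * (q ^ j - 1#)
      euclid g x y i j eq with quotient i x | quotient j y
      ... | A , _ , e , _ | A′ , _ , e′ , _ = A , - (q ^ g * A′) , (begin
        q ^ g - 1#
          ≈⟨ solve 2 (λ G Y → G :- :1 := G :* Y :- :1 :- G :* (Y :- :1)) refl (q ^ g) (q ^ (y ℕ.* j)) ⟩
        q ^ g * q ^ (y ℕ.* j) - 1# - q ^ g * (q ^ (y ℕ.* j) - 1#)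
          ≈⟨ +-congʳ (+-congʳ (trans (sym (^-homo-* q g (y ℕ.* j))) (reflexive (≡.cong (q ^_) eq)))) ⟩
        q ^ (x ℕ.* i) - 1# - q ^ g * (q ^ (y ℕ.* j) - 1#)
          ≈⟨ +-cong e (-‿cong (*-congˡ e′)) ⟩
        (q ^ i - 1#) * A - q ^ g * ((q ^ j - 1#) * A′)
          ≈⟨ solve 5 (λ I A G J A′ → I :* A :- G :* (J :* A′) := A :* I :+ :- (G :* A′) :* J) refl _ A (q ^ g) _ A′ ⟩
        A * (q ^ i - 1#) + - (q ^ g * A′) * (q ^ j - 1#) ∎)

    gcd-combination : ∀ i j → ∃₂ λ X Y → q ^ gcd i j - 1# ≈ X * (q ^ i - 1#) + Y * (q ^ j - 1#)
    gcd-combination i j = combine (Bézout.identity (gcd-GCD i j))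
      where
      combine : ∀ {g} → Bézout.Identity g i j → ∃₂ λ X Y → q ^ g - 1# ≈ X * (q ^ i - 1#) + Y * (q ^ j - 1#)
      combine {g} (Bézout.+- x y eq) = euclid g x y i j eq
      combine {g} (Bézout.-+ x y eq) = let (X , Y , e) = euclid g y x j i eq in
        Y , X , trans e (+-comm _ _)

    Φ-divides : ∀ {i} → Factorises (suc i) → ∃ λ E → q ^ suc i - 1# ≈ Φ (suc i) * E
    Φ-divides {i} h = prod i (factor (suc i)) , trans h (trans (*-comm _ _) (*-congʳ (factor-yes ∣-refl)))

    private
      -- Let I < J be the two indices, g their gcd and A = (q^J - 1) / (q^g - 1). The larger factor
      -- Φ_J divides A, because it does not occur in q^g - 1, and Φ_I divides q^I - 1. Now A is the
      -- integer k = J / g modulo q^g - 1, which is itself a combination of q^I - 1 and a multiple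
      -- of A; hence A and q^I - 1 combine to k.
      coprime-< : ∀ {i j} → i < j → Factorises (suc i) → Factorises (suc j) →
        (∀ g → 0 < g → g ≤ suc i → Factorises g) → Coprime (Φ (suc j)) (Φ (suc i))
      coprime-< {i} {j} i<j hi hj hg with gcd[m,n]∣n (suc i) (suc j)
      ... | divides k j≡k*g with quotient g k | gcd-combination (suc i) (suc j) | Φ-divides hi
        where g = gcd (suc i) (suc j)
      ...   | A , W , e , f | X , Y , comb | Ei , ei =
        coprime-factorˡ (coprime-cong A≈ refl (coprime-factorʳ (coprime-cong refl ei
          (bézout (1# - W * Y * G) (- (W * X)) (k · 1#) (const-ℕ k 0<k) (begin
            (1# - W * Y * G) * A + - (W * X) * I
              ≈⟨ solve 6 (λ A W X Y G I → (:1 :- W :* Y :* G) :* A :+ :- (W :* X) :* I := A :- W :* (X :* I :+ Y :* (G :* A))) refl A W X Y G I ⟩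
            A - W * (X * I + Y * (G * A))
              ≈⟨ +-congˡ (-‿cong (*-congˡ (trans (+-congˡ (*-congˡ (trans (sym e) (+-congʳ (reflexive (≡.cong (q ^_) (≡.sym j≡k*g))))))) (sym comb)))) ⟩
            A - W * G
              ≈⟨ +-congʳ f ⟩
            k · 1# + W * G - W * G
              ≈⟨ solve 2 (λ k x → k :+ x :- x := k) refl (k · 1#) (W * G) ⟩
            k · 1# ∎)))))
        where
        g = gcd (suc i) (suc j)
        G = q ^ g - 1#
        I = q ^ suc i - 1#
        0<g : 0 < g
        0<g = ℕₚ.n≢0⇒n>0 λ g≡0 → contradiction (≡.trans j≡k*g (≡.trans (≡.cong (k ℕ.*_) g≡0) (ℕₚ.*-zeroʳ k))) λ ()
        0<k : 0 < k
        0<k = ℕₚ.n≢0⇒n>0 λ k≡0 → contradiction (≡.trans j≡k*g (≡.cong (ℕ._* g) k≡0)) λ ()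
        g≤i : g ≤ suc i
        g≤i = ℕ∣.∣⇒≤ (gcd[m,n]∣m (suc i) (suc j))
        rest : ℕ → ℕ
        rest m = divides? m (suc j) ℕ.∸ divides? m g
        rest-+ : ∀ m → divides? m (suc j) ≡ divides? m g ℕ.+ rest m
        rest-+ m = ≡.sym (ℕₚ.m+[n∸m]≡n (divides?-mono m))
          where
          divides?-mono : ∀ m → divides? m g ≤ divides? m (suc j)
          divides?-mono m with m ∣? g
          ... | yes m∣g = ℕₚ.≤-reflexive (≡.sym (divides?-yes (∣-trans m∣g (gcd[m,n]∣n (suc i) (suc j)))))
          ... | no _    = z≤n
        E : Carrier
        E = prod j (λ l → Φ (suc l) ^ rest (suc l))
        A≈ : A ≈ Φ (suc j) * E
        A≈ = *-cancelʳ G (q^-1≉0 g 0<g) (begin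
          A * G
            ≈⟨ *-comm A G ⟩
          G * A
            ≈⟨ trans (+-congʳ (reflexive (≡.cong (q ^_) j≡k*g))) e ⟨
          q ^ suc j - 1#
            ≈⟨ hj ⟩
          prod j (factor (suc j)) * factor (suc j) j
            ≈⟨ *-cong (prod-cong j λ l → trans (reflexive (≡.cong (Φ (suc l) ^_) (rest-+ (suc l)))) (^-homo-* (Φ (suc l)) (divides? (suc l) g) (rest (suc l)))) (factor-yes ∣-refl) ⟩
          prod j (λ l → factor g l * Φ (suc l) ^ rest (suc l)) * Φ (suc j)
            ≈⟨ *-congʳ (prod-* j _ _) ⟩
          prod j (factor g) * E * Φ (suc j)
            ≈⟨ *-congʳ (*-congʳ (trans (prod-factor g j 0<g (ℕₚ.≤-trans g≤i i<j)) (sym (hg g 0<g g≤i)))) ⟩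
          G * E * Φ (suc j)
            ≈⟨ solve 3 (λ G E F → G :* E :* F := F :* E :* G) refl G E (Φ (suc j)) ⟩
          Φ (suc j) * E * G ∎)

    coprime-Φ : ∀ N → (∀ j → 0 < j → j ≤ N → Factorises j) →
      ∀ {i j} → i < N → j < N → ¬ i ≡ j → Coprime (Φ (suc i)) (Φ (suc j))
    coprime-Φ N h {i} {j} i<N j<N i≢j with ℕₚ.<-cmp i j
    ... | tri< i<j _ _ = coprime-sym (coprime-< i<j (h _ ℕ.z<s i<N) (h _ ℕ.z<s j<N) λ g 0<g g≤ → h g 0<g (ℕₚ.≤-trans g≤ i<N))
    ... | tri≈ _ i≡j _ = contradiction i≡j i≢j
    ... | tri> _ _ j<i = coprime-< j<i (h _ ℕ.z<s j<N) (h _ ℕ.z<s i<N) λ g 0<g g≤ → h g 0<g (ℕₚ.≤-trans g≤ j<N)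

    -- The Bézout identity between the product so far and the next factor merges their two quotients
    -- into one. Each merging costs the constant of that identity, whence c.
    product-divides : ∀ n f x → (∀ i → i < n → ∃ λ y → x ≈ f i * y) →
      (∀ {i j} → i < n → j < n → ¬ i ≡ j → Coprime (f i) (f j)) →
      ∃₂ λ c y → Const c × (c * x ≈ prod n f * y)
    product-divides zero    f x divs cop = 1# , x , const-1 , refl
    product-divides (suc n) f x divs cop
      with product-divides n f x (λ i i<n → divs i (ℕₚ.m<n⇒m<1+n i<n)) (λ i<n j<n → cop (ℕₚ.m<n⇒m<1+n i<n) (ℕₚ.m<n⇒m<1+n j<n))
         | divs n ℕₚ.≤-refl
         | coprime-prod n {f} {f n} (λ i i<n → cop (ℕₚ.m<n⇒m<1+n i<n) ℕₚ.≤-refl (ℕₚ.<⇒≢ i<n))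
    ... | c , y , kc , e | y′ , e′ | bézout X Y c′ kc′ e″ = c * c′ , c * X * y′ + Y * y , const-* kc kc′ , (begin
      c * c′ * x
        ≈⟨ *-congʳ (*-congˡ (sym e″)) ⟩
      c * (X * P + Y * F) * x
        ≈⟨ solve 6 (λ c X P Y F x → c :* (X :* P :+ Y :* F) :* x := c :* X :* P :* x :+ Y :* F :* (c :* x)) refl c X P Y F x ⟩
      c * X * P * x + Y * F * (c * x)
        ≈⟨ +-cong (*-congˡ e′) (*-congˡ e) ⟩
      c * X * P * (F * y′) + Y * F * (P * y)
        ≈⟨ solve 7 (λ c X P Y F y y′ → c :* X :* P :* (F :* y′) :+ Y :* F :* (P :* y) := P :* F :* (c :* X :* y′ :+ Y :* y)) refl c X P Y F y y′ ⟩
      P * F * (c * X * y′ + Y * y) ∎)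
      where
      P = prod n f
      F = f n

    proper-divisors : ∀ N → (∀ j → 0 < j → j ≤ N → Factorises j) →
      ∃₂ λ c y → Const c × (c * (q ^ suc N - 1#) ≈ prod N (factor (suc N)) * y)
    proper-divisors N h = product-divides N (factor (suc N)) (q ^ suc N - 1#) divs cop
      where
      divs : ∀ i → i < N → ∃ λ y → q ^ suc N - 1# ≈ factor (suc N) i * y
      divs i i<N with suc i ∣? suc N
      ... | no ¬d = _ , trans (sym (*-identityˡ _)) (*-congʳ (sym (factor-no ¬d)))
      ... | yes d with quotient-∣ d | Φ-divides (h (suc i) ℕ.z<s i<N)
      ...   | A , e | E , e′ = E * A , trans e (trans (*-congʳ e′) (trans (*-assoc _ _ _) (*-congʳ (sym (factor-yes d)))))
      cop : ∀ {i j} → i < N → j < N → ¬ i ≡ j → Coprime (factor (suc N) i) (factor (suc N) j)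
      cop {i} {j} i<N j<N i≢j = coprime-^ (divides? (suc i) (suc N))
        (coprime-sym (coprime-^ (divides? (suc j) (suc N)) (coprime-sym (coprime-Φ N h i<N j<N i≢j))))

-- The integral domain of dense polynomials.

module PolyRing where

  open import Defs
  open import Data.Integer.Base as ℤ using (+_)
  open import Data.Sum using (inj₁; inj₂)
  open ≡ using (_≡_)
  open import Algebra.Structures

  coef : ∀ k → Poly (suc k) → ℕ → Poly k
  coef k []       i       = zeroP k
  coef k (x ∷ xs) zero    = x
  coef k (x ∷ xs) (suc i) = coef k xs i

  -- Equality of coefficient sequences, blind to trailing zeros; it is equivalent to the zero test
  -- on the difference, and the ring laws can be checked coefficientwise.
  data Eq : ∀ k → Poly k → Poly k → Set where
    base : ∀ {x y} → x ≡ y → Eq zero x y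
    step : ∀ {k xs ys} → (∀ i → Eq k (coef k xs i) (coef k ys i)) → Eq (suc k) xs ys

  Eq⇒≡ : ∀ {x y} → Eq zero x y → x ≡ y
  Eq⇒≡ (base e) = e

  coef-cong : ∀ {k xs ys} → Eq (suc k) xs ys → ∀ i → Eq k (coef k xs i) (coef k ys i)
  coef-cong (step e) = e

  Eq-isEquivalence : ∀ k → IsEquivalence (Eq k)
  Eq-isEquivalence zero = record
    { refl  = base ≡.refl
    ; sym   = λ { (base e) → base (≡.sym e) }
    ; trans = λ { (base e) (base f) → base (≡.trans e f) } }
  Eq-isEquivalence (suc k) = record
    { refl  = step λ i → E.refl
    ; sym   = λ { (step e) → step λ i → E.sym (e i) }
    ; trans = λ { (step e) (step f) → step λ i → E.trans (e i) (f i) } }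
    where module E = IsEquivalence (Eq-isEquivalence k)

  IsPolyRing : ℕ → Set
  IsPolyRing k = IsCommutativeRing (Eq k) (addP k) (mulP k) (negP k) (zeroP k) (oneP k)

  mkPolyRing : ∀ k → IsPolyRing k → CommutativeRing 0ℓ 0ℓ
  mkPolyRing k isRing = record
    { Carrier = Poly k ; _≈_ = Eq k ; _+_ = addP k ; _*_ = mulP k ; -_ = negP k
    ; 0# = zeroP k ; 1# = oneP k ; isCommutativeRing = isRing }

  module ListRing (k : ℕ) (isRing : IsPolyRing k) where
    open CommutativeRing (mkPolyRing k isRing) public
    open RingProperties ring using (-0#≈0#)
    open CommutativeSemigroupProperties +-commutativeSemigroup using (x∙yz≈y∙xz)
    open IsEquivalence (Eq-isEquivalence (suc k)) public
      using () renaming (refl to reflL; sym to symL; trans to transL)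

    infixl 6 _⊕_
    infixl 7 _⊗_ _·_
    infix  4 _≈L_
    _≈L_ = Eq (suc k)
    _⊕_ = addP (suc k)
    _⊗_ = mulP (suc k)
    _·_ = scaleP k
    co = coef k

    infixr 5 _∷-cong_
    _∷-cong_ : ∀ {x y xs ys} → x ≈ y → xs ≈L ys → (x ∷ xs) ≈L (y ∷ ys)
    e ∷-cong step f = step λ { zero → e ; (suc i) → f i }

    coef-⊕ : ∀ xs ys i → co (xs ⊕ ys) i ≈ co xs i + co ys i
    coef-⊕ []       ys       i       = sym (+-identityˡ _)
    coef-⊕ (x ∷ xs) []       i       = sym (+-identityʳ _)
    coef-⊕ (x ∷ xs) (y ∷ ys) zero    = refl
    coef-⊕ (x ∷ xs) (y ∷ ys) (suc i) = coef-⊕ xs ys i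

    coef-neg : ∀ xs i → co (negP (suc k) xs) i ≈ - co xs i
    coef-neg []       i       = sym -0#≈0#
    coef-neg (x ∷ xs) zero    = refl
    coef-neg (x ∷ xs) (suc i) = coef-neg xs i

    coef-· : ∀ c xs i → co (c · xs) i ≈ c * co xs i
    coef-· c []       i       = sym (zeroʳ c)
    coef-· c (x ∷ xs) zero    = refl
    coef-· c (x ∷ xs) (suc i) = coef-· c xs i

    private
      by₂ : ∀ xs ys {zs} → (∀ i → co xs i + co ys i ≈ co zs i) → xs ⊕ ys ≈L zs
      by₂ xs ys e = step λ i → trans (coef-⊕ xs ys i) (e i)

    ⊕-isAbelianGroup : IsAbelianGroup _≈L_ _⊕_ [] (negP (suc k))
    ⊕-isAbelianGroup = record
      { isGroup = record
        { isMonoid = record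
          { isSemigroup = record
            { isMagma = record
              { isEquivalence = Eq-isEquivalence (suc k)
              ; ∙-cong = λ { {xs} {xs′} {ys} {ys′} (step e) (step f) → by₂ xs ys λ i →
                  trans (+-cong (e i) (f i)) (sym (coef-⊕ xs′ ys′ i)) } }
            ; assoc = λ xs ys zs → by₂ (xs ⊕ ys) zs λ i → begin
                co (xs ⊕ ys) i + co zs i       ≈⟨ +-congʳ (coef-⊕ xs ys i) ⟩
                co xs i + co ys i + co zs i    ≈⟨ +-assoc _ _ _ ⟩
                co xs i + (co ys i + co zs i)  ≈⟨ +-congˡ (coef-⊕ ys zs i) ⟨
                co xs i + co (ys ⊕ zs) i       ≈⟨ coef-⊕ xs (ys ⊕ zs) i ⟨
                co (xs ⊕ (ys ⊕ zs)) i          ∎ }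
          ; identity = (λ xs → reflL) , (λ xs → by₂ xs [] λ i → +-identityʳ _) }
        ; inverse = (λ xs → by₂ (negP (suc k) xs) xs λ i → trans (+-congʳ (coef-neg xs i)) (-‿inverseˡ _))
                  , (λ xs → by₂ xs (negP (suc k) xs) λ i → trans (+-congˡ (coef-neg xs i)) (-‿inverseʳ _))
        ; ⁻¹-cong = λ { {xs} {ys} (step e) → step λ i →
            trans (coef-neg xs i) (trans (-‿cong (e i)) (sym (coef-neg ys i))) } }
      ; comm = λ xs ys → by₂ xs ys λ i → trans (+-comm _ _) (sym (coef-⊕ ys xs i)) }
      where open SetoidReasoning setoid

    private
      G : AbelianGroup 0ℓ 0ℓ
      G = record { isAbelianGroup = ⊕-isAbelianGroup }
      module G = AbelianGroup G
      open CommutativeSemigroupProperties G.commutativeSemigroup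
        using (interchange) renaming (x∙yz≈y∙xz to ⊕-swap)

    ·-cong : ∀ {c d xs ys} → c ≈ d → xs ≈L ys → c · xs ≈L d · ys
    ·-cong {c} {d} {xs} {ys} e (step f) = step λ i →
      trans (coef-· c xs i) (trans (*-cong e (f i)) (sym (coef-· d ys i)))

    ·-zeroˡ : ∀ {c} xs → c ≈ 0# → c · xs ≈L []
    ·-zeroˡ xs e = step λ i → trans (coef-· _ xs i) (trans (*-congʳ e) (zeroˡ _))

    ·-distribˡ : ∀ c xs ys → c · (xs ⊕ ys) ≈L c · xs ⊕ c · ys
    ·-distribˡ c xs ys = symL (by₂ (c · xs) (c · ys) λ i → let open SetoidReasoning setoid in begin
      co (c · xs) i + co (c · ys) i   ≈⟨ +-cong (coef-· c xs i) (coef-· c ys i) ⟩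
      c * co xs i + c * co ys i       ≈⟨ distribˡ c _ _ ⟨
      c * (co xs i + co ys i)         ≈⟨ *-congˡ (coef-⊕ xs ys i) ⟨
      c * co (xs ⊕ ys) i              ≈⟨ coef-· c (xs ⊕ ys) i ⟨
      co (c · (xs ⊕ ys)) i            ∎)

    ·-assoc : ∀ c d xs → (c * d) · xs ≈L c · (d · xs)
    ·-assoc c d xs = step λ i → trans (coef-· _ xs i) (trans (*-assoc c d _)
      (sym (trans (coef-· c (d · xs) i) (*-congˡ (coef-· d xs i)))))

    open SetoidReasoning G.setoid

    0∷-⊕ : ∀ xs ys → (0# ∷ (xs ⊕ ys)) ≈L (0# ∷ xs) ⊕ (0# ∷ ys)
    0∷-⊕ xs ys = sym (+-identityʳ 0#) ∷-cong reflL

    0∷-zero : ∀ {xs} → xs ≈L [] → (0# ∷ xs) ≈L []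
    0∷-zero (step e) = step λ { zero → refl ; (suc i) → e i }

    ⊗-congˡ : ∀ xs {ys zs} → ys ≈L zs → xs ⊗ ys ≈L xs ⊗ zs
    ⊗-congˡ []       e = reflL
    ⊗-congˡ (x ∷ xs) e = G.∙-cong (·-cong refl e) (refl ∷-cong ⊗-congˡ xs e)

    ⊗-zeroʳ : ∀ xs → xs ⊗ [] ≈L []
    ⊗-zeroʳ []       = reflL
    ⊗-zeroʳ (x ∷ xs) = 0∷-zero (⊗-zeroʳ xs)

    -- The recursion of `mulP` transferred to its second argument; commutativity follows from it by
    -- induction.
    ⊗-∷ʳ : ∀ ys x xs → ys ⊗ (x ∷ xs) ≈L x · ys ⊕ (0# ∷ ys ⊗ xs)
    ⊗-∷ʳ []       x xs = symL (0∷-zero reflL)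
    ⊗-∷ʳ (y ∷ ys) x xs = +-congʳ (*-comm y x) ∷-cong (begin
      y · xs ⊕ ys ⊗ (x ∷ xs)               ≈⟨ G.∙-congˡ {y · xs} (⊗-∷ʳ ys x xs) ⟩
      y · xs ⊕ (x · ys ⊕ (0# ∷ ys ⊗ xs))   ≈⟨ ⊕-swap (y · xs) (x · ys) _ ⟩
      x · ys ⊕ (y · xs ⊕ (0# ∷ ys ⊗ xs))   ∎)

    ⊗-comm : ∀ xs ys → xs ⊗ ys ≈L ys ⊗ xs
    ⊗-comm []       ys = symL (⊗-zeroʳ ys)
    ⊗-comm (x ∷ xs) ys = begin
      x · ys ⊕ (0# ∷ xs ⊗ ys)   ≈⟨ G.∙-congˡ {x · ys} (refl ∷-cong ⊗-comm xs ys) ⟩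
      x · ys ⊕ (0# ∷ ys ⊗ xs)   ≈⟨ ⊗-∷ʳ ys x xs ⟨
      ys ⊗ (x ∷ xs)             ∎

    ⊗-distribˡ : ∀ xs ys zs → xs ⊗ (ys ⊕ zs) ≈L xs ⊗ ys ⊕ xs ⊗ zs
    ⊗-distribˡ []       ys zs = reflL
    ⊗-distribˡ (x ∷ xs) ys zs = begin
      x · (ys ⊕ zs) ⊕ (0# ∷ xs ⊗ (ys ⊕ zs))
        ≈⟨ G.∙-cong (·-distribˡ x ys zs) (transL (refl ∷-cong ⊗-distribˡ xs ys zs) (0∷-⊕ (xs ⊗ ys) (xs ⊗ zs))) ⟩
      (x · ys ⊕ x · zs) ⊕ ((0# ∷ xs ⊗ ys) ⊕ (0# ∷ xs ⊗ zs))
        ≈⟨ interchange (x · ys) (x · zs) (0# ∷ xs ⊗ ys) (0# ∷ xs ⊗ zs) ⟩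
      (x · ys ⊕ (0# ∷ xs ⊗ ys)) ⊕ (x · zs ⊕ (0# ∷ xs ⊗ zs))  ∎

    ⊗-distribʳ : ∀ zs xs ys → (xs ⊕ ys) ⊗ zs ≈L xs ⊗ zs ⊕ ys ⊗ zs
    ⊗-distribʳ zs xs ys = begin
      (xs ⊕ ys) ⊗ zs     ≈⟨ ⊗-comm (xs ⊕ ys) zs ⟩
      zs ⊗ (xs ⊕ ys)     ≈⟨ ⊗-distribˡ zs xs ys ⟩
      zs ⊗ xs ⊕ zs ⊗ ys  ≈⟨ G.∙-cong (⊗-comm zs xs) (⊗-comm zs ys) ⟩
      xs ⊗ zs ⊕ ys ⊗ zs  ∎

    0∷-⊗ : ∀ xs ys → (0# ∷ xs) ⊗ ys ≈L 0# ∷ xs ⊗ ys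
    0∷-⊗ xs ys = G.∙-congʳ (·-zeroˡ ys refl)

    ·-⊗-assoc : ∀ c xs ys → (c · xs) ⊗ ys ≈L c · (xs ⊗ ys)
    ·-⊗-assoc c []       ys = reflL
    ·-⊗-assoc c (x ∷ xs) ys = begin
      (c * x) · ys ⊕ (0# ∷ (c · xs) ⊗ ys)      ≈⟨ G.∙-cong (·-assoc c x ys) (sym (zeroʳ c) ∷-cong ·-⊗-assoc c xs ys) ⟩
      c · (x · ys) ⊕ c · (0# ∷ xs ⊗ ys)        ≈⟨ ·-distribˡ c (x · ys) (0# ∷ xs ⊗ ys) ⟨
      c · (x · ys ⊕ (0# ∷ xs ⊗ ys))            ∎

    ⊗-assoc : ∀ xs ys zs → (xs ⊗ ys) ⊗ zs ≈L xs ⊗ (ys ⊗ zs)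
    ⊗-assoc []       ys zs = reflL
    ⊗-assoc (x ∷ xs) ys zs = begin
      (x · ys ⊕ (0# ∷ xs ⊗ ys)) ⊗ zs              ≈⟨ ⊗-distribʳ zs (x · ys) (0# ∷ xs ⊗ ys) ⟩
      (x · ys) ⊗ zs ⊕ (0# ∷ xs ⊗ ys) ⊗ zs
        ≈⟨ G.∙-cong (·-⊗-assoc x ys zs) (transL (0∷-⊗ (xs ⊗ ys) zs) (refl ∷-cong ⊗-assoc xs ys zs)) ⟩
      x · (ys ⊗ zs) ⊕ (0# ∷ xs ⊗ (ys ⊗ zs))       ∎

    ⊗-identityˡ : ∀ xs → oneP (suc k) ⊗ xs ≈L xs
    ⊗-identityˡ xs = begin
      1# · xs ⊕ (0# ∷ [])   ≈⟨ G.∙-congˡ {1# · xs} (0∷-zero reflL) ⟩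
      1# · xs ⊕ []          ≈⟨ G.identityʳ (1# · xs) ⟩
      1# · xs               ≈⟨ step (λ i → trans (coef-· 1# xs i) (*-identityˡ _)) ⟩
      xs                    ∎

    constant-⊗ : ∀ xs ys → co (xs ⊗ ys) 0 ≈ co xs 0 * co ys 0
    constant-⊗ []       ys = sym (zeroˡ _)
    constant-⊗ (x ∷ xs) ys = trans (coef-⊕ (x · ys) _ 0) (trans (+-identityʳ _) (coef-· x ys 0))

    isPolyRing : IsPolyRing (suc k)
    isPolyRing = record
      { isRing = record
        { +-isAbelianGroup = ⊕-isAbelianGroup
        ; *-cong = λ {xs} {ys} {zs} {ws} e f → transL (⊗-comm xs zs)
            (transL (⊗-congˡ zs e) (transL (⊗-comm zs ys) (⊗-congˡ ys f)))
        ; *-assoc = ⊗-assoc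
        ; *-identity = ⊗-identityˡ
                     , λ xs → transL (⊗-comm xs (oneP (suc k))) (⊗-identityˡ xs)
        ; distrib = ⊗-distribˡ , ⊗-distribʳ }
      ; *-comm = ⊗-comm }

  isPolyRing : ∀ k → IsPolyRing k
  isPolyRing zero = record
    { isRing = record
      { +-isAbelianGroup = record
        { isGroup = record
          { isMonoid = record
            { isSemigroup = record
              { isMagma = record
                { isEquivalence = Eq-isEquivalence zero
                ; ∙-cong = λ { (base e) (base f) → base (≡.cong₂ ℤ._+_ e f) } }
              ; assoc = λ x y z → base (ℤₚ.+-assoc x y z) }
            ; identity = (λ x → base (ℤₚ.+-identityˡ x)) , (λ x → base (ℤₚ.+-identityʳ x)) }
          ; inverse = (λ x → base (ℤₚ.+-inverseˡ x)) , (λ x → base (ℤₚ.+-inverseʳ x))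
          ; ⁻¹-cong = λ { (base e) → base (≡.cong ℤ.-_ e) } }
        ; comm = λ x y → base (ℤₚ.+-comm x y) }
      ; *-cong = λ { (base e) (base f) → base (≡.cong₂ ℤ._*_ e f) }
      ; *-assoc = λ x y z → base (ℤₚ.*-assoc x y z)
      ; *-identity = (λ x → base (ℤₚ.*-identityˡ x)) , (λ x → base (ℤₚ.*-identityʳ x))
      ; distrib = (λ x y z → base (ℤₚ.*-distribˡ-+ x y z)) , (λ x y z → base (ℤₚ.*-distribʳ-+ x y z)) }
    ; *-comm = λ x y → base (ℤₚ.*-comm x y) }
  isPolyRing (suc k) = ListRing.isPolyRing k (isPolyRing k)

  polyRing : ℕ → CommutativeRing 0ℓ 0ℓ
  polyRing k = mkPolyRing k (isPolyRing k)

  IsZero⇒Eq : ∀ k x → IsZero k x → Eq k x (zeroP k)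
  IsZero⇒Eq zero    x        e        = base e
  IsZero⇒Eq (suc k) []       e        = step λ i → IsEquivalence.refl (Eq-isEquivalence k)
  IsZero⇒Eq (suc k) (x ∷ xs) (e ∷ es) = step λ
    { zero → IsZero⇒Eq k x e ; (suc i) → coef-cong (IsZero⇒Eq (suc k) xs es) i }

  Eq⇒IsZero : ∀ k x → Eq k x (zeroP k) → IsZero k x
  Eq⇒IsZero zero    x        (base e) = e
  Eq⇒IsZero (suc k) []       _        = []
  Eq⇒IsZero (suc k) (x ∷ xs) (step e) = Eq⇒IsZero k x (e 0) ∷ Eq⇒IsZero (suc k) xs (step λ i → e (suc i))

  ≈P⇒Eq : ∀ k x y → _≈P_ {k} x y → Eq k x y
  ≈P⇒Eq k x y e = x∙y⁻¹≈ε⇒x≈y x y (IsZero⇒Eq k (subP k x y) e)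
    where open AbelianGroupProperties (CommutativeRing.+-abelianGroup (polyRing k))

  Eq⇒≈P : ∀ k x y → Eq k x y → _≈P_ {k} x y
  Eq⇒≈P k x y e = Eq⇒IsZero k (subP k x y) (x≈y⇒x∙y⁻¹≈ε e)
    where open AbelianGroupProperties (CommutativeRing.+-abelianGroup (polyRing k))

  zero? : ∀ k x → Dec (Eq k x (zeroP k))
  zero? zero    x with x ℤₚ.≟ + 0
  ... | yes e = yes (base e)
  ... | no ¬e = no λ { (base e) → ¬e e }
  zero? (suc k) [] = yes (IsEquivalence.refl (Eq-isEquivalence (suc k)))
  zero? (suc k) (x ∷ xs) with zero? k x | zero? (suc k) xs
  ... | yes e | yes es = yes (step λ { zero → e ; (suc i) → coef-cong es i })
  ... | no ¬e | _      = no λ { (step e) → ¬e (e 0) }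
  ... | _     | no ¬es = no λ { (step e) → ¬es (step λ i → e (suc i)) }

  NoZeroDivisors : ℕ → Set
  NoZeroDivisors k = ∀ x y → Eq k (mulP k x y) (zeroP k) → ¬ Eq k x (zeroP k) → Eq k y (zeroP k)

  -- A vanishing lowest coefficient of the first factor is stripped off. If it does not vanish, the
  -- lowest coefficient of the product forces that of the second factor to be zero, and the second
  -- factor is shortened instead.
  noZeroDivisors : ∀ k → NoZeroDivisors k
  noZeroDivisors zero x y (base e) x≉0 with ℤₚ.i*j≡0⇒i≡0∨j≡0 x e
  ... | inj₁ x≡0 = ⊥-elim (x≉0 (base x≡0))
  ... | inj₂ y≡0 = base y≡0
  noZeroDivisors (suc k) []       ys e xs≉0 = ⊥-elim (xs≉0 (IsEquivalence.refl (Eq-isEquivalence (suc k))))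
  noZeroDivisors (suc k) (x ∷ xs) ys e xs≉0 with zero? k x
  ... | yes x≈0 = noZeroDivisors (suc k) xs ys
          (step λ i → coef-cong (transL (symL (⊕.∙-congʳ (·-zeroˡ ys x≈0))) e) (suc i))
          λ xs≈0 → xs≉0 (step λ { zero → x≈0 ; (suc i) → coef-cong xs≈0 i })
    where
    open ListRing k (isPolyRing k)
    module ⊕ = IsAbelianGroup ⊕-isAbelianGroup
  ... | no  x≉0 = go ys e
    where
    open ListRing k (isPolyRing k)
    module ⊕ = IsAbelianGroup ⊕-isAbelianGroup
    go : ∀ ys → (x ∷ xs) ⊗ ys ≈L [] → ys ≈L []
    go []       e = reflL
    go (y ∷ ys) e = step λ { zero → y≈0 ; (suc i) → coef-cong (go ys rest) i }
      where
      y≈0 : y ≈ 0#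
      y≈0 = noZeroDivisors k x y (trans (sym (+-identityʳ _)) (coef-cong e 0)) x≉0
      tail≈ : y · (x ∷ xs) ⊕ (0# ∷ (x ∷ xs) ⊗ ys) ≈L 0# ∷ (x ∷ xs) ⊗ ys
      tail≈ = ⊕.∙-congʳ (·-zeroˡ (x ∷ xs) y≈0)
      rest : (x ∷ xs) ⊗ ys ≈L []
      rest = step λ i → coef-cong (transL (symL tail≈) (transL (symL (⊗-∷ʳ (x ∷ xs) y ys)) e)) (suc i)

  1≉0 : ∀ k → ¬ Eq k (oneP k) (zeroP k)
  1≉0 zero    (base ())
  1≉0 (suc k) (step e) = 1≉0 k (e 0)

  IsConstant : ∀ k → Poly (suc k) → Set
  IsConstant k x = ∃ λ c → ¬ Eq k c (zeroP k) × Eq (suc k) x (c ∷ [])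

  -- Needed twice: for k = 0, where ℤ[q] contains the cyclotomic polynomials, and for k = 2, where
  -- ℤ[b][a][q] contains the sum.
  polyDomain : ℕ → ConstDomain
  polyDomain k = record
    { ring           = polyRing (suc k)
    ; noZeroDivisors = noZeroDivisors (suc k)
    ; 1≉0            = 1≉0 (suc k)
    ; Const          = IsConstant k
    ; const-1        = oneP k , 1≉0 k , CommutativeRing.refl (polyRing (suc k))
    ; const-*        = λ { (c , c≉0 , e) (d , d≉0 , f) → mulP k c d
        , (λ cd≈0 → d≉0 (noZeroDivisors k c d cd≈0 c≉0))
        , CommutativeRing.trans (polyRing (suc k)) (CommutativeRing.*-cong (polyRing (suc k)) e f)
            (step λ { zero → CommutativeRing.+-identityʳ (polyRing k) _ ; (suc i) → CommutativeRing.refl (polyRing k) }) } }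

-- The computed Φ and the factorisation of q^m - 1 in ℤ[q].

module CyclotomicPoly where

  open import Defs
  open PolyRing
  open import Data.Integer.Base as ℤ using (ℤ; +_; -[1+_])
  open import Data.Sum using (_⊎_; inj₁; inj₂)
  open Counting

  module P = CommutativeRing (polyRing 1)
  module PB = BigOp (polyRing 1)
  private
    module L = ListRing 0 (isPolyRing 0)
    open L using (_·_; _∷-cong_; coef-⊕; coef-neg; coef-·)
    open Solver (polyRing 1)

  powP≡^ : ∀ x n → powP 1 x n ≡ x PB.^ n
  powP≡^ x zero    = ≡.refl
  powP≡^ x (suc n) = ≡.cong (mulP 1 x) (powP≡^ x n)

  head : P1 → ℤ
  head x = coef 0 x 0

  head-cong : ∀ {x y} → x P.≈ y → head x ≡ head y
  head-cong e = Eq⇒≡ (coef-cong e 0)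

  head-* : ∀ x y → head (x P.* y) ≡ head x ℤ.* head y
  head-* x y = Eq⇒≡ (L.constant-⊗ x y)

  headZ≡head : ∀ x → headZ x ≡ head x
  headZ≡head []      = ≡.refl
  headZ≡head (_ ∷ _) = ≡.refl

  private
    ∷-η : ∀ x → x P.≈ (headZ x ∷ tailZ x)
    ∷-η []       = step λ { zero → base ≡.refl ; (suc i) → base ≡.refl }
    ∷-η (x ∷ xs) = P.refl

    coef-tailZ : ∀ x i → coef 0 (tailZ x) i ≡ coef 0 x (suc i)
    coef-tailZ []       i = ≡.refl
    coef-tailZ (x ∷ xs) i = ≡.refl

    length-tailZ : ∀ x {f} → length x ≤ suc f → length (tailZ x) ≤ f
    length-tailZ []       _        = z≤n
    length-tailZ (x ∷ xs) (s≤s xs≤) = xs≤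

    ·-cancel : ∀ c {x y} → ¬ c ≡ + 0 → c · x P.≈ c · y → x P.≈ y
    ·-cancel c {x} {y} c≢0 (step e) = step λ i → base (ℤₚ.*-cancelˡ-≡ c _ _ {{ℤ.≢-nonZero c≢0}}
      (Eq⇒≡ (L.trans (L.sym (coef-· c x i)) (L.trans (e i) (coef-· c y i)))))

    neg-· : ∀ c x → P.- (c · x) P.≈ c · (P.- x)
    neg-· c x = step λ i → L.trans (coef-neg (c · x) i) (L.trans (L.-‿cong (coef-· c x i))
      (L.trans (base (ℤₚ.neg-distribʳ-* c (coef 0 x i)))
        (L.sym (L.trans (coef-· c (P.- x) i) (L.*-congˡ {c} (coef-neg x i))))))

    mul-· : ∀ c x y → x P.* (c · y) P.≈ c · (x P.* y)
    mul-· c x y = P.trans (P.*-comm x (c · y)) (P.trans (L.·-⊗-assoc c y x) (L.·-cong L.refl (P.*-comm y x)))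

  -- The integer c is there because coprimality over ℚ only yields that g divides a multiple of p.
  divLow-exact : ∀ f p g k c → ¬ c ≡ + 0 → headZ g ℤ.* headZ g ≡ + 1 → length k ≤ f →
    g P.* k P.≈ c · p → k P.≈ c · divLow f p g
  divLow-exact zero    p g []       c c≢0 unit k≤ e = P.refl
  -- Comparing lowest coefficients gives g₀ k₀ = c p₀, and g₀² = 1 solves this for k₀ without
  -- division. Subtracting k₀ g leaves the same situation one degree lower.
  divLow-exact (suc f) p g k        c c≢0 unit k≤ e = P.trans (∷-η k)
    (base k₀≡ ∷-cong divLow-exact f p′ g (tailZ k) c c≢0 unit (length-tailZ k k≤) tail-eq)
    where
    c₀ = headZ g ℤ.* headZ p
    p′ = tailZ (subP 1 p (c₀ · g))
    k₀≡ : headZ k ≡ c ℤ.* c₀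
    k₀≡ = begin
      headZ k                            ≡⟨ ≡.sym (ℤₚ.*-identityˡ _) ⟩
      + 1 ℤ.* headZ k                    ≡⟨ ≡.cong (ℤ._* headZ k) (≡.sym unit) ⟩
      headZ g ℤ.* headZ g ℤ.* headZ k    ≡⟨ ℤₚ.*-assoc (headZ g) _ _ ⟩
      headZ g ℤ.* (headZ g ℤ.* headZ k)  ≡⟨ ≡.cong (headZ g ℤ.*_) heads ⟩
      headZ g ℤ.* (c ℤ.* headZ p)        ≡⟨ swap (headZ g) c (headZ p) ⟩
      c ℤ.* c₀                           ∎
      where
      open ≡.≡-Reasoning
      swap : ∀ x y z → x ℤ.* (y ℤ.* z) ≡ y ℤ.* (x ℤ.* z)
      swap x y z = ≡.trans (≡.sym (ℤₚ.*-assoc x y z)) (≡.trans (≡.cong (ℤ._* z) (ℤₚ.*-comm x y)) (ℤₚ.*-assoc y x z))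
      heads : headZ g ℤ.* headZ k ≡ c ℤ.* headZ p
      heads = begin
        headZ g ℤ.* headZ k  ≡⟨ ≡.cong₂ ℤ._*_ (headZ≡head g) (headZ≡head k) ⟩
        head g ℤ.* head k    ≡⟨ ≡.sym (head-* g k) ⟩
        head (g P.* k)       ≡⟨ head-cong e ⟩
        head (c · p)         ≡⟨ Eq⇒≡ (coef-· c p 0) ⟩
        c ℤ.* head p         ≡⟨ ≡.cong (c ℤ.*_) (≡.sym (headZ≡head p)) ⟩
        c ℤ.* headZ p        ∎
    k₀ = headZ k
    shifted : + 0 ∷ (g P.* tailZ k) P.≈ c · subP 1 p (c₀ · g)
    shifted = begin
      + 0 ∷ (g P.* tailZ k)
        ≈⟨ solve 2 (λ x y → x := y :+ x :- y) P.refl _ (k₀ · g) ⟩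
      k₀ · g P.+ (+ 0 ∷ (g P.* tailZ k)) P.- k₀ · g
        ≈⟨ P.+-congʳ (L.⊗-∷ʳ g k₀ (tailZ k)) ⟨
      g P.* (k₀ ∷ tailZ k) P.- k₀ · g
        ≈⟨ P.+-cong {g P.* (k₀ ∷ tailZ k)} {c · p} {P.- (k₀ · g)} {P.- (c · (c₀ · g))} (P.trans (P.*-congˡ {g} (P.sym (∷-η k))) e) (P.-‿cong (P.trans (L.·-cong (base k₀≡) P.refl) (L.·-assoc c c₀ g))) ⟩
      c · p P.- c · (c₀ · g)
        ≈⟨ P.+-congˡ {c · p} (neg-· c (c₀ · g)) ⟩
      c · p P.+ c · (P.- (c₀ · g))
        ≈⟨ L.·-distribˡ c p (P.- (c₀ · g)) ⟨
      c · subP 1 p (c₀ · g) ∎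
      where
      open SetoidReasoning P.setoid
    tail-eq : g P.* tailZ k P.≈ c · p′
    tail-eq = step λ i → L.trans (coef-cong shifted (suc i)) (L.trans (coef-· c (subP 1 p (c₀ · g)) (suc i))
      (L.trans (base (≡.cong (c ℤ.*_) (≡.sym (coef-tailZ (subP 1 p (c₀ · g)) i)))) (L.sym (coef-· c p′ i))))

  -- The last entry is not zero, so the length of the list is the degree plus one.
  data Proper : P1 → Set where
    [_] : ∀ {x} → ¬ x ≡ + 0 → Proper (x ∷ [])
    _∷_ : ∀ x {xs} → Proper xs → Proper (x ∷ xs)

  -- The conditions on a divisor of `exactDiv`: its length shows its true degree, and its constant
  -- term is 1 or -1, encoded by the square being 1.
  Unital : P1 → Set
  Unital x = Proper x × headZ x ℤ.* headZ x ≡ + 1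

  private
    Proper-⊕ : ∀ ws {zs} → Proper zs → length ws < length zs →
      Proper (ws P.+ zs) × length (ws P.+ zs) ≡ length zs
    Proper-⊕ []       pz       _        = pz , ≡.refl
    Proper-⊕ (w ∷ ws) [ _ ]    (s≤s ())
    Proper-⊕ (w ∷ ws) (z ∷ pz) (s≤s lt) = let (p , l) = Proper-⊕ ws pz lt in _ ∷ p , ≡.cong suc l

    length-· : ∀ c xs → length (c · xs) ≡ length xs
    length-· c []       = ≡.refl
    length-· c (x ∷ xs) = ≡.cong suc (length-· c xs)

    ⊕-[] : ∀ (xs : P1) → xs P.+ [] ≡ xs
    ⊕-[] []       = ≡.refl
    ⊕-[] (x ∷ xs) = ≡.refl

    nonzero-* : ∀ {x y} → ¬ x ≡ + 0 → ¬ y ≡ + 0 → ¬ x ℤ.* y ≡ + 0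
    nonzero-* {x} x≢0 y≢0 e with ℤₚ.i*j≡0⇒i≡0∨j≡0 x e
    ... | inj₁ x≡0 = x≢0 x≡0
    ... | inj₂ y≡0 = y≢0 y≡0

    Proper-· : ∀ {c ys} → ¬ c ≡ + 0 → Proper ys → Proper (c · ys)
    Proper-· c≢0 [ y≢0 ]  = [ nonzero-* c≢0 y≢0 ]
    Proper-· c≢0 (y ∷ py) = _ ∷ Proper-· c≢0 py

    Proper-* : ∀ {xs ys} → Proper xs → Proper ys →
      Proper (xs P.* ys) × suc (length (xs P.* ys)) ≡ length xs ℕ.+ length ys
    Proper-* {x ∷ []} {ys} [ x≢0 ] py = helper (Proper-· x≢0 py) (length-· x ys)
      where
      helper : ∀ {ws} → Proper ws → length ws ≡ length ys →
        Proper (ws P.+ (+ 0 ∷ [])) × suc (length (ws P.+ (+ 0 ∷ []))) ≡ suc (length ys)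
      helper ([_] {w} w≢0) l = [ (λ e → w≢0 (≡.trans (≡.sym (ℤₚ.+-identityʳ w)) e)) ] , ≡.cong suc l
      helper (_∷_ w {ws} p) l rewrite ⊕-[] ws = _ ∷ p , ≡.cong suc l
    Proper-* {x ∷ xs} {ys} (x ∷ px) py =
      let (p , l)   = Proper-* px py
          (p′ , l′) = Proper-⊕ (x · ys) {+ 0 ∷ (xs P.* ys)} (+ 0 ∷ p)
            (≡.subst₂ _<_ (≡.sym (length-· x ys)) (≡.sym l) (ℕₚ.m<n+m (length ys) (positive px)))
      in p′ , ≡.cong suc (≡.trans l′ l)
      where
      positive : ∀ {xs} → Proper xs → 0 < length xs
      positive [ _ ]   = ℕ.z<s
      positive (_ ∷ _) = ℕ.z<s

    Proper-length : ∀ {xs} ys → Proper xs → xs P.≈ ys → length xs ≤ length ys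
    Proper-length [] [ x≢0 ] (step e)  = contradiction (Eq⇒≡ (e 0)) x≢0
    Proper-length [] (x ∷ px) (step e) = contradiction (Proper-length [] px (step λ i → e (suc i))) (none px)
      where
      none : ∀ {xs} → Proper xs → ¬ length xs ≤ 0
      none [ _ ]   ()
      none (_ ∷ _) ()
    Proper-length (y ∷ ys) [ x≢0 ]  e        = s≤s z≤n
    Proper-length (y ∷ ys) (x ∷ px) (step e) = s≤s (Proper-length ys px (step λ i → e (suc i)))

    trim-≈ : ∀ xs → trim xs P.≈ xs
    trim-≈ [] = P.refl
    trim-≈ (x ∷ xs) with trim xs | trim-≈ xs
    ... | y ∷ ys | e = L.refl ∷-cong e
    ... | []     | e with x ℤₚ.≟ + 0
    ...   | yes x≡0 = P.trans (step λ { zero → base ≡.refl ; (suc i) → base ≡.refl }) (base (≡.sym x≡0) ∷-cong e)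
    ...   | no  _   = L.refl ∷-cong e

    trim-Proper : ∀ xs → trim xs ≡ [] ⊎ Proper (trim xs)
    trim-Proper [] = inj₁ ≡.refl
    trim-Proper (x ∷ xs) with trim xs | trim-Proper xs
    ... | y ∷ ys | inj₂ p = inj₂ (x ∷ p)
    ... | []     | _ with x ℤₚ.≟ + 0
    ...   | yes _   = inj₁ ≡.refl
    ...   | no  x≢0 = inj₂ [ x≢0 ]

  -- Power-series division is linear and its result unique, so k is c times the computed quotient
  -- and c can be cancelled in ℤ. Comparing degrees shows that k has no more coefficients than the
  -- division computes.
  exactDiv-exact : ∀ p g k c → ¬ c ≡ + 0 → Unital g → g P.* k P.≈ c · p → g P.* exactDiv p g P.≈ p
  exactDiv-exact p g k c c≢0 (proper-g , unit-g) e = ·-cancel c c≢0 (begin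
    c · (g P.* exactDiv p g)  ≈⟨ mul-· c g (exactDiv p g) ⟨
    g P.* (c · exactDiv p g)  ≈⟨ P.*-congˡ {g} (L.·-cong L.refl (trim-≈ (divLow f p g))) ⟩
    g P.* (c · divLow f p g)  ≈⟨ P.*-congˡ {g} (divLow-exact f p g (trim k) c c≢0 unit-g (length-trim (trim-Proper k)) e′) ⟨
    g P.* trim k              ≈⟨ e′ ⟩
    c · p                     ∎)
    where
    open SetoidReasoning P.setoid
    f = suc (length p ℕ.∸ length g)
    e′ : g P.* trim k P.≈ c · p
    e′ = P.trans (P.*-congˡ {g} (trim-≈ k)) e
    suc-∸ : ∀ a b → suc a ℕ.∸ b ≤ suc (a ℕ.∸ b)
    suc-∸ a zero          = ℕₚ.≤-refl
    suc-∸ zero (suc b)    = ℕₚ.≤-trans (ℕₚ.m∸n≤m 0 b) z≤n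
    suc-∸ (suc a) (suc b) = suc-∸ a b
    length-trim : trim k ≡ [] ⊎ Proper (trim k) → length (trim k) ≤ f
    length-trim (inj₁ k≡[]) rewrite k≡[] = z≤n
    length-trim (inj₂ proper-k) = let (p′ , l) = Proper-* proper-g proper-k in
      ℕₚ.≤-trans (ℕₚ.m+n≤o⇒m≤o∸n (length (trim k)) (ℕₚ.≤-trans (ℕₚ.≤-reflexive (≡.trans (ℕₚ.+-comm (length (trim k)) (length g)) (≡.sym l)))
        (s≤s (ℕₚ.≤-trans (Proper-length (c · p) p′ e′) (ℕₚ.≤-reflexive (length-· c p)))))) (suc-∸ (length p) (length g))

  private
    module Φ-Factors where
      open import Algebra.Properties.Semiring.Mult P.semiring using () renaming (_×_ to _·ℕ_)

      q^ : ∀ k → head (qvar1 PB.^ suc k) ≡ + 0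
      q^ k = ≡.trans (head-* qvar1 (qvar1 PB.^ k)) (ℤₚ.*-zeroˡ (head (qvar1 PB.^ k)))

      ℕ-constant : ∀ k → k ·ℕ P.1# P.≈ (+ k ∷ [])
      ℕ-constant zero    = step λ { zero → base ≡.refl ; (suc i) → base ≡.refl }
      ℕ-constant (suc k) = P.+-congˡ {P.1#} (ℕ-constant k)

      const-ℕ : ∀ k → 0 < k → IsConstant 0 (k ·ℕ P.1#)
      const-ℕ (suc k) _ = + suc k , (λ { (base ()) }) , ℕ-constant (suc k)

      head-q^-1 : ∀ k → head (qvar1 PB.^ suc k P.- P.1#) ≡ -[1+ 0 ]
      head-q^-1 k = ≡.trans (Eq⇒≡ (coef-⊕ (qvar1 PB.^ suc k) (P.- P.1#) 0)) (≡.cong (ℤ._+ -[1+ 0 ]) (q^ k))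

      q^-1≉0 : ∀ k → 0 < k → ¬ qvar1 PB.^ k P.- P.1# P.≈ P.0#
      q^-1≉0 (suc k) _ e = contradiction (≡.trans (≡.sym (head-q^-1 k)) (head-cong e)) λ ()

      open CyclotomicFactors (polyDomain 0)
      open Localisation (polyDomain 0) using (Coprime)

      private
        D = λ j → qvar1 PB.^ j P.- P.1#

        square-* : ∀ x y → (x ℤ.* x) ℤ.* (y ℤ.* y) ≡ (x ℤ.* y) ℤ.* (x ℤ.* y)
        square-* = ℤ-Solver.solve-∀

        square-unit : ∀ x y → (x ℤ.* y) ℤ.* (x ℤ.* y) ≡ + 1 → x ℤ.* x ≡ + 1 → y ℤ.* y ≡ + 1
        square-unit x y e f = ≡.trans (≡.sym (ℤₚ.*-identityˡ _)) (≡.trans (≡.cong (ℤ._* (y ℤ.* y)) (≡.sym f))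
          (≡.trans (square-* x y) e))

        Unital-1 : Unital P.1#
        Unital-1 = [ (λ ()) ] , ≡.refl

        Unital-* : ∀ {x y} → Unital x → Unital y → Unital (x P.* y)
        Unital-* {x} {y} (px , ux) (py , uy) = proj₁ (Proper-* px py) , (begin
          headZ (x P.* y) ℤ.* headZ (x P.* y)              ≡⟨ ≡.cong (λ h → h ℤ.* h) (≡.trans (headZ≡head (x P.* y)) (head-* x y)) ⟩
          (head x ℤ.* head y) ℤ.* (head x ℤ.* head y)      ≡⟨ ≡.cong₂ (λ h k → (h ℤ.* k) ℤ.* (h ℤ.* k)) (≡.sym (headZ≡head x)) (≡.sym (headZ≡head y)) ⟩
          (headZ x ℤ.* headZ y) ℤ.* (headZ x ℤ.* headZ y)  ≡⟨ ≡.sym (square-* (headZ x) (headZ y)) ⟩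
          (headZ x ℤ.* headZ x) ℤ.* (headZ y ℤ.* headZ y)  ≡⟨ ≡.cong₂ ℤ._*_ ux uy ⟩
          + 1                                              ∎)
          where open ≡.≡-Reasoning

        Unital-prodDivs : ∀ m xs → All (λ dp → Unital (proj₂ dp)) xs → Unital (prodDivs m xs)
        Unital-prodDivs m []       []       = Unital-1
        Unital-prodDivs m (x ∷ xs) (u ∷ us) with proj₁ x ∣? m
        ... | yes _ = Unital-* u (Unital-prodDivs m xs us)
        ... | no _  = Unital-prodDivs m xs us

        prodDivs-∷ʳ : ∀ m xs j p → prodDivs m (xs ++ ((j , p) ∷ [])) P.≈ prodDivs m xs P.* p PB.^ divides? j m
        prodDivs-∷ʳ m [] j p with j ∣? m
        ... | yes _ = P.trans (P.*-identityʳ p) (P.sym (P.trans (P.*-identityˡ _) (P.*-identityʳ p)))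
        ... | no _  = P.sym (P.*-identityˡ _)
        prodDivs-∷ʳ m (x ∷ xs) j p with proj₁ x ∣? m
        ... | yes _ = P.trans (P.*-congˡ {proj₂ x} (prodDivs-∷ʳ m xs j p)) (P.sym (P.*-assoc (proj₂ x) (prodDivs m xs) (p PB.^ divides? j m)))
        ... | no _  = prodDivs-∷ʳ m xs j p

        prodDivs-cyclos : ∀ m N → prodDivs m (cyclos N) P.≈ PB.prod N (λ i → Φ (suc i) PB.^ divides? (suc i) m)
        prodDivs-cyclos m zero    = P.refl
        prodDivs-cyclos m (suc N) = P.trans (prodDivs-∷ʳ m (cyclos N) (suc N) (Φ (suc N))) (P.*-congʳ (prodDivs-cyclos m N))

        Unital-cyclos : ∀ N → (∀ i → i < N → Unital (Φ (suc i))) → All (λ dp → Unital (proj₂ dp)) (cyclos N)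
        Unital-cyclos zero    h = []
        Unital-cyclos (suc N) h = ++⁺ (Unital-cyclos N λ i i<N → h i (ℕₚ.m<n⇒m<1+n i<N)) (h N ℕₚ.≤-refl ∷ [])

        Fact : ℕ → Set
        Fact j = Factorises const-ℕ qvar1 q^-1≉0 Φ j

        -- By pairwise coprimality the product over the proper divisors divides a constant multiple
        -- of q^(N+1) - 1; `exactDiv-exact` removes the constant.
        next : ∀ N → (∀ j → 0 < j → j ≤ N → Fact j) → (∀ i → i < N → Unital (Φ (suc i))) →
          prodDivs (suc N) (cyclos N) P.* Φ (suc N) P.≈ D (suc N)
        next N h u with proper-divisors const-ℕ qvar1 q^-1≉0 Φ N h
        ... | c , k , (c₀ , c₀≉0 , c≈) , e = P.trans
          (exactDiv-exact p g k c₀ (λ c₀≡0 → c₀≉0 (base c₀≡0)) (Unital-prodDivs (suc N) (cyclos N) (Unital-cyclos N u)) (begin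
            g P.* k                  ≈⟨ P.*-congʳ {k} (prodDivs-cyclos (suc N) N) ⟩
            G P.* k                  ≈⟨ e ⟨
            c P.* D (suc N)          ≈⟨ P.*-congʳ {D (suc N)} c≈ ⟩
            (c₀ ∷ []) P.* D (suc N)  ≈⟨ constant-* c₀ (D (suc N)) ⟩
            c₀ · D (suc N)           ≈⟨ L.·-cong L.refl p≈D ⟨
            c₀ · p                   ∎))
          p≈D
          where
          open SetoidReasoning P.setoid
          p = subP 1 (powP 1 qvar1 (suc N)) (oneP 1)
          g = prodDivs (suc N) (cyclos N)
          G = PB.prod N (λ i → Φ (suc i) PB.^ divides? (suc i) (suc N))
          p≈D : p P.≈ D (suc N)
          p≈D = P.reflexive (≡.cong (λ x → subP 1 x (oneP 1)) (powP≡^ qvar1 (suc N)))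
          constant-* : ∀ c x → (c ∷ []) P.* x P.≈ c · x
          constant-* c x = P.trans (P.+-congˡ {c · x} (step λ { zero → base ≡.refl ; (suc i) → base ≡.refl })) (P.+-identityʳ (c · x))

        -- The constant terms of g and of Φ multiply to that of q^(N+1) - 1, which is -1. So the
        -- trimmed quotient is not empty, and its constant term is again 1 or -1.
        unital-next : ∀ N g → Unital g → g P.* Φ (suc N) P.≈ D (suc N) → Unital (Φ (suc N))
        unital-next N g (pg , ug) e = proper (trim-Proper (divLow (suc (length p ℕ.∸ length g′)) p g′)) , square-unit (headZ g) (headZ (Φ (suc N)))
            (≡.trans (≡.cong (λ h → h ℤ.* h) heads) ≡.refl) ug
          where
          p = subP 1 (powP 1 qvar1 (suc N)) (oneP 1)
          g′ = prodDivs (suc N) (cyclos N)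
          heads : headZ g ℤ.* headZ (Φ (suc N)) ≡ -[1+ 0 ]
          heads = ≡.trans (≡.cong₂ ℤ._*_ (headZ≡head g) (headZ≡head (Φ (suc N))))
            (≡.trans (≡.sym (head-* g (Φ (suc N)))) (≡.trans (head-cong e) (head-q^-1 N)))
          proper : Φ (suc N) ≡ [] ⊎ Proper (Φ (suc N)) → Proper (Φ (suc N))
          proper (inj₂ p) = p
          proper (inj₁ Φ≡[]) = contradiction (≡.trans (≡.sym heads)
            (≡.trans (≡.cong (λ x → headZ g ℤ.* headZ x) Φ≡[]) (ℤₚ.*-zeroʳ (headZ g)))) λ ()

        -- The two claims need each other: exactness of the next division requires constant terms 1
        -- or -1 so far, and the constant term of the next Φ is read off from that exactness.
        both : ∀ N → (∀ j → 0 < j → j ≤ N → Fact j) × (∀ i → i < N → Unital (Φ (suc i)))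
        both zero = (λ { zero () _ ; (suc j) _ () }) , λ i ()
        both (suc N) with both N
        ... | h , u = fact , unital
          where
          eq = next N h u
          fact : ∀ j → 0 < j → j ≤ suc N → Fact j
          fact j 0<j j≤ with ℕₚ.m≤n⇒m<n∨m≡n j≤
          ... | inj₁ (s≤s j≤N) = h j 0<j j≤N
          ... | inj₂ ≡.refl    = P.trans (P.sym eq) (P.*-cong (prodDivs-cyclos (suc N) N)
            (P.sym (P.trans (P.reflexive (≡.cong (Φ (suc N) PB.^_) (divides?-yes {suc N} ∣-refl))) (P.*-identityʳ _))))
          unital : ∀ i → i < suc N → Unital (Φ (suc i))
          unital i (s≤s i≤N) with ℕₚ.m≤n⇒m<n∨m≡n i≤N
          ... | inj₁ i<N    = u i i<N
          ... | inj₂ ≡.refl = unital-next N (prodDivs (suc N) (cyclos N)) (Unital-prodDivs (suc N) (cyclos N) (Unital-cyclos N u)) eq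

      q^-1-factors : ∀ B j → 0 < j → j ≤ B → D j P.≈ PB.prod B (λ i → Φ (suc i) PB.^ divides? (suc i) j)
      q^-1-factors B j 0<j j≤B = P.trans (proj₁ (both j) j 0<j ℕₚ.≤-refl)
        (P.sym (prod-factor const-ℕ qvar1 q^-1≉0 Φ j B 0<j j≤B))

      Φ-coprime : ∀ {i j} → ¬ i ≡ j → Coprime (Φ (suc i)) (Φ (suc j))
      Φ-coprime {i} {j} i≢j = coprime-Φ const-ℕ qvar1 q^-1≉0 Φ (suc (i ℕ.+ j)) (proj₁ (both (suc (i ℕ.+ j))))
        (s≤s (ℕₚ.m≤m+n i j)) (s≤s (ℕₚ.m≤n+m j i)) i≢j

  open Φ-Factors public using (q^-1-factors; Φ-coprime)

-- Transfer from ℤ[q] to ℤ[a,b][q].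

module Embedding where

  open import Defs
  open PolyRing
  open CyclotomicPoly using (q^-1-factors; Φ-coprime; powP≡^)
  open import Data.Integer.Base as ℤ using (+_)
  open Counting

  module Z = CommutativeRing (polyRing 0)
  module P = CommutativeRing (polyRing 1)
  module PB = BigOp (polyRing 1)
  module C = CommutativeRing (polyRing 2)
  module CB = BigOp (polyRing 2)
  module R = CommutativeRing (polyRing 3)
  module RB = BigOp (polyRing 3)

  private
    constP-zero : ∀ k → Eq k (constP k (+ 0)) (zeroP k)
    constP-zero zero    = base ≡.refl
    constP-zero (suc k) = step λ { zero → constP-zero k ; (suc i) → CommutativeRing.refl (polyRing k) }

    constP-+ : ∀ k x y → Eq k (constP k (x ℤ.+ y)) (addP k (constP k x) (constP k y))
    constP-+ zero    x y = base ≡.refl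
    constP-+ (suc k) x y = step λ { zero → constP-+ k x y ; (suc i) → CommutativeRing.refl (polyRing k) }

    constP-neg : ∀ k x → Eq k (constP k (ℤ.- x)) (negP k (constP k x))
    constP-neg zero    x = base ≡.refl
    constP-neg (suc k) x = step λ { zero → constP-neg k x ; (suc i) → CommutativeRing.refl (polyRing k) }

    constP-* : ∀ k x y → Eq k (constP k (x ℤ.* y)) (mulP k (constP k x) (constP k y))
    constP-* zero    x y = base ≡.refl
    constP-* (suc k) x y = step λ
      { zero → CommutativeRing.trans (polyRing k) (constP-* k x y) (CommutativeRing.sym (polyRing k) (CommutativeRing.+-identityʳ (polyRing k) _))
      ; (suc i) → CommutativeRing.refl (polyRing k) }

    constP-nonzero : ∀ k {x} → ¬ x ≡ + 0 → ¬ Eq k (constP k x) (zeroP k)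
    constP-nonzero zero    x≢0 (base e) = x≢0 e
    constP-nonzero (suc k) x≢0 (step e) = constP-nonzero k x≢0 (e 0)

    module L₁ = ListRing 0 (isPolyRing 0)
    module L₃ = ListRing 2 (isPolyRing 2)

  coef-embed1 : ∀ x i → coef 2 (embed1 x) i C.≈ constP 2 (coef 0 x i)
  coef-embed1 []       i       = C.sym (constP-zero 2)
  coef-embed1 (x ∷ xs) zero    = C.refl
  coef-embed1 (x ∷ xs) (suc i) = coef-embed1 xs i

  embed1-cong : ∀ {x y} → x P.≈ y → embed1 x R.≈ embed1 y
  embed1-cong {x} {y} (step e) = step λ i → C.trans (coef-embed1 x i)
    (C.trans (C.reflexive (≡.cong (constP 2) (Eq⇒≡ (e i)))) (C.sym (coef-embed1 y i)))

  embed1-+ : ∀ x y → embed1 (x P.+ y) R.≈ embed1 x R.+ embed1 y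
  embed1-+ []       y        = R.refl
  embed1-+ (x ∷ xs) []       = R.refl
  embed1-+ (x ∷ xs) (y ∷ ys) = constP-+ 2 x y L₃.∷-cong embed1-+ xs ys

  embed1-neg : ∀ x → embed1 (P.- x) R.≈ R.- embed1 x
  embed1-neg []       = R.refl
  embed1-neg (x ∷ xs) = constP-neg 2 x L₃.∷-cong embed1-neg xs

  embed1-* : ∀ x y → embed1 (x P.* y) R.≈ embed1 x R.* embed1 y
  embed1-* []       y = R.refl
  embed1-* (x ∷ xs) y = R.trans (embed1-+ (scaleP 0 x y) (+ 0 ∷ mulP 1 xs y))
    (R.+-cong (scale y) (constP-zero 2 L₃.∷-cong embed1-* xs y))
    where
    scale : ∀ y → embed1 (scaleP 0 x y) R.≈ scaleP 2 (constP 2 x) (embed1 y)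
    scale []       = R.refl
    scale (y ∷ ys) = constP-* 2 x y L₃.∷-cong scale ys

  embed1-^ : ∀ x n → embed1 (x PB.^ n) R.≈ embed1 x RB.^ n
  embed1-^ x zero    = R.refl
  embed1-^ x (suc n) = R.trans (embed1-* x (x PB.^ n)) (R.*-congˡ {embed1 x} (embed1-^ x n))

  embed1-prod : ∀ n f → embed1 (PB.prod n f) R.≈ RB.prod n (λ i → embed1 (f i))
  embed1-prod zero    f = R.refl
  embed1-prod (suc n) f = R.trans (embed1-* (PB.prod n f) (f n)) (R.*-congʳ {embed1 (f n)} (embed1-prod n f))

  embed1-q : embed1 qvar1 R.≈ qP
  embed1-q = constP-zero 2 L₃.∷-cong R.refl

  embed1-q^ : ∀ k → embed1 (qvar1 PB.^ k) R.≈ qP RB.^ k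
  embed1-q^ k = R.trans (embed1-^ qvar1 k) (RB.^-congˡ k embed1-q)

  embed1-constant : ∀ {c} → IsConstant 0 c → IsConstant 2 (embed1 c)
  embed1-constant (c , c≉0 , e) = constP 2 c , constP-nonzero 2 (λ c≡0 → c≉0 (base c≡0)) , embed1-cong e

  open Localisation (polyDomain 2)
  private module L₁oc = Localisation (polyDomain 0)

  -- A Bézout identity in ℤ[q] is preserved, and its nonzero integer is still a nonzero constant.
  embed1-coprime : ∀ {x y} → L₁oc.Coprime x y → Coprime (embed1 x) (embed1 y)
  embed1-coprime {x} {y} (L₁oc.bézout X Y c k e) = bézout (embed1 X) (embed1 Y) (embed1 c) (embed1-constant k)
    (R.trans (R.+-cong (R.sym (embed1-* X x)) (R.sym (embed1-* Y y)))
      (R.trans (R.sym (embed1-+ (X P.* x) (Y P.* y))) (embed1-cong e)))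

  -- Φ 1 = q − 1 is replaced by 1 − q, so that 1 − q^j is the product of the φ m over the divisors m of j.
  φ : ℕ → P3
  φ zero          = R.1#
  φ (suc zero)    = R.1# R.- qP
  φ (suc (suc m)) = embed1 (Φ (suc (suc m)))

  private
    open RingProperties R.ring using (-‿involutive; -‿distribˡ-*; ⁻¹-anti-homo‿-)

    embed1-q^-1 : ∀ j → embed1 (qvar1 PB.^ j P.- P.1#) R.≈ R.- (R.1# R.- qP RB.^ j)
    embed1-q^-1 j = R.trans (embed1-+ (qvar1 PB.^ j) (P.- P.1#)) (R.trans (R.+-congʳ {R.- R.1#} (embed1-q^ j))
      (R.sym (⁻¹-anti-homo‿- R.1# (qP RB.^ j))))

    embed1-Φ1 : embed1 (Φ 1) R.≈ R.- (R.1# R.- qP)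
    embed1-Φ1 = R.trans (embed1-cong (P.sym (P.trans (q^-1-factors 1 1 ℕ.z<s ℕₚ.≤-refl)
        (P.trans (P.*-identityˡ _) (P.*-identityʳ (Φ 1))))))
      (R.trans (embed1-q^-1 1) (R.-‿cong (R.+-congˡ {R.1#} (R.-‿cong (R.*-identityʳ qP)))))

    coprime-neg : ∀ {x y z} → x R.≈ R.- z → Coprime x y → Coprime z y
    coprime-neg {x} {y} {z} x≈ (bézout X Y c k e) = bézout (R.- X) Y c k (R.trans (R.+-congʳ {Y R.* y}
      (R.trans (R.sym (-‿distribˡ-* X z)) (R.trans (distribʳ X z) (R.*-congˡ {X} (R.sym x≈))))) e)
      where open RingProperties R.ring using () renaming (-‿distribʳ-* to distribʳ)

  φ-coprime : ∀ {i j} → ¬ i ≡ j → Coprime (φ (suc i)) (φ (suc j))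
  φ-coprime {zero}  {zero}  i≢j = contradiction ≡.refl i≢j
  φ-coprime {zero}  {suc j} i≢j = coprime-neg embed1-Φ1 (embed1-coprime (Φ-coprime i≢j))
  φ-coprime {suc i} {zero}  i≢j = coprime-sym (coprime-neg embed1-Φ1 (coprime-sym (embed1-coprime (Φ-coprime i≢j))))
  φ-coprime {suc i} {suc j} i≢j = embed1-coprime (Φ-coprime i≢j)

  1-q^-factors : ∀ B j → 0 < j → j ≤ B →
    R.1# R.- qP RB.^ j R.≈ RB.prod B (λ i → φ (suc i) RB.^ divides? (suc i) j)
  1-q^-factors zero    j 0<j j≤B = contradiction j≤B (ℕₚ.<⇒≱ 0<j)
  1-q^-factors (suc B) j 0<j j≤B = begin
    R.1# R.- qP RB.^ j
      ≈⟨ R.trans (R.-‿cong (embed1-q^-1 j)) (-‿involutive _) ⟨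
    R.- embed1 (qvar1 PB.^ j P.- P.1#)
      ≈⟨ R.-‿cong (R.trans (embed1-cong (q^-1-factors (suc B) j 0<j j≤B)) (embed1-prod (suc B) (λ i → Φ (suc i) PB.^ divides? (suc i) j))) ⟩
    R.- RB.prod (suc B) (λ i → embed1 (Φ (suc i) PB.^ divides? (suc i) j))
      ≈⟨ R.-‿cong (R.trans (RB.prod-sucˡ B _) (R.*-cong first (RB.prod-cong B λ i → embed1-^ (Φ (suc (suc i))) (divides? (suc (suc i)) j)))) ⟩
    R.- (R.- (R.1# R.- qP) R.* rest)
      ≈⟨ R.trans (R.-‿cong (R.sym (-‿distribˡ-* (R.1# R.- qP) rest))) (-‿involutive _) ⟩
    (R.1# R.- qP) R.* rest
      ≈⟨ R.*-congʳ {rest} (R.sym φ1^) ⟩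
    φ 1 RB.^ divides? 1 j R.* rest
      ≈⟨ RB.prod-sucˡ B (λ i → φ (suc i) RB.^ divides? (suc i) j) ⟨
    RB.prod (suc B) (λ i → φ (suc i) RB.^ divides? (suc i) j) ∎
    where
    open SetoidReasoning R.setoid
    rest = RB.prod B (λ i → φ (suc (suc i)) RB.^ divides? (suc (suc i)) j)
    φ1^ : φ 1 RB.^ divides? 1 j R.≈ R.1# R.- qP
    φ1^ = R.trans (R.reflexive (≡.cong (φ 1 RB.^_) (divides?-yes (1∣ j)))) (R.*-identityʳ (φ 1))
    first : embed1 (Φ 1 PB.^ divides? 1 j) R.≈ R.- (R.1# R.- qP)
    first = R.trans (R.reflexive (≡.cong (λ k → embed1 (Φ 1 PB.^ k)) (divides?-yes (1∣ j))))
      (R.trans (embed1-cong (P.*-identityʳ (Φ 1))) embed1-Φ1)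

  embed1-qint : ∀ n → (R.1# R.- qP) R.* embed1 (qintPoly n) R.≈ R.1# R.- qP RB.^ n
  embed1-qint zero    = R.trans (R.zeroʳ (R.1# R.- qP)) (R.sym (R.-‿inverseʳ R.1#))
  embed1-qint (suc n) = begin
    (R.1# R.- qP) R.* embed1 (addP 1 (qintPoly n) (powP 1 qvar1 n))
      ≈⟨ R.*-congˡ {R.1# R.- qP} (R.trans (embed1-+ (qintPoly n) (powP 1 qvar1 n)) (R.+-congˡ {embed1 (qintPoly n)}
           (R.trans (R.reflexive (≡.cong embed1 (powP≡^ qvar1 n))) (embed1-q^ n)))) ⟩
    (R.1# R.- qP) R.* (embed1 (qintPoly n) R.+ qP RB.^ n)
      ≈⟨ R.trans (R.distribˡ (R.1# R.- qP) (embed1 (qintPoly n)) (qP RB.^ n)) (R.+-congʳ {(R.1# R.- qP) R.* qP RB.^ n} (embed1-qint n)) ⟩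
    (R.1# R.- qP RB.^ n) R.+ (R.1# R.- qP) R.* qP RB.^ n
      ≈⟨ solve 2 (λ q x → (:1 :- x) :+ (:1 :- q) :* x := :1 :- q :* x) R.refl qP (qP RB.^ n) ⟩
    R.1# R.- qP RB.^ suc n ∎
    where
    open SetoidReasoning R.setoid
    open Solver (polyRing 3)

-- The formal fractions of the statement as elements of the fraction field.

module Link where

  open import Defs
  open PolyRing
  open Embedding
  open import Data.Integer.Base as ℤ using (ℤ; +_)

  open FractionRing (polyRing 3) (noZeroDivisors 3) (1≉0 3)
  open Congruence (polyDomain 2)
  open K
  open Solver fractionRing
  open import Relation.Binary.Reasoning.Setoid setoid
  open Localisation (polyDomain 2) using (Coprime; bézout; coprime-factorʳ; module Modulo)
  private
    module S₂ = Solver (polyRing 2)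
    module L₁ = ListRing 0 (isPolyRing 0)
    module L₂ = ListRing 1 (isPolyRing 1)
    module L₃ = ListRing 2 (isPolyRing 2)

  infix 4 _~_
  -- A formal fraction is a bare pair of polynomials; this relation supplies its value together with
  -- the proof that its denominator is not zero.
  record _~_ (x : Frac) (ξ : Carrier) : Set where
    constructor represents
    field
      den≉0    : ¬ proj₂ x R.≈ R.0#
      equation : ξ * ι (proj₂ x) ≈ ι (proj₁ x)

  ~-resp : ∀ {x ξ η} → ξ ≈ η → x ~ ξ → x ~ η
  ~-resp e (represents d f) = represents d (trans (*-congʳ (sym e)) f)

  ~-fromP : ∀ u → fromP u ~ ι u
  ~-fromP u = represents (1≉0 3) (trans (*-congˡ ι-1) (*-identityʳ (ι u)))

  ~-1 : 1F ~ 1#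
  ~-1 = ~-resp ι-1 (~-fromP R.1#)

  ~-* : ∀ {x y ξ η} → x ~ ξ → y ~ η → x *F y ~ ξ * η
  ~-* {a , b} {c , d} {ξ} {η} (represents b≉0 e) (represents d≉0 f) = represents (*-nonzero b≉0 d≉0) (begin
    ξ * η * ι (b R.* d)  ≈⟨ *-congˡ (ι-* b d) ⟩
    ξ * η * (ι b * ι d)  ≈⟨ solve 4 (λ x y b d → x :* y :* (b :* d) := x :* b :* (y :* d)) refl ξ η (ι b) (ι d) ⟩
    ξ * ι b * (η * ι d)  ≈⟨ *-cong e f ⟩
    ι a * ι c            ≈⟨ ι-* a c ⟨
    ι (a R.* c)          ∎)

  ~-+ : ∀ {x y ξ η} → x ~ ξ → y ~ η → x +F y ~ ξ + η
  ~-+ {a , b} {c , d} {ξ} {η} (represents b≉0 e) (represents d≉0 f) = represents (*-nonzero b≉0 d≉0) (begin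
    (ξ + η) * ι (b R.* d)          ≈⟨ *-congˡ (ι-* b d) ⟩
    (ξ + η) * (ι b * ι d)          ≈⟨ solve 4 (λ x y b d → (x :+ y) :* (b :* d) := x :* b :* d :+ y :* d :* b) refl ξ η (ι b) (ι d) ⟩
    ξ * ι b * ι d + η * ι d * ι b  ≈⟨ +-cong (*-congʳ e) (*-congʳ f) ⟩
    ι a * ι d + ι c * ι b          ≈⟨ trans (ι-+ (a R.* d) (c R.* b)) (+-cong (ι-* a d) (ι-* c b)) ⟨
    ι (a R.* d R.+ c R.* b)        ∎)

  ~-neg : ∀ {x ξ} → x ~ ξ → (R.- proj₁ x , proj₂ x) ~ - ξ
  ~-neg {a , b} {ξ} (represents b≉0 e) = represents b≉0 (begin
    - ξ * ι b    ≈⟨ solve 2 (λ x b → :- x :* b := :- (x :* b)) refl ξ (ι b) ⟩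
    - (ξ * ι b)  ≈⟨ -‿cong e ⟩
    - ι a        ≈⟨ ι-neg a ⟨
    ι (R.- a)    ∎)

  ~-- : ∀ {x y ξ η} → x ~ ξ → y ~ η → x -F y ~ ξ - η
  ~-- {a , b} {c , d} {ξ} {η} p q = represents (_~_.den≉0 sum)
    (trans (_~_.equation sum) (ι-cong (R.+-congˡ {a R.* d} (R.sym (-‿distribˡ-* c b)))))
    where
    open import Algebra.Properties.Ring R.ring using (-‿distribˡ-*)
    sum : (a R.* d R.+ R.- c R.* b , b R.* d) ~ ξ - η
    sum = ~-+ p (~-neg q)

  -- A fraction with an invertible value has a nonzero numerator, which may therefore serve as a
  -- denominator.
  ~-inv : ∀ {y η η′} → y ~ η → η * η′ ≈ 1# → invF y ~ η′
  ~-inv {c , d} {η} {η′} (represents d≉0 f) inverse = represents c≉0 (begin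
    η′ * ι c        ≈⟨ *-congˡ f ⟨
    η′ * (η * ι d)  ≈⟨ solve 3 (λ x y d → x :* (y :* d) := y :* x :* d) refl η′ η (ι d) ⟩
    η * η′ * ι d    ≈⟨ trans (*-congʳ inverse) (*-identityˡ (ι d)) ⟩
    ι d             ∎)
    where
    c≉0 : ¬ c R.≈ R.0#
    c≉0 c≈0 = d≉0 (ι-injective (begin
      ι d             ≈⟨ trans (*-congʳ inverse) (*-identityˡ (ι d)) ⟨
      η * η′ * ι d    ≈⟨ solve 3 (λ x y d → y :* x :* d := x :* (y :* d)) refl η′ η (ι d) ⟩
      η′ * (η * ι d)  ≈⟨ *-congˡ (trans f (trans (ι-cong c≈0) ι-0)) ⟩
      η′ * 0#         ≈⟨ zeroʳ η′ ⟩
      0#              ≈⟨ ι-0 ⟨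
      ι R.0#          ∎))

  ~-/ : ∀ {x y ξ η η′} → x ~ ξ → y ~ η → η * η′ ≈ 1# → x /F y ~ ξ * η′
  ~-/ p q inverse = ~-* p (~-inv q inverse)

  ~-^ : ∀ {x ξ} → x ~ ξ → ∀ n → powF x n ~ ξ KB.^ n
  ~-^ p zero    = ~-1
  ~-^ p (suc n) = ~-* p (~-^ p n)

  ~-qpoch : ∀ {x y ξ η} → x ~ ξ → y ~ η → ∀ n → qpoch x y n ~ KB.prod n (λ l → 1# - ξ * η KB.^ l)
  ~-qpoch p q zero    = ~-1
  ~-qpoch p q (suc n) = ~-* (~-qpoch p q n) (~-- ~-1 (~-* p (~-^ q n)))

  ~-sum : ∀ n {f g} → (∀ k → f k ~ g k) → sumF n f ~ KB.sum n g
  ~-sum zero    h = ~-resp ι-0 (~-fromP R.0#)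
  ~-sum (suc n) h = ~-+ (~-sum n h) (h n)

  private
    constant-coefficient : P3 → Poly 2
    constant-coefficient x = coef 2 x 0

    constant-coefficient-q^ : ∀ j → constant-coefficient (qP RB.^ suc j) C.≈ C.0#
    constant-coefficient-q^ j = C.trans (L₃.constant-⊗ qP (qP RB.^ j)) (C.zeroˡ (constant-coefficient (qP RB.^ j)))

    constant-coefficient-- : ∀ x y → constant-coefficient (x R.- y) C.≈ constant-coefficient x C.- constant-coefficient y
    constant-coefficient-- x y = C.trans (L₃.coef-⊕ x (R.- y) 0) (C.+-congˡ {constant-coefficient x} (L₃.coef-neg y 0))

    -- Polynomials in q are seen to be nonzero at q = 0.
    nonzero-by : ∀ {x c} → constant-coefficient x C.≈ c → ¬ c C.≈ C.0# → ¬ x R.≈ R.0#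
    nonzero-by e c≉0 (step f) = c≉0 (C.trans (C.sym e) (f 0))

    minus-zero : ∀ x {y} → y C.≈ C.0# → x C.- y C.≈ x
    minus-zero x {y} e = C.trans (C.+-congˡ {x} (C.-‿cong e)) (S₂.solve 1 (λ x → x S₂.:- S₂.con (+ 0) S₂.:= x) C.refl x)

  q≉0 : ¬ qP R.≈ R.0#
  q≉0 (step e) = 1≉0 2 (e 1)

  1-q^≉0 : ∀ j → ¬ R.1# R.- qP RB.^ suc j R.≈ R.0#
  1-q^≉0 j = nonzero-by (C.trans (constant-coefficient-- R.1# (qP RB.^ suc j)) (minus-zero C.1# (constant-coefficient-q^ j))) (1≉0 2)

  module Summation (n d : ℕ) (1<n : 1 < n) (3≤d : 3 ≤ d) (n⊥d : ℕC.Coprime n d) where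

    open Setup n d 1<n 3≤d n⊥d qP φ R.refl φ-coprime 1-q^-factors q≉0 1-q^≉0

    private
      -- The value at a = b = 0. It is 0 for a and for b, hence 1 for 1 - a^k and 1 - b^k with k >
      -- 0, which are therefore not zero.
      augmentation : Poly 2 → ℤ
      augmentation x = coef 0 (coef 1 x 0) 0

      augmentation-* : ∀ x y → augmentation (x C.* y) ≡ augmentation x ℤ.* augmentation y
      augmentation-* x y = Eq⇒≡ (Z.trans (coef-cong (L₂.constant-⊗ x y) 0) (L₁.constant-⊗ (coef 1 x 0) (coef 1 y 0)))

      augmentation-1- : ∀ x → augmentation x ≡ + 0 → augmentation (C.1# C.- x) ≡ + 1
      augmentation-1- x e = ≡.trans (Eq⇒≡ (Z.trans (coef-cong (P.trans (L₂.coef-⊕ C.1# (C.- x) 0)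
        (P.+-congˡ {P.1#} (L₂.coef-neg x 0))) 0) (Z.trans (L₁.coef-⊕ P.1# (P.- coef 1 x 0) 0)
          (Z.+-congˡ {+ 1} (L₁.coef-neg (coef 1 x 0) 0))))) (≡.cong (λ z → + 1 ℤ.+ (ℤ.- z)) e)

      augmentation-^ : ∀ c → augmentation c ≡ + 0 → ∀ k → 0 < k → augmentation (c CB.^ k) ≡ + 0
      augmentation-^ c e (suc k) _ = ≡.trans (augmentation-* c (c CB.^ k))
        (≡.trans (≡.cong (ℤ._* augmentation (c CB.^ k)) e) (ℤₚ.*-zeroˡ (augmentation (c CB.^ k))))

      nonzero : ∀ c → augmentation c ≡ + 0 → ∀ k → 0 < k → ¬ C.1# C.- c CB.^ k C.≈ C.0#
      nonzero c e k 0<k f = contradiction (≡.trans (≡.sym (augmentation-1- (c CB.^ k) (augmentation-^ c e k 0<k)))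
        (Eq⇒≡ (coef-cong (coef-cong f 0) 0))) λ ()

      constQ-^ : ∀ c k → constQ c RB.^ k R.≈ constQ (c CB.^ k)
      constQ-^ c zero    = R.refl
      constQ-^ c (suc k) = R.trans (R.*-congˡ {constQ c} (constQ-^ c k))
        (step λ { zero → C.+-identityʳ (c C.* c CB.^ k) ; (suc i) → C.refl })

      constant-coefficient-cq^ : ∀ c j → 0 < j → constant-coefficient (constQ c R.* qP RB.^ j) C.≈ C.0#
      constant-coefficient-cq^ c (suc j) _ = C.trans (L₃.constant-⊗ (constQ c) (qP RB.^ suc j))
        (C.trans (C.*-congˡ {c} (constant-coefficient-q^ j)) (C.zeroʳ c))

    indeterminate : ∀ c → ¬ c C.≈ C.0# → augmentation c ≡ + 0 → Indeterminate (constQ c)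
    indeterminate c c≉0 e = record
      { const-y   = c , c≉0 , R.refl
      ; const-1-y = λ k 0<k → C.1# C.- c CB.^ k , nonzero c e k 0<k ,
          R.+-congˡ {R.1#} (R.-‿cong (constQ-^ c k))
      ; const-y-1 = λ k 0<k → c CB.^ k C.- C.1# , (λ f → nonzero c e k 0<k (C.trans (swap k) (C.trans (C.-‿cong f) C.refl))) ,
          R.+-congʳ {R.- R.1#} (constQ-^ c k)
      ; y≉0       = λ f → c≉0 (coef-cong f 0)
      ; 1-yq^≉0   = λ j 0<j → nonzero-by (C.trans (constant-coefficient-- R.1# (constQ c R.* qP RB.^ j))
          (minus-zero C.1# (constant-coefficient-cq^ c j 0<j))) (1≉0 2)
      ; y-q^≉0    = λ { (suc j) _ → nonzero-by (C.trans (constant-coefficient-- (constQ c) (qP RB.^ suc j))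
          (minus-zero c (constant-coefficient-q^ j))) c≉0 } }
      where
      swap : ∀ k → C.1# C.- c CB.^ k C.≈ C.- (c CB.^ k C.- C.1#)
      swap k = S₂.solve 1 (λ x → S₂.:1 S₂.:- x S₂.:= S₂.:- (x S₂.:- S₂.:1)) C.refl (c CB.^ k)

    module T = Sum aP bP
      (indeterminate (zeroP 1 ∷ oneP 1 ∷ []) (λ f → 1≉0 1 (coef-cong f 1)) ≡.refl)
      (indeterminate ((+ 0 ∷ + 1 ∷ []) ∷ []) (λ f → contradiction (Eq⇒≡ (coef-cong (coef-cong f 0) 1)) λ ()) ≡.refl)

    private
      ~-q : qF ~ qK
      ~-q = ~-fromP qP

      ~-r : invF qF ~ r
      ~-r = ~-inv ~-q qr≈1

      ~-p : powF qF d ~ p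
      ~-p = ~-^ ~-q d

      ~-zpow : ∀ m → zpowF qF (+ m ℤ.- + 1) ~ qK KB.^ m * r
      ~-zpow zero    = ~-resp (*-comm r 1#) (~-^ ~-r 1)
      ~-zpow (suc m) = ~-resp (begin
          qK KB.^ m           ≈⟨ trans (*-congʳ qr≈1) (*-identityˡ _) ⟨
          qK * r * qK KB.^ m  ≈⟨ solve 3 (λ q r x → q :* r :* x := q :* x :* r) refl qK r (qK KB.^ m) ⟩
          qK KB.^ suc m * r   ∎)
        (~-^ ~-q m)

      q^1 : 1# - qK ≈ ι (R.1# R.- qP RB.^ 1)
      q^1 = trans (+-congˡ (-‿cong (ι-cong (R.sym (R.*-identityʳ qP))))) (sym (ι-1- _))

      ~-qint : ∀ m → qint (+ m ℤ.- + 1) ~ (1# - qK KB.^ m * r) * κ 1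
      ~-qint m = ~-/ (~-- ~-1 (~-zpow m)) (~-- ~-1 ~-q) (trans (*-congʳ q^1) (κ-inverse 1 ℕ.z<s))

      product-inverse : ∀ k {f g} → (∀ l → f l * g l ≈ 1#) → KB.prod k f * KB.prod k g ≈ 1#
      product-inverse k e = trans (sym (KB.prod-* k _ _)) (KB.prod-one k λ l _ → e l)

      commuted : ∀ y x β → (1# - p * y * x) * β ≈ 1# → (1# - y * p * x) * β ≈ 1#
      commuted y x β e = trans (*-congʳ (+-congˡ (-‿cong (*-congʳ (*-comm y p))))) e

      prod-split : ∀ k (f g : ℕ → Carrier) (x : Carrier) (u : ℕ → Carrier) (v : ℕ → Carrier) →
        KB.prod k (λ l → f l * g l * x * (u l * v l)) ≈
        KB.prod k f * KB.prod k g * x KB.^ k * (KB.prod k u * KB.prod k v)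
      prod-split k f g x u v = trans (KB.prod-* k _ _) (*-cong
        (trans (KB.prod-* k _ _) (*-cong (KB.prod-* k f g) (KB.prod-^ k x)))
        (KB.prod-* k u v))

      multiply-inverses : ∀ {a b c d e f a′ b′ c′ d′ e′ f′} →
        a * a′ ≈ 1# → b * b′ ≈ 1# → c * c′ ≈ 1# → d * d′ ≈ 1# → e * e′ ≈ 1# → f * f′ ≈ 1# →
        a * b * c * d * e * f * (a′ * b′ * c′ * d′ * e′ * f′) ≈ 1#
      multiply-inverses {a} {b} {c} {d} {e} {f} {a′} {b′} {c′} {d′} {e′} {f′} p₁ p₂ p₃ p₄ p₅ p₆ =
        inverse-* (inverse-* (inverse-* (inverse-* (inverse-* p₁ p₂) p₃) p₄) p₅) p₆
        where
        inverse-* : ∀ {x y x′ y′} → x * x′ ≈ 1# → y * y′ ≈ 1# → x * y * (x′ * y′) ≈ 1#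
        inverse-* {x} {y} {x′} {y′} e f = trans
          (solve 4 (λ x y x′ y′ → x :* y :* (x′ :* y′) := x :* x′ :* (y :* y′)) refl x y x′ y′)
          (trans (*-cong e f) (*-identityʳ 1#))

    ~-summand : ∀ k → summand d k ~ κ 1 * (c k * (T.PA.QA.term k * T.PB.QA.term k))
    ~-summand k = ~-resp value (~-* (~-* (~-qint (2 ℕ.* d ℕ.* k)) (~-/
        (~-* (~-* (~-* (~-* (~-* (~-qpoch (~-* ~-a ~-r) ~-p k) (~-qpoch (~-/ ~-r ~-a T.PA.yy⁻≈1) ~-p k))
          (~-qpoch (~-* ~-b ~-r) ~-p k)) (~-qpoch (~-/ ~-r ~-b T.PB.yy⁻≈1) ~-p k))
          (~-qpoch ~-r ~-p k)) (~-qpoch ~-r ~-p k))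
        (~-* (~-* (~-* (~-* (~-* (~-qpoch (~-* ~-a ~-p) ~-p k) (~-qpoch (~-/ ~-p ~-a T.PA.yy⁻≈1) ~-p k))
          (~-qpoch (~-* ~-b ~-p) ~-p k)) (~-qpoch (~-/ ~-p ~-b T.PB.yy⁻≈1) ~-p k))
          (~-qpoch ~-p ~-p k)) (~-qpoch ~-p ~-p k))
        (multiply-inverses
          (product-inverse k λ l → commuted (ι aP) (p KB.^ l) (T.PA.β l) (T.PA.β-inverse l))
          (product-inverse k T.PA.β⁻-inverse)
          (product-inverse k λ l → commuted (ι bP) (p KB.^ l) (T.PB.β l) (T.PB.β-inverse l))
          (product-inverse k T.PB.β⁻-inverse)
          (product-inverse k e-inverse) (product-inverse k e-inverse))))
        (~-^ ~-q ((2 ℕ.* d ℕ.+ 3) ℕ.* k)))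
      where
      ~-a : aF ~ ι aP
      ~-a = ~-fromP aP
      ~-b : bF ~ ι bP
      ~-b = ~-fromP bP
      A₁ = KB.prod k (λ l → 1# - ι aP * r * p KB.^ l)
      A₂ = KB.prod k (λ l → 1# - r * T.PA.y⁻ * p KB.^ l)
      B₁ = KB.prod k (λ l → 1# - ι bP * r * p KB.^ l)
      B₂ = KB.prod k (λ l → 1# - r * T.PB.y⁻ * p KB.^ l)
      N  = KB.prod k (λ l → 1# - r * p KB.^ l)
      α₁ = KB.prod k T.PA.β
      α₂ = KB.prod k T.PA.β⁻
      β₁ = KB.prod k T.PB.β
      β₂ = KB.prod k T.PB.β⁻
      E  = KB.prod k e
      V  = 1# - r * (p KB.^ k * p KB.^ k)
      s  = (qK * p) KB.^ k
      -- The very-well-poised factor 1 - q^(2dk-1), for which the name stands, in the base p.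
      vwp : 1# - qK KB.^ (2 ℕ.* d ℕ.* k) * r ≈ V
      vwp = +-congˡ (-‿cong (trans (*-comm _ r) (*-congˡ (begin
        qK KB.^ (2 ℕ.* d ℕ.* k)                ≡⟨ ≡.cong (qK KB.^_) (double d k) ⟩
        qK KB.^ (d ℕ.* k ℕ.+ d ℕ.* k)          ≈⟨ KB.^-homo-* qK (d ℕ.* k) (d ℕ.* k) ⟩
        qK KB.^ (d ℕ.* k) * qK KB.^ (d ℕ.* k)  ≈⟨ *-cong (KB.^-assocʳ qK d k) (KB.^-assocʳ qK d k) ⟨
        p KB.^ k * p KB.^ k                    ∎))))
        where
        double : ∀ d k → 2 ℕ.* d ℕ.* k ≡ d ℕ.* k ℕ.+ d ℕ.* k
        double = solve-∀
      -- Since (2d + 3) k = k + 2 (d + 1) k, each `term` receives one power (qp)^k, and q^k goes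
      -- into `weight`.
      argument : qK KB.^ ((2 ℕ.* d ℕ.+ 3) ℕ.* k) ≈ qK KB.^ k * (s * s)
      argument = begin
        qK KB.^ ((2 ℕ.* d ℕ.+ 3) ℕ.* k)
          ≡⟨ ≡.cong (qK KB.^_) (expand d k) ⟩
        qK KB.^ (k ℕ.+ ((k ℕ.+ d ℕ.* k) ℕ.+ (k ℕ.+ d ℕ.* k)))
          ≈⟨ trans (KB.^-homo-* qK k _) (*-congˡ (KB.^-homo-* qK (k ℕ.+ d ℕ.* k) _)) ⟩
        qK KB.^ k * (qK KB.^ (k ℕ.+ d ℕ.* k) * qK KB.^ (k ℕ.+ d ℕ.* k))
          ≈⟨ *-congˡ (*-cong half half) ⟩
        qK KB.^ k * (s * s) ∎
        where
        expand : ∀ d k → (2 ℕ.* d ℕ.+ 3) ℕ.* k ≡ k ℕ.+ ((k ℕ.+ d ℕ.* k) ℕ.+ (k ℕ.+ d ℕ.* k))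
        expand = solve-∀
        half : qK KB.^ (k ℕ.+ d ℕ.* k) ≈ s
        half = trans (KB.^-homo-* qK k (d ℕ.* k)) (trans (*-congˡ (sym (KB.^-assocʳ qK d k))) (sym (KB.^-*-distrib qK p k)))
      value : (1# - qK KB.^ (2 ℕ.* d ℕ.* k) * r) * κ 1
          * (A₁ * A₂ * B₁ * B₂ * N * N * (α₁ * α₂ * β₁ * β₂ * E * E))
          * qK KB.^ ((2 ℕ.* d ℕ.+ 3) ℕ.* k)
        ≈ κ 1 * (c k * (T.PA.QA.term k * T.PB.QA.term k))
      value = begin
        (1# - qK KB.^ (2 ℕ.* d ℕ.* k) * r) * κ 1
          * (A₁ * A₂ * B₁ * B₂ * N * N * (α₁ * α₂ * β₁ * β₂ * E * E))
          * qK KB.^ ((2 ℕ.* d ℕ.+ 3) ℕ.* k)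
          ≈⟨ *-cong (*-congʳ (*-congʳ vwp)) argument ⟩
        V * κ 1 * (A₁ * A₂ * B₁ * B₂ * N * N * (α₁ * α₂ * β₁ * β₂ * E * E)) * (qK KB.^ k * (s * s))
          ≈⟨ rearrange (κ 1) V (A₁ * A₂) B₁ B₂ N (α₁ * α₂) β₁ β₂ E (qK KB.^ k) s ⟩
        κ 1 * (V * (qK KB.^ k * ((N * E) * (N * E))) * ((A₁ * A₂ * s * (α₁ * α₂)) * (B₁ * B₂ * s * (β₁ * β₂))))
          ≈⟨ *-congˡ (*-cong (*-congˡ (*-congˡ (*-cong (KB.prod-* k _ _) (KB.prod-* k _ _))))
               (*-cong (prod-split k _ _ _ _ _) (prod-split k _ _ _ _ _))) ⟨
        κ 1 * (c k * (T.PA.QA.term k * T.PB.QA.term k)) ∎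
        where
        rearrange : ∀ κ V A B₁ B₂ N α β₁ β₂ E Q s →
          V * κ * (A * B₁ * B₂ * N * N * (α * β₁ * β₂ * E * E)) * (Q * (s * s)) ≈
          κ * (V * (Q * ((N * E) * (N * E))) * ((A * s * α) * (B₁ * B₂ * s * (β₁ * β₂))))
        rearrange = solve 12 (λ κ V A B₁ B₂ N α β₁ β₂ E Q s →
          V :* κ :* (A :* B₁ :* B₂ :* N :* N :* (α :* β₁ :* β₂ :* E :* E)) :* (Q :* (s :* s)) :=
          κ :* (V :* (Q :* ((N :* E) :* (N :* E))) :* ((A :* s :* α) :* (B₁ :* B₂ :* s :* (β₁ :* β₂)))))
          refl

-- The congruences in the form of the statement.

open import Defs
open PolyRing
open Embedding
open Link

open FractionRing (polyRing 3) (noZeroDivisors 3) (1≉0 3)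
open Congruence (polyDomain 2)
open Localisation (polyDomain 2) using (Coprime; bézout; coprime-factorʳ; coprime-cong; module Modulo)

coprime⇒CoprimeQ : ∀ {V P} → Coprime V P → CoprimeQ V P
coprime⇒CoprimeQ {V} {P} (bézout X Y c (c₀ , c₀≉0 , c≈) e) =
  X , Y , c₀ , (λ c₀≈0 → c₀≉0 (≈P⇒Eq 2 c₀ (zeroP 2) c₀≈0)) ,
  Eq⇒≈P 3 (X R.* V R.+ Y R.* P) (constQ c₀) (R.trans e c≈)

-- The required identity is `ξ` V = P U multiplied by the denominator D. The denominator V is known
-- to be coprime to Q; `factor` passes from this to the modulus P of the congruence.
multiple⇒≡0mod : ∀ {Q P P′ x ξ} → x ~ ξ → P R.≈ P′ → (∀ {V} → Coprime V Q → Coprime V P) →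
  Modulo.Multiple Q P ξ → ≡0mod x P′
multiple⇒≡0mod {Q} {P} {P′} {N , D} {ξ} (represents _ e) P≈ factor (Modulo.multiple-of U V V⊥Q f) =
  U , V , coprime⇒CoprimeQ (coprime-cong R.refl P≈ (factor V⊥Q)) ,
  Eq⇒≈P 3 (N R.* V) (P′ R.* U R.* D) (R.trans (ι-injective (begin
    ι (N R.* V)          ≈⟨ ι-* N V ⟩
    ι N K.* ι V          ≈⟨ K.*-congʳ e ⟨
    ξ K.* ι D K.* ι V    ≈⟨ K.trans (K.*-assoc ξ (ι D) (ι V)) (K.trans (K.*-congˡ (K.*-comm (ι D) (ι V))) (K.sym (K.*-assoc ξ (ι V) (ι D)))) ⟩
    ξ K.* ι V K.* ι D    ≈⟨ K.*-congʳ f ⟩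
    ι (P R.* U) K.* ι D  ≈⟨ ι-* (P R.* U) D ⟨
    ι (P R.* U R.* D)    ∎)) (R.*-congʳ {D} (R.*-congʳ {U} P≈)))
  where open SetoidReasoning K.setoid

module _ (n d : ℕ) (1<n : 1 < n) (3≤d : 3 ≤ d) (n⊥d : ℕC.Coprime n d) where

  open Setup n d 1<n 3≤d n⊥d qP φ R.refl φ-coprime 1-q^-factors q≉0 1-q^≉0
  private module T = Link.Summation n d 1<n 3≤d n⊥d

  -- Both sides become 1 - q^n when multiplied by 1 - q, which can be cancelled.
  [n]≈qint : [n] R.≈ embed1 (qintPoly n)
  [n]≈qint = *-cancelʳ (R.1# R.- qP) 1-q≉0 (R.trans (R.*-comm [n] (R.1# R.- qP)) (R.trans 1-q^n
    (R.trans (R.sym (embed1-qint n)) (R.*-comm (R.1# R.- qP) (embed1 (qintPoly n))))))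
    where
    1-q≉0 : ¬ R.1# R.- qP R.≈ R.0#
    1-q≉0 e = 1-q^≉0 0 (R.trans (R.+-congˡ {R.1#} (R.-‿cong (R.*-identityʳ qP))) e)

  Q≈ : Q R.≈ embed1 (mulP 1 (qintPoly n) (Φ n))
  Q≈ = R.trans (R.*-cong [n]≈qint (φ≈ n 1<n)) (R.sym (embed1-* (qintPoly n) (Φ n)))
    where
    φ≈ : ∀ m → 1 < m → φ m R.≈ embed1 (Φ m)
    φ≈ (suc zero)    (s≤s ())
    φ≈ (suc (suc m)) _ = R.refl

  lhs~total : lhs n d ~ T.T.total
  lhs~total = ~-sum n T.~-summand

  lhs-mod-[n] : ≡0mod (lhs n d) (embed1 (qintPoly n))
  lhs-mod-[n] = multiple⇒≡0mod {Q} {[n]} {embed1 (qintPoly n)} {lhs n d} {T.T.total} lhs~total [n]≈qint coprime-factorʳ T.T.total-[n]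

  lhs-mod-Q : d ∣ n ∸ 1 → ≡0mod (lhs n d) (embed1 (mulP 1 (qintPoly n) (Φ n)))
  lhs-mod-Q (divides t n-1≡t*d) = multiple⇒≡0mod {Q} {Q} {embed1 (mulP 1 (qintPoly n) (Φ n))} {lhs n d} {T.T.total} lhs~total Q≈ (λ h → h)
    -- As 1 < n, the truncated n ∸ 1 is the true predecessor, and n = d t + 1.
    (T.T.total-Q t (≡.trans (≡.sym (ℕₚ.m+[n∸m]≡n (ℕₚ.<⇒≤ 1<n))) (≡.cong suc (≡.trans n-1≡t*d (ℕₚ.*-comm t d)))))

theorem1p2 : (n d : ℕ) → 1 < n → 3 ≤ d → gcd n d ≡ 1 →
    (d ∣ (n ∸ 1) → ≡0mod (lhs n d) (embed1 (mulP 1 (qintPoly n) (Φ n))))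
    × (¬ (d ∣ (n ∸ 1)) → ≡0mod (lhs n d) (embed1 (qintPoly n)))
theorem1p2 n d 1<n 3≤d gcd≡1 =
  lhs-mod-Q n d 1<n 3≤d (ℕC.gcd≡1⇒coprime gcd≡1) ,
  λ _ → lhs-mod-[n] n d 1<n 3≤d (ℕC.gcd≡1⇒coprime gcd≡1)
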